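{- Let $k$ be an integer and let $G$ be a connected bipartite graph with bipartition classes $A$ and $B$, where $|A|=a$, $|B|=b$ and $b \ge a \ge k/2 \ge 4$. Suppose $G$ contains no path on $k$ vertices as a subgraph. Write $t = \lfloor (k-3)/2 \rfloor$. Then \[ |E(G)| \le t\, b + (a - t). \] Moreover, equality holds exactly in the following cases. If $k$ is odd, equality holds if and only if $G$ is isomorphic to the graph $B_1(a,b,k)$ obtained from the complete bipartite graph $K_{t,\,b}$ (with parts of sizes $t$ and $b$, the latter being the class $B$) by adding $a-t$ new pairwise non-adjacent vertices, each adjacent to the same single vertex of the part of size $b$. If $k$ is even, equality holds if and only if $G$ belongs to the family $\mathcal{B}_1(a,b,k)$ of graphs obtained from $K_{t,\,b}$ (with parts of sizes $t$ and $b$, the latter being the class $B$) by adding $a-t$ new pairwise non-adjacent vertices, each adjacent to exactly one (arbitrary, not necessarily the same) vertex of the part of size $b$.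
   Context: All graphs are finite, simple and undirected. $P_k$ denotes the path on $k$ vertices; $G$ being $P_k$-free means $G$ has no subgraph isomorphic to $P_k$. -}

module Defs where

open import Data.Nat using (ℕ; zero; suc; _+_; _*_; _∸_; _<ᵇ_)
open import Data.Nat.DivMod using (_/_)
open import Data.Fin using (Fin; toℕ; _≟_)
open import Data.Bool using (Bool; true; false; if_then_else_)
open import Data.Sum using (_⊎_; inj₁; inj₂)
open import Data.Product using (Σ; _×_)
open import Data.Empty using (⊥)
open import Data.List using (List; map; allFin)
open import Data.Nat.ListAction using (sum)
open import Relation.Nullary.Decidable using (⌊_⌋)
open import Relation.Binary.PropositionalEquality using (_≡_)
open import Function.Bundles using (_↔_; _⇔_; Inverse)
open import Function.Definitions using (Injective)

-- A bipartite graph with bipartition classes A = Fin a and B = Fin b,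
-- given by its (decidable) bipartite adjacency relation.  Vertex set is
-- Fin a ⊎ Fin b; every edge joins A to B, so the graph is simple.
BipGraph : ℕ → ℕ → Set
BipGraph a b = Fin a → Fin b → Bool

Vertex : ℕ → ℕ → Set
Vertex a b = Fin a ⊎ Fin b

Adj : ∀ {a b} → BipGraph a b → Vertex a b → Vertex a b → Set
Adj G (inj₁ i) (inj₂ j) = G i j ≡ true
Adj G (inj₂ j) (inj₁ i) = G i j ≡ true
Adj G (inj₁ _) (inj₁ _) = ⊥
Adj G (inj₂ _) (inj₂ _) = ⊥

edgeCount : ∀ {a b} → BipGraph a b → ℕ
edgeCount {a} {b} G =
  sum (map (λ i → sum (map (λ j → if G i j then 1 else 0) (allFin b))) (allFin a))

data Reach {a b} (G : BipGraph a b) : Vertex a b → Vertex a b → Set where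
  here : ∀ {u} → Reach G u u
  step : ∀ {u v w} → Adj G u v → Reach G v w → Reach G u w

Connected : ∀ {a b} → BipGraph a b → Set
Connected G = ∀ u v → Reach G u v

ContainsPath : ∀ {a b} → ℕ → BipGraph a b → Set
ContainsPath {a} {b} k G =
  Σ (Fin k → Vertex a b) λ p →
    Injective _≡_ _≡_ p ×
    (∀ (i j : Fin k) → toℕ j ≡ suc (toℕ i) → Adj G (p i) (p j))

-- graph isomorphism (not required to preserve the sides)
_≅_ : ∀ {a b a' b'} → BipGraph a b → BipGraph a' b' → Set
_≅_ {a} {b} {a'} {b'} G H =
  Σ (Vertex a b ↔ Vertex a' b') λ φ →
    ∀ u v → Adj G u v ⇔ Adj H (Inverse.to φ u) (Inverse.to φ v)

tOf : ℕ → ℕ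
tOf k = (k ∸ 3) / 2

-- Member of the family B₁(a,b,k): the A-vertices with index < t form,
-- together with B, a copy of K_{t,b}; each remaining A-vertex i (there are
-- a - t of them) is adjacent exactly to the single B-vertex f i.
-- (Values of f on indices < t are irrelevant.)
B1 : (a b k : ℕ) → (Fin a → Fin b) → BipGraph a b
B1 a b k f i j = if toℕ i <ᵇ tOf k then true else ⌊ f i ≟ j ⌋

{-# OPTIONS --safe #-}
module Submission where

-- Both parities follow from graphs without a path on 2t+4 vertices, for which
-- e + t < t b + a unless all but t vertices of A (or, if a = b, of B) have degree
-- at most 1.  This is proved by induction, deleting ends of longest paths, which are
-- never cut vertices.  Let P be a longest path with ends u and v in A and B.  If z, z′
-- are consecutive on P with v ~ z and u ~ z′, there is a cycle through P, and hence a
-- longer path; so d(u) + d(v) ≤ |P ∩ B| ≤ t + 1.  If instead both ends u and r of P lie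
-- in A, choose a spanning tree with root r through P of maximal total depth.  As b ≥ a
-- it has a leaf v in B, the neighbours of v are its ancestors, and the crossing argument
-- on P and the branch to v again gives d(u) + d(v) ≤ t + 1.  Hence for b > a a vertex of
-- B of degree at most t can be deleted, and for a = b a pair of vertices carrying at most
-- t + 1 edges.  Adding a vertex to an extremal graph in a way that does not lead to an
-- extremal graph again creates a path on 2t+4 vertices.  In the remaining case
-- a = b = t + 2, rotations at the ends of a longest path yield many vertices of small
-- degree, and the missing edges are counted as in Chvátal's theorem.

open import Defs
open import Data.Nat.Properties
open import Algebra.Properties.CommutativeSemigroup +-commutativeSemigroup using (x∙yz≈y∙xz; interchange)
import Data.Fin as Fin
import Data.List as List
import Data.Nat.ListAction as ListAction
open import Relation.Binary.PropositionalEquality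
import Data.Sum as Sum
import Data.Fin.Permutation as Perm
open import Data.Nat using (ℕ; zero; suc; _+_; _*_; _∸_; _≤_; _<_; z≤n; s≤s; _≤?_; _<?_; _<ᵇ_; _%_)
open import Data.Nat.Tactic.RingSolver using (solve-∀)
open import Data.Bool using (Bool; true; false; if_then_else_)
open import Data.Fin using (Fin; zero; suc; punchIn; punchOut; toℕ; fromℕ; inject≤; splitAt)
open import Data.List using (List; []; _∷_; _++_; reverse; allFin; take; initLast; _∷ʳ′_; length; lookup)
open import Data.List.Properties using (unfold-reverse; map-tabulate; ++-assoc; ∷-injective; ∷-injectiveʳ; ≡-dec)
open import Data.Sum using (_⊎_; inj₁; inj₂; swap; [_,_]′)
open import Data.Sum.Properties using (inj₁-injective; inj₂-injective) renaming (≡-dec to ⊎-≡-dec)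
open import Data.Product using (Σ; ∃; _×_; _,_; proj₁; proj₂)
open import Data.Empty using (⊥; ⊥-elim)
open import Function using (_∘_; flip; case_of_)
open import Relation.Nullary using (¬_; Dec; yes; no; does)
open import Relation.Nullary.Decidable using (map′; ¬?; _×-dec_; _⊎-dec_; decidable-stable; ⌊_⌋; isYes≗does)
open import Algebra.Properties.CommutativeMonoid.Sum +-0-commutativeMonoid using (sum-remove; ∑-distrib-+; ∑-comm; sum-cong-≗; sum-permute) renaming (sum to ∑)
open import Data.Fin.Properties using (punchIn-injective; punchIn-punchOut; punchInᵢ≢i; any?; ¬∀⟶∃¬; injective⇒≤; punchOut-injective; toℕ-inject≤; toℕ-fromℕ; inject≤-injective; +↔⊎)
open import Data.Fin.Permutation using (Permutation; _⟨$⟩ʳ_; _⟨$⟩ˡ_; insert; insert-punchIn; inverseˡ)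
open import Function.Bundles using (_⇔_; Inverse; Equivalence; mk⇔; mk↔ₛ′)
open import Function.Construct.Composition using (_↔-∘_; _⇔-∘_)
open import Function.Construct.Symmetry using (↔-sym)
open import Function.Construct.Identity using (↔-id)
open import Data.Sum.Function.Propositional using (_⊎-↔_)
open import Data.Nat.DivMod using (m≡m%n+[m/n]*n; m%n<n; [m+kn]%n≡m%n)

-- The induction must start at a = b = t + 2, because the claim is false one step below: the
-- complete bipartite graph with t + 1 vertices on each side has no path on 2t + 4 vertices, yet its
-- (t+1)² edges exceed t(t+1) + 1. For a = b a single deletion in B would violate b ≥ a, hence the
-- pairs. Deleting a vertex of B lowers t b + a by t and deleting a pair lowers it by t + 1, exactly
-- the degree bounds available; so a graph attaining the bound leaves a smaller graph attaining it,
-- whose shape is already known. For a = b = t + 2 the bound permits exactly 2t + 2 non-edges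
-- between A and B, and every count in that case is compared with this number. The spanning tree of
-- maximal depth replaces a depth-first search tree: all that is wanted of it is a leaf whose
-- neighbours are ancestors.

⟦_⟧ : Bool → ℕ
⟦ b ⟧ = if b then 1 else 0

⟦⟧≤1 : ∀ b → ⟦ b ⟧ ≤ 1
⟦⟧≤1 true  = ≤-refl
⟦⟧≤1 false = z≤n

-- Replaces a linear arithmetic procedure: s ≤ r is a sum of hypotheses and the
-- equation is left to the ring solver.
≤-by : ∀ {s r} x y → s ≤ r → x + r ≡ y + s → x ≤ y
≤-by {s} {r} x y s≤r eq =
  +-cancelʳ-≤ s x y (≤-trans (+-monoʳ-≤ x s≤r) (≤-reflexive eq))

≡-≤-trans : ∀ {x y z} → x ≡ y → y ≤ z → x ≤ z
≡-≤-trans refl y≤z = y≤z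

-- No search through X takes place. Since `Goal` is decidable one may assume ¬ `Goal`; a y above x
-- would yield `Goal` by recursion, so x is already maximal. The fuel is the room left below the
-- bound N.
maximise : {X Goal : Set} (μ : X → ℕ) (N : ℕ) → (∀ x → μ x ≤ N) → Dec Goal → X →
  (∀ x → (∀ y → μ y ≤ μ x) → Goal) → Goal
maximise {X} {Goal} μ N μ≤N (yes g) x₀ climb = g
maximise {X} {Goal} μ N μ≤N (no ¬g) x₀ climb = go N x₀ (m≤n+m N (μ x₀))
  where
  go : ∀ k x → N ≤ μ x + k → Goal
  go zero    x N≤ = climb x (λ y → ≤-trans (μ≤N y) (≤-trans N≤ (≤-reflexive (+-identityʳ _))))
  go (suc k) x N≤ = climb x λ y → ≮⇒≥ λ μx<μy →
    ¬g (go k y (≤-trans N≤ (≡-≤-trans (+-suc (μ x) k) (+-monoˡ-≤ k μx<μy))))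

-- Finite sums and the number of edges

∑-mono : ∀ {n} {f g : Fin n → ℕ} → (∀ i → f i ≤ g i) → ∑ f ≤ ∑ g
∑-mono {zero}  f≤g = z≤n
∑-mono {suc n} f≤g = +-mono-≤ (f≤g zero) (∑-mono (f≤g ∘ suc))

∑-mono-< : ∀ {n} {f g : Fin n → ℕ} → (∀ i → f i ≤ g i) → ∀ i → f i < g i → ∑ f < ∑ g
∑-mono-< {suc n} f≤g zero    lt = +-mono-<-≤ lt (∑-mono (f≤g ∘ suc))
∑-mono-< {suc n} f≤g (suc i) lt = +-mono-≤-< (f≤g zero) (∑-mono-< (f≤g ∘ suc) i lt)

∑-const : ∀ n c → ∑ {n} (λ _ → c) ≡ n * c
∑-const zero    c = refl
∑-const (suc n) c = cong (c +_) (∑-const n c)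

∑-zero : ∀ n → ∑ {n} (λ _ → 0) ≡ 0
∑-zero n = trans (∑-const n 0) (*-zeroʳ n)

∑-one : ∀ n → ∑ {n} (λ _ → 1) ≡ n
∑-one n = trans (∑-const n 1) (*-identityʳ n)

∑-*ʳ : ∀ {n} (f : Fin n → ℕ) c → ∑ (λ i → f i * c) ≡ ∑ f * c
∑-*ʳ {zero}  f c = refl
∑-*ʳ {suc n} f c = trans (cong (f zero * c +_) (∑-*ʳ (f ∘ suc) c)) (sym (*-distribʳ-+ c (f zero) _))

∑-lookup≤ : ∀ {n} (f : Fin n → ℕ) i → f i ≤ ∑ f
∑-lookup≤ f zero    = m≤m+n _ _
∑-lookup≤ f (suc i) = ≤-trans (∑-lookup≤ (f ∘ suc) i) (m≤n+m _ _)

∑-pick : ∀ {n} (i : Fin n) (f : Fin n → ℕ) → ∑ (λ j → ⟦ does (i Fin.≟ j) ⟧ * f j) ≡ f i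
∑-pick {suc n} zero    f = trans (cong₂ _+_ (+-identityʳ (f zero)) (∑-zero n)) (+-identityʳ _)
∑-pick {suc n} (suc i) f = ∑-pick i (f ∘ suc)

sum-allFin : ∀ {n} (f : Fin n → ℕ) → ListAction.sum (List.map f (allFin n)) ≡ ∑ f
sum-allFin {zero}  f = refl
sum-allFin {suc n} f = cong (f zero +_) (trans (cong ListAction.sum (trans (map-tabulate suc f) (sym (map-tabulate (λ i → i) (f ∘ suc))))) (sum-allFin (f ∘ suc)))

row : ∀ {a b} → BipGraph a b → Fin a → ℕ
row G i = ∑ λ j → ⟦ G i j ⟧

edges : ∀ {a b} → BipGraph a b → ℕ
edges G = ∑ (row G)

edgeCount≡edges : ∀ {a b} (G : BipGraph a b) → edgeCount G ≡ edges G
edgeCount≡edges {a} {b} G = trans (sum-allFin {a} _) (sum-cong-≗ {a} λ i → sum-allFin {b} λ j → ⟦ G i j ⟧)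

edges-flip : ∀ {a b} (G : BipGraph a b) → edges (flip G) ≡ edges G
edges-flip G = ∑-comm λ j i → ⟦ G i j ⟧

-- Weights and walks

module Graph {a b : ℕ} (G : BipGraph a b) where

  V : Set
  V = Vertex a b

  infix 4 _≟ⱽ_
  _≟ⱽ_ : (x y : V) → Dec (x ≡ y)
  _≟ⱽ_ = ⊎-≡-dec Fin._≟_ Fin._≟_

  adj : V → V → Bool
  adj (inj₁ i) (inj₂ j) = G i j
  adj (inj₂ j) (inj₁ i) = G i j
  adj (inj₁ _) (inj₁ _) = false
  adj (inj₂ _) (inj₂ _) = false

  -- Wrapping the equation keeps x and y recoverable from the type; `adj x y ≡ true` reduces and
  -- loses them.
  record E (x y : V) : Set where
    constructor edge
    field isEdge : adj x y ≡ true
  open E public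

  E-sym : ∀ {x y} → E x y → E y x
  E-sym {inj₁ _} {inj₂ _} (edge e) = edge e
  E-sym {inj₂ _} {inj₁ _} (edge e) = edge e

  E? : ∀ x y → Dec (E x y)
  E? x y = map′ edge isEdge (adj x y Data.Bool.≟ true)

  nA nB : V → ℕ
  nA (inj₁ _) = 1
  nA (inj₂ _) = 0
  nB (inj₁ _) = 0
  nB (inj₂ _) = 1

  nA≡nB : ∀ {x y} → E x y → nA x ≡ nB y
  nA≡nB {inj₁ _} {inj₂ _} e = refl
  nA≡nB {inj₂ _} {inj₁ _} e = refl

  adj# : V → V → ℕ
  adj# x y = ⟦ adj x y ⟧

  adj#-E : ∀ {x y} → E x y → adj# x y ≡ 1
  adj#-E (edge e) rewrite e = refl

  adj#-¬E : ∀ {x y} → ¬ E x y → adj# x y ≡ 0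
  adj#-¬E {x} {y} ¬e with adj x y in eq
  ... | true  = ⊥-elim (¬e (edge eq))
  ... | false = refl

  E-adj# : ∀ {x y} → 1 ≤ adj# x y → E x y
  E-adj# {x} {y} le with adj x y in eq
  ... | true = edge eq

  δ : V → V → ℕ
  δ x y = ⟦ does (x ≟ⱽ y) ⟧

  δ-refl : ∀ x → δ x x ≡ 1
  δ-refl x with x ≟ⱽ x
  ... | yes _ = refl
  ... | no ¬p = ⊥-elim (¬p refl)

  δ-≢ : ∀ {x y} → x ≢ y → δ x y ≡ 0
  δ-≢ {x} {y} x≢y with x ≟ⱽ y
  ... | yes p = ⊥-elim (x≢y p)
  ... | no _  = refl

  ΣV : (V → ℕ) → ℕ
  ΣV f = ∑ (f ∘ inj₁) + ∑ (f ∘ inj₂)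

  ΣV-cong : ∀ {f g} → (∀ x → f x ≡ g x) → ΣV f ≡ ΣV g
  ΣV-cong eq = cong₂ _+_ (sum-cong-≗ (eq ∘ inj₁)) (sum-cong-≗ (eq ∘ inj₂))

  ΣV-mono : ∀ {f g} → (∀ x → f x ≤ g x) → ΣV f ≤ ΣV g
  ΣV-mono le = +-mono-≤ (∑-mono (le ∘ inj₁)) (∑-mono (le ∘ inj₂))

  ΣV-mono-< : ∀ {f g} → (∀ x → f x ≤ g x) → ∀ x → f x < g x → ΣV f < ΣV g
  ΣV-mono-< le (inj₁ i) lt = +-mono-<-≤ (∑-mono-< (le ∘ inj₁) i lt) (∑-mono (le ∘ inj₂))
  ΣV-mono-< le (inj₂ j) lt = +-mono-≤-< (∑-mono (le ∘ inj₁)) (∑-mono-< (le ∘ inj₂) j lt)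

  ΣV-+ : ∀ f g → ΣV (λ x → f x + g x) ≡ ΣV f + ΣV g
  ΣV-+ f g = trans (cong₂ _+_ (∑-distrib-+ (f ∘ inj₁) (g ∘ inj₁)) (∑-distrib-+ (f ∘ inj₂) (g ∘ inj₂))) (interchange (∑ (f ∘ inj₁)) (∑ (g ∘ inj₁)) (∑ (f ∘ inj₂)) (∑ (g ∘ inj₂)))

  ΣV-0 : ΣV (λ _ → 0) ≡ 0
  ΣV-0 = cong₂ _+_ (∑-zero a) (∑-zero b)

  ΣV-pick : ∀ x (f : V → ℕ) → ΣV (λ y → δ x y * f y) ≡ f x
  ΣV-pick (inj₁ i) f = trans (cong₂ _+_ (∑-pick i (f ∘ inj₁)) (∑-zero b)) (+-identityʳ _)
  ΣV-pick (inj₂ j) f = cong₂ _+_ (∑-zero a) (∑-pick j (f ∘ inj₂))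

  deg : V → ℕ
  deg x = ΣV (adj# x)

  deg-inj₁ : ∀ i → deg (inj₁ i) ≡ row G i
  deg-inj₁ i = cong (_+ row G i) (∑-zero a)

  deg-inj₂ : ∀ j → deg (inj₂ j) ≡ row (flip G) j
  deg-inj₂ j = trans (cong (row (flip G) j +_) (∑-zero b)) (+-identityʳ _)

  -- All quantities attached to a vertex list (length, number of B-vertices,
  -- multiplicity of a vertex, number of neighbours of a vertex) are weights.
  wt : (V → ℕ) → List V → ℕ
  wt f []       = 0
  wt f (x ∷ xs) = f x + wt f xs

  size : List V → ℕ
  size = wt (λ _ → 1)

  occ : V → List V → ℕ
  occ v = wt (λ x → δ x v)

  record Distinct (xs : List V) : Set where
    constructor distinct
    field once : ∀ v → occ v xs ≤ 1
  open Distinct public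

  wt-++ : ∀ f xs ys → wt f (xs ++ ys) ≡ wt f xs + wt f ys
  wt-++ f []       ys = refl
  wt-++ f (x ∷ xs) ys = trans (cong (f x +_) (wt-++ f xs ys)) (sym (+-assoc (f x) _ _))

  wt-reverse : ∀ f xs → wt f (reverse xs) ≡ wt f xs
  wt-reverse f []       = refl
  wt-reverse f (x ∷ xs) = begin
    wt f (reverse (x ∷ xs))         ≡⟨ cong (wt f) (unfold-reverse x xs) ⟩
    wt f (reverse xs ++ x ∷ [])     ≡⟨ wt-++ f (reverse xs) _ ⟩
    wt f (reverse xs) + (f x + 0)   ≡⟨ cong₂ _+_ (wt-reverse f xs) (+-identityʳ (f x)) ⟩
    wt f xs + f x                   ≡⟨ +-comm _ (f x) ⟩
    f x + wt f xs                   ∎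
    where open ≡-Reasoning

  wt-mono : ∀ {f g} → (∀ x → f x ≤ g x) → ∀ xs → wt f xs ≤ wt g xs
  wt-mono le []       = z≤n
  wt-mono le (x ∷ xs) = +-mono-≤ (le x) (wt-mono le xs)

  -- Regroups the list by vertices. It links degrees, which are sums over all vertices, with
  -- neighbour counts along a path.
  wt-ΣV : ∀ f xs → wt f xs ≡ ΣV (λ y → occ y xs * f y)
  wt-ΣV f []       = sym ΣV-0
  wt-ΣV f (x ∷ xs) = begin
    f x + wt f xs                                             ≡⟨ cong₂ _+_ (sym (ΣV-pick x f)) (wt-ΣV f xs) ⟩
    ΣV (λ y → δ x y * f y) + ΣV (λ y → occ y xs * f y)        ≡⟨ sym (ΣV-+ (λ y → δ x y * f y) (λ y → occ y xs * f y)) ⟩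
    ΣV (λ y → δ x y * f y + occ y xs * f y)                   ≡⟨ ΣV-cong (λ y → sym (*-distribʳ-+ (f y) (δ x y) (occ y xs))) ⟩
    ΣV (λ y → occ y (x ∷ xs) * f y)                           ∎
    where open ≡-Reasoning

  infix 4 _∈_ _∉_ _∈?_
  record _∈_ (v : V) (xs : List V) : Set where
    constructor occurs
    field multiplicity : 1 ≤ occ v xs
  open _∈_ public

  _∉_ : V → List V → Set
  v ∉ xs = ¬ v ∈ xs

  _∈?_ : ∀ v xs → Dec (v ∈ xs)
  v ∈? xs = map′ occurs multiplicity (1 ≤? occ v xs)

  ∉⇒occ≡0 : ∀ {v xs} → v ∉ xs → occ v xs ≡ 0
  ∉⇒occ≡0 v∉ = n<1⇒n≡0 (≰⇒> (v∉ ∘ occurs))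

  ∉[] : ∀ {v} → v ∉ []
  ∉[] (occurs ())

  ∈-here : ∀ {v xs} → v ∈ v ∷ xs
  ∈-here {v} {xs} = occurs (subst (λ k → 1 ≤ k + occ v xs) (sym (δ-refl v)) (s≤s z≤n))

  ∈-there : ∀ {v x xs} → v ∈ xs → v ∈ x ∷ xs
  ∈-there {v} {x} (occurs le) = occurs (≤-trans le (m≤n+m _ (δ x v)))

  ∈-∷⁻ : ∀ {v x xs} → v ∈ x ∷ xs → x ≡ v ⊎ v ∈ xs
  ∈-∷⁻ {v} {x} {xs} (occurs le) with x ≟ⱽ v
  ... | yes p = inj₁ p
  ... | no _  = inj₂ (occurs le)

  ∈-++ˡ : ∀ {v xs ys} → v ∈ xs → v ∈ xs ++ ys
  ∈-++ˡ {v} {xs} {ys} (occurs le) = occurs (≤-trans le (≤-trans (m≤m+n _ (occ v ys)) (≤-reflexive (sym (wt-++ _ xs ys)))))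

  ∈-++ʳ : ∀ {v} xs {ys} → v ∈ ys → v ∈ xs ++ ys
  ∈-++ʳ {v} xs {ys} (occurs le) = occurs (≤-trans le (≤-trans (m≤n+m _ (occ v xs)) (≤-reflexive (sym (wt-++ _ xs ys)))))

  ∈-++⁻ : ∀ {v} xs {ys} → v ∈ xs ++ ys → v ∈ xs ⊎ v ∈ ys
  ∈-++⁻ {v} xs {ys} (occurs le) with v ∈? xs
  ... | yes p = inj₁ p
  ... | no ¬p = inj₂ (occurs (≤-trans le (≤-reflexive (trans (wt-++ _ xs ys) (cong (_+ occ v ys) (∉⇒occ≡0 ¬p))))))

  ∈-resp : ∀ {v xs ys} → (∀ f → wt f xs ≡ wt f ys) → v ∈ xs → v ∈ ys
  ∈-resp eq (occurs le) = occurs (≤-trans le (≤-reflexive (eq _)))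

  ΣV≤wt : ∀ {f xs} → (∀ y → 1 ≤ f y → y ∈ xs) → ΣV f ≤ wt f xs
  ΣV≤wt {f} {xs} cover = ≤-trans (ΣV-mono le) (≤-reflexive (sym (wt-ΣV f xs)))
    where
    le : ∀ y → f y ≤ occ y xs * f y
    le y with f y | cover y
    ... | zero  | _ = z≤n
    ... | suc k | c = ≡-≤-trans (sym (+-identityʳ (suc k))) (*-monoˡ-≤ (suc k) (multiplicity (c (s≤s z≤n))))

  wt≤ΣV : ∀ f {xs} → Distinct xs → wt f xs ≤ ΣV f
  wt≤ΣV f {xs} d = ≡-≤-trans (wt-ΣV f xs)
    (ΣV-mono λ y → ≤-trans (*-monoˡ-≤ (f y) (once d y)) (≤-reflexive (+-identityʳ (f y))))

  infixr 5 _∷_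
  data Walk : V → List V → V → Set where
    ⟨_⟩ : ∀ x → Walk x (x ∷ []) x
    _∷_ : ∀ {x y ys z} → E x y → Walk y ys z → Walk x (x ∷ ys) z

  head∈ : ∀ {x xs y} → Walk x xs y → x ∈ xs
  head∈ ⟨ x ⟩   = ∈-here
  head∈ (e ∷ w) = ∈-here

  last∈ : ∀ {x xs y} → Walk x xs y → y ∈ xs
  last∈ ⟨ x ⟩   = ∈-here
  last∈ (e ∷ w) = ∈-there (last∈ w)

  size≥1 : ∀ {x xs y} → Walk x xs y → 1 ≤ size xs
  size≥1 ⟨ x ⟩   = ≤-refl
  size≥1 (e ∷ w) = s≤s z≤n

  infixr 4 _⋈⟨_⟩_
  _⋈⟨_⟩_ : ∀ {x xs y z zs w} → Walk x xs y → E y z → Walk z zs w → Walk x (xs ++ zs) w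
  ⟨ x ⟩   ⋈⟨ e ⟩ w = e ∷ w
  (d ∷ v) ⋈⟨ e ⟩ w = d ∷ (v ⋈⟨ e ⟩ w)

  rev : ∀ {x xs y} → Walk x xs y → Walk y (reverse xs) x
  rev ⟨ x ⟩ = ⟨ x ⟩
  rev {x} {_ ∷ ys} (e ∷ w) = subst (λ l → Walk _ l x) (sym (unfold-reverse x ys)) (rev w ⋈⟨ E-sym e ⟩ ⟨ x ⟩)

  split : ∀ {x w} X {z Y} → Walk x (X ++ z ∷ Y) w → Walk x (X ++ z ∷ []) z × Walk z (z ∷ Y) w
  split []          ⟨ x ⟩   = ⟨ x ⟩ , ⟨ x ⟩
  split []          (e ∷ w) = ⟨ _ ⟩ , e ∷ w
  split (x ∷ [])    (e ∷ w) with split [] w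
  ... | p , q = e ∷ p , q
  split (x ∷ y ∷ X) (e ∷ w) with split (y ∷ X) w
  ... | p , q = e ∷ p , q

  -- The decomposed list is an index, so a match splits it in place. Where the list is not a
  -- variable, an equation is carried along, as in `body (find z∈) refl`.
  data At (v : V) : List V → Set where
    at : ∀ X Y → At v (X ++ v ∷ Y)

  find : ∀ {v xs} → v ∈ xs → At v xs
  find {v} {x ∷ xs} v∈ with ∈-∷⁻ v∈
  ... | inj₁ refl = at [] xs
  ... | inj₂ v∈xs with find v∈xs
  ...   | at X Y = at (x ∷ X) Y

  -- The two sides alternate along a walk. The terms `nB x` and `nA y` correct for the sides of the
  -- ends, so one equation covers all four combinations.
  alternate : ∀ {x xs y} → Walk x xs y → wt nA xs + nB x ≡ wt nB xs + nA y
  alternate ⟨ inj₁ _ ⟩ = refl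
  alternate ⟨ inj₂ _ ⟩ = refl
  alternate {x} {y = y} (_∷_ {y = x′} {ys = ys} e w) = begin
    nA x + wt nA ys + nB x   ≡⟨ cong (λ k → k + wt nA ys + nB x) (nA≡nB e) ⟩
    nB x′ + wt nA ys + nB x  ≡⟨ lemma (nB x′) (wt nA ys) (nB x) ⟩
    nB x + (wt nA ys + nB x′) ≡⟨ cong (nB x +_) (alternate w) ⟩
    nB x + (wt nB ys + nA y) ≡⟨ sym (+-assoc (nB x) _ _) ⟩
    nB x + wt nB ys + nA y   ∎
    where
    open ≡-Reasoning
    lemma : ∀ p q r → p + q + r ≡ r + (q + p)
    lemma = solve-∀

  nA+nB : ∀ xs → size xs ≡ wt nA xs + wt nB xs
  nA+nB [] = refl
  nA+nB (inj₁ _ ∷ xs) = cong suc (nA+nB xs)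
  nA+nB (inj₂ _ ∷ xs) = trans (cong suc (nA+nB xs)) (sym (+-suc _ _))

  -- With m = `wt nB xs` the list has 2m entries, and 2m ≤ 2t + 3 forces m ≤ t + 1. In `half-same`
  -- it has 2m + 1.
  half-opposite : ∀ {t} xs → wt nA xs ≡ wt nB xs → size xs ≤ 3 + (t + t) → wt nB xs ≤ suc t
  half-opposite {t} xs A≡B short = ≮⇒≥ λ lt → <⇒≱ (s≤s (≡-≤-trans (sym (trans (nA+nB xs) (cong (_+ wt nB xs) A≡B))) short))
    (≡-≤-trans (lemma t) (+-mono-≤ lt lt))
    where
    lemma : ∀ t → 4 + (t + t) ≡ suc (suc t) + suc (suc t)
    lemma = solve-∀

  half-same : ∀ {t} xs → wt nA xs ≡ suc (wt nB xs) → size xs ≤ 3 + (t + t) → wt nB xs ≤ suc t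
  half-same {t} xs A≡suc short = ≮⇒≥ λ lt → <⇒≱ (s≤s (≡-≤-trans (sym (trans (nA+nB xs) (cong (_+ wt nB xs) A≡suc))) short))
    (≤-trans (≤-trans (n≤1+n _) (≤-reflexive (lemma t))) (s≤s (+-mono-≤ lt lt)))
    where
    lemma : ∀ t → 5 + (t + t) ≡ suc (suc (suc t) + suc (suc t))
    lemma = solve-∀

-- Rearranged lists, reachability and the crossing count

module Paths {a b : ℕ} (G : BipGraph a b) where
  open Graph G

  infixr 5 _⊕_
  -- Syntax for lists cut up, reversed and joined again. Their weight is the sum over the pieces, so
  -- comparing a rerouted path with the old one becomes an equation for the ring solver.
  data Shape : Set where
    ‵_  : List V → Shape
    _⊕_ : Shape → Shape → Shape
    ↺_  : Shape → Shape

  ⟪_⟫ : Shape → List V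
  ⟪ ‵ xs ⟫  = xs
  ⟪ s ⊕ t ⟫ = ⟪ s ⟫ ++ ⟪ t ⟫
  ⟪ ↺ s ⟫   = reverse ⟪ s ⟫

  weight : (V → ℕ) → Shape → ℕ
  weight f (‵ xs)  = wt f xs
  weight f (s ⊕ t) = weight f s + weight f t
  weight f (↺ s)   = weight f s

  wt-shape : ∀ f s → wt f ⟪ s ⟫ ≡ weight f s
  wt-shape f (‵ xs)  = refl
  wt-shape f (s ⊕ t) = trans (wt-++ f ⟪ s ⟫ ⟪ t ⟫) (cong₂ _+_ (wt-shape f s) (wt-shape f t))
  wt-shape f (↺ s)   = trans (wt-reverse f ⟪ s ⟫) (wt-shape f s)

  E-irrefl : ∀ {x} → ¬ E x x
  E-irrefl {inj₁ _} (edge ())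
  E-irrefl {inj₂ _} (edge ())

  head≡ : ∀ {x y ys z} → Walk x (y ∷ ys) z → x ≡ y
  head≡ ⟨ _ ⟩   = refl
  head≡ (_ ∷ _) = refl

  disjoint-from : ∀ {P Q} → Distinct P → Distinct Q → (∀ {z} → z ∈ Q → z ∉ P) → ∀ v → occ v P + occ v Q ≤ 1
  disjoint-from {P} {Q} dP dQ dis v with v ∈? Q
  ... | yes v∈ rewrite ∉⇒occ≡0 (dis v∈) = once dQ v
  ... | no v∉  rewrite ∉⇒occ≡0 v∉ | +-identityʳ (occ v P) = once dP v

  distinct-one : ∀ x → Distinct (x ∷ [])
  distinct-one x = distinct λ v → ≡-≤-trans (+-identityʳ (δ x v)) (⟦⟧≤1 _)

  disjoint-one : ∀ {z xs} → Distinct xs → z ∉ xs → ∀ v → occ v xs + occ v (z ∷ []) ≤ 1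
  disjoint-one {z} {xs} d z∉ = disjoint-from d (distinct-one z) λ v∈ → case ∈-∷⁻ v∈ of λ
    { (inj₁ refl) → z∉ ; (inj₂ v∈[]) → ⊥-elim (∉[] v∈[]) }

  distinct-++ˡ : ∀ xs {ys} → Distinct (xs ++ ys) → Distinct xs
  distinct-++ˡ xs {ys} d = distinct λ v → ≤-trans (≤-trans (m≤m+n _ (occ v ys)) (≤-reflexive (sym (wt-++ _ xs ys)))) (once d v)

  distinct-++ʳ : ∀ xs {ys} → Distinct (xs ++ ys) → Distinct ys
  distinct-++ʳ xs {ys} d = distinct λ v → ≤-trans (≤-trans (m≤n+m _ (occ v xs)) (≤-reflexive (sym (wt-++ _ xs ys)))) (once d v)

  distinct-∷ : ∀ {x xs} → x ∉ xs → Distinct xs → Distinct (x ∷ xs)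
  distinct-∷ {x} {xs} x∉ d = distinct λ v → ≤-trans
    (≤-reflexive (trans (+-comm (δ x v) (occ v xs)) (cong (occ v xs +_) (sym (+-identityʳ (δ x v))))))
    (disjoint-one d x∉ v)

  ΣV-nB : ΣV nB ≡ b
  ΣV-nB = cong₂ _+_ (∑-zero a) (∑-one b)

  ΣV-nA : ΣV nA ≡ a
  ΣV-nA = trans (cong₂ _+_ (∑-one a) (∑-zero b)) (+-identityʳ a)

  adj#≤nB : ∀ {i} z → adj# (inj₁ i) z ≤ nB z
  adj#≤nB (inj₁ _) = z≤n
  adj#≤nB {i} (inj₂ j) = ⟦⟧≤1 (G i j)

  adj#≤nA : ∀ {j} z → adj# (inj₂ j) z ≤ nA z
  adj#≤nA (inj₂ _) = z≤n
  adj#≤nA {j} (inj₁ i) = ⟦⟧≤1 (G i j)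

  Reach-E : ∀ {x y} → Adj G x y → E x y
  Reach-E {inj₁ _} {inj₂ _} e = edge e
  Reach-E {inj₂ _} {inj₁ _} e = edge e

  ¬E⇒false : ∀ {k l} → ¬ E (inj₁ k) (inj₂ l) → G k l ≡ false
  ¬E⇒false {k} {l} ¬kl with G k l in eq
  ... | true  = ⊥-elim (¬kl (edge eq))
  ... | false = refl

  has-neighbour : Connected G → ∀ {x y} → x ≢ y → ∃ λ z → E x z
  has-neighbour conn {x} {y} x≢y with conn x y
  ... | here     = ⊥-elim (x≢y refl)
  ... | step e _ = _ , Reach-E e

  -- Loop erasure: if x reappears later, everything before that occurrence is dropped.
  simple : ∀ {x y} → Reach G x y → ∃ λ xs → Walk x xs y × Distinct xs
  simple {x} here = _ , ⟨ x ⟩ , distinct-one x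
  simple {x} (step e p) with simple p
  ... | xs , w , d with x ∈? xs
  ... | no x∉ = _ , Reach-E e ∷ w , distinct-∷ x∉ d
  ... | yes x∈ with find x∈
  ...   | at X Y = _ , proj₂ (split X w) , distinct-++ʳ X d

  record FirstHit (P : List V) (x : V) (xs : List V) (y : V) : Set where
    field
      {q l}  : V
      Q rest : List V
      wQ     : Walk x Q q
      q~l    : E q l
      l∈P    : l ∈ P
      Q∩P    : ∀ {z} → z ∈ Q → z ∉ P
      xs≡    : xs ≡ Q ++ l ∷ rest

  firstHit : ∀ P {x xs y} → Walk x xs y → x ∉ P → y ∈ P → FirstHit P x xs y
  firstHit P ⟨ x ⟩ x∉ y∈ = ⊥-elim (x∉ y∈)
  firstHit P (_∷_ {y = x′} e w) x∉ y∈ with x′ ∈? P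
  firstHit P {x} (_∷_ {ys = _ ∷ ys} e w) x∉ y∈ | yes x′∈ with head≡ w
  ... | refl = record { Q = x ∷ [] ; rest = ys ; wQ = ⟨ x ⟩ ; q~l = e ; l∈P = x′∈ ; xs≡ = refl
    ; Q∩P = λ z∈ → case ∈-∷⁻ z∈ of λ { (inj₁ refl) → x∉ ; (inj₂ z∈[]) → ⊥-elim (∉[] z∈[]) } }
  firstHit P {x} (e ∷ w) x∉ y∈ | no x′∉ = record
    { Q = x ∷ Q ; rest = rest ; wQ = e ∷ wQ ; q~l = q~l ; l∈P = l∈P ; xs≡ = cong (x ∷_) xs≡
    ; Q∩P = λ z∈ → case ∈-∷⁻ z∈ of λ { (inj₁ refl) → x∉ ; (inj₂ z∈Q) → Q∩P z∈Q } }
    where open FirstHit (firstHit P w x′∉ y∈)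

  -- If no vertex z of a walk is a neighbour of v while its successor is a
  -- neighbour of u, then N(u) and the shifted N(v) are disjoint sets of B-vertices.
  module _ {i : Fin a} {j : Fin b} where
    private
      u v : V
      u = inj₁ i
      v = inj₂ j

      NoCross : List V → Set
      NoCross S = ∀ X z z′ Y → S ≡ X ++ z ∷ z′ ∷ Y → E v z → ¬ E u z′

      NotLast : List V → Set
      NotLast S = ∀ X z → S ≡ X ++ z ∷ [] → ¬ E v z

      tailX : ∀ {x S} → NoCross (x ∷ S) → NoCross S
      tailX {x} noX X z z′ Y eq = noX (x ∷ X) z z′ Y (cong (x ∷_) eq)

      tailL : ∀ {x S} → NotLast (x ∷ S) → NotLast S
      tailL {x} noL X z eq = noL (x ∷ X) z (cong (x ∷_) eq)

    -- An A-vertex z of S adjacent to v is charged to the B-vertex after it, which exists by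
    -- `NotLast` and is not adjacent to u by `NoCross`. `cross-count-after` is the state between the
    -- two.
    cross-count : ∀ {x S y} → Walk x S y → NoCross S → NotLast S → wt (adj# u) S + wt (adj# v) S ≤ wt nB S
    cross-count-after : ∀ {x S y} → Walk x S y → nB x ≡ 1 → ¬ E u x → NoCross S → NotLast S →
      suc (wt (adj# u) S + wt (adj# v) S) ≤ wt nB S
    cross-count ⟨ z ⟩ noX noL rewrite adj#-¬E (noL [] z refl) =
      ≡-≤-trans (+-identityʳ _) (+-monoˡ-≤ 0 (adj#≤nB z))
    cross-count (_∷_ {x = inj₂ k} e w) noX noL =
      ≡-≤-trans (+-assoc ⟦ G i k ⟧ _ _) (+-mono-≤ (⟦⟧≤1 (G i k))
        (cross-count w (tailX noX) (tailL noL)))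
    cross-count (_∷_ {x = inj₁ k} {ys = y ∷ ys} e w) noX noL with head≡ w | E? v (inj₁ k)
    ... | refl | yes v~x rewrite adj#-E v~x | +-suc (wt (adj# u) (y ∷ ys)) (wt (adj# v) (y ∷ ys)) =
      cross-count-after w (sym (nA≡nB e)) (noX [] _ _ _ refl v~x)
        (tailX noX) (tailL noL)
    ... | refl | no v≁x rewrite adj#-¬E v≁x =
      cross-count w (tailX noX) (tailL noL)
    cross-count-after ⟨ inj₂ k ⟩ x∈B u≁x noX noL rewrite adj#-¬E u≁x = ≤-refl
    cross-count-after (_∷_ {x = inj₂ k} e w) x∈B u≁x noX noL rewrite adj#-¬E u≁x =
      s≤s (cross-count w (tailX noX) (tailL noL))

    -- The first g vertices contribute nothing on the left, so their B-vertices remain as a surplus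
    -- when the rest is counted.
    cross-count-gap : ∀ g {x S y} → Walk x S y → (∀ X z Y → S ≡ X ++ z ∷ Y → size X < g → ¬ E u z × ¬ E v z) →
      NoCross S → NotLast S → wt (adj# u) S + wt (adj# v) S + wt nB (take g S) ≤ wt nB S
    cross-count-gap zero w gap noX noL = ≡-≤-trans (+-identityʳ _) (cross-count w noX noL)
    cross-count-gap (suc g) ⟨ z ⟩ gap noX noL with gap [] z [] refl (s≤s z≤n)
    ... | u≁z , v≁z rewrite adj#-¬E u≁z | adj#-¬E v≁z = +-monoʳ-≤ (nB z) (≤-reflexive (lemma g))
      where
      lemma : ∀ g → wt nB (take g []) ≡ 0
      lemma zero    = refl
      lemma (suc g) = refl
    cross-count-gap (suc g) (_∷_ {x} {ys = S} e w) gap noX noL with gap [] x _ refl (s≤s z≤n)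
    ... | u≁z , v≁z rewrite adj#-¬E u≁z | adj#-¬E v≁z = ≤-trans
      (≤-reflexive (x∙yz≈y∙xz (wt (adj# u) S + wt (adj# v) S) (nB x) (wt nB (take g S))))
      (+-monoʳ-≤ (nB x) (cross-count-gap g w (λ X z Y eq lt → gap (_ ∷ X) z Y (cong (_ ∷_) eq) (s≤s lt))
        (tailX noX) (tailL noL)))

  same-side : ∀ {l x y} → E l x → E l y → nB x ≡ nB y
  same-side l~x l~y = trans (sym (nA≡nB l~x)) (nA≡nB l~y)

  nB≡⇒nA≡ : ∀ {x y} → nB x ≡ nB y → nA x ≡ nA y
  nB≡⇒nA≡ {inj₁ _} {inj₁ _} _ = refl
  nB≡⇒nA≡ {inj₂ _} {inj₂ _} _ = refl

  -- Both walks alternate and start on the same side, so they stay level.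
  in-step : ∀ {x Q y x′ S y′} → Walk x Q y → Walk x′ S y′ → nB x ≡ nB x′ → size Q ≤ size S →
    wt nB Q ≡ wt nB (take (size Q) S)
  in-step ⟨ x ⟩ ⟨ x′ ⟩  eq le = cong (_+ 0) eq
  in-step ⟨ x ⟩ (e ∷ w) eq le = cong (_+ 0) eq
  in-step (_∷_ {ys = _ ∷ _} e w) ⟨ x′ ⟩ eq (s≤s ())
  in-step (e ∷ w) (e′ ∷ w′) eq (s≤s le) = cong₂ _+_ eq (in-step w w′ (trans (sym (nA≡nB e)) (trans (nB≡⇒nA≡ eq) (nA≡nB e′))) le)

  in-step-last : ∀ {x Q y x′ S y′} → Walk x Q y → Walk x′ S y′ → nB x ≡ nB x′ → size Q ≡ size S → nB y ≡ nB y′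
  in-step-last ⟨ x ⟩ ⟨ x′ ⟩  eq le = eq
  in-step-last ⟨ x ⟩ (_∷_ {ys = _ ∷ _} e w) eq ()
  in-step-last (_∷_ {ys = _ ∷ _} e w) ⟨ x′ ⟩ eq ()
  in-step-last (e ∷ w) (e′ ∷ w′) eq le =
    in-step-last w w′ (trans (sym (nA≡nB e)) (trans (nB≡⇒nA≡ eq) (nA≡nB e′))) (suc-injective le)

-- Longest paths

module LongestPath {a b : ℕ} (G : BipGraph a b) where
  open Graph G
  open Paths G

  uncons : ∀ {u P v} → Walk u P v → u ≢ v → ∃ λ y → ∃ λ ys → P ≡ u ∷ y ∷ ys × E u y × Walk y (y ∷ ys) v
  uncons ⟨ _ ⟩ u≢v = ⊥-elim (u≢v refl)
  uncons (_∷_ {ys = y ∷ ys} e w) u≢v with head≡ w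
  ... | refl = y , ys , refl , e , w

  record Longest (u : V) (P : List V) (r : V) : Set where
    field
      wP      : Walk u P r
      dP      : Distinct P
      longest : ∀ {x xs y} → Walk x xs y → Distinct xs → size xs ≤ size P

  reverse-longest : ∀ {u P r} → Longest u P r → Longest r (reverse P) u
  reverse-longest {P = P} L = record
    { wP      = rev wP
    ; dP      = distinct λ v → ≡-≤-trans (wt-reverse _ P) (once dP v)
    ; longest = λ w d → ≤-trans (longest w d) (≤-reflexive (sym (wt-reverse _ P)))
    }
    where open Longest L

  module _ {u P r} (L : Longest u P r) where
    open Longest L

    -- The new walk consists of P and the vertices Q off P, except for the omitted X. The equation
    -- is required for every weight: taken with multiplicities it shows that nothing repeats, taken
    -- with sizes that the walk is longer than P.
    too-long : ∀ {x xs y} X Q → Walk x xs y → (∀ v → occ v P + occ v Q ≤ 1) →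
      (∀ f → wt f xs + wt f X ≡ wt f P + wt f Q) → size X < size Q → ⊥
    too-long {xs = xs} X Q w d eq lt = <-irrefl refl (≤-by (suc (size P)) (size P) lt′ (lemma (size P) (size xs) (size X) (size Q) (eq _)))
      where
      dxs : Distinct xs
      dxs = distinct λ v → ≤-trans (≤-trans (m≤m+n _ (occ v X)) (≤-reflexive (eq _))) (d v)
      lt′ : size xs + suc (size X) ≤ size P + size Q
      lt′ = +-mono-≤ (longest w dxs) lt
      lemma : ∀ p s x q → s + x ≡ p + q → suc p + (p + q) ≡ p + (s + suc x)
      lemma p s x q eq = trans (cong (suc p +_) (sym eq)) (shift p s x)
        where
        shift : ∀ p s x → suc p + (s + x) ≡ p + (s + suc x)
        shift = solve-∀

    start-closed : ∀ {z} → E u z → z ∈ P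
    start-closed {z} u~z with z ∈? P
    ... | yes z∈ = z∈
    ... | no z∉  = ⊥-elim (too-long [] (z ∷ []) (E-sym u~z ∷ wP) (disjoint-one dP z∉) (λ f → lemma (f z) (wt f P)) (s≤s z≤n))
      where
      lemma : ∀ x y → x + y + 0 ≡ y + (x + 0)
      lemma = solve-∀

    same-size-longest : ∀ {x xs y} → Walk x xs y → (∀ f → wt f xs ≡ wt f P) → Longest x xs y
    same-size-longest w eq = record
      { wP = w ; dP = distinct λ v → ≡-≤-trans (eq _) (once dP v)
      ; longest = λ w′ d → ≤-trans (longest w′ d) (≤-reflexive (sym (eq _))) }

    -- A cycle on the vertices of P can be opened at w; entering it there from z gives a path with
    -- one vertex more.
    no-exit-from-cycle : ∀ {x C y} → Walk x C y → E y x → (∀ f → wt f C ≡ wt f P) → ∀ {z w} → z ∉ P → w ∈ P → ¬ E z w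
    no-exit-from-cycle {x} {C} {y} wC y~x eq {z} {w} z∉ w∈ z~w with find {w} {C} (∈-resp {xs = P} {ys = C} (sym ∘ eq) w∈)
    ... | at X [] with split X wC
    ...   | wX , ⟨ _ ⟩ = too-long [] (z ∷ []) (z~w ∷ rev wX) (disjoint-one dP z∉)
      (λ f → trans (lemma (f z) _) (cong (_+ (f z + 0)) (trans (wt-reverse f (X ++ w ∷ [])) (eq f)))) (s≤s z≤n)
      where
      lemma : ∀ x y → x + y + 0 ≡ y + (x + 0)
      lemma = solve-∀
    no-exit-from-cycle {x} {C} {y} wC y~x eq {z} {w} z∉ w∈ z~w | at X (w′ ∷ Y) with split X wC
    ...   | wX , (e ∷ wY) with head≡ wY
    ...     | refl = too-long [] (z ∷ []) (z~w ∷ (rev wX ⋈⟨ E-sym y~x ⟩ rev wY)) (disjoint-one dP z∉) weights (s≤s z≤n)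
      where
      lemma : ∀ z x w y → z + (x + (w + 0) + y) + 0 ≡ (x + (w + y)) + (z + 0)
      lemma = solve-∀
      weights : ∀ f → f z + wt f (reverse (X ++ w ∷ []) ++ reverse (w′ ∷ Y)) + 0 ≡ wt f P + (f z + 0)
      weights f = trans (cong (λ k → f z + k + 0) (wt-shape f (↺ (‵ X ⊕ ‵ (w ∷ [])) ⊕ ↺ ‵ (w′ ∷ Y))))
        (trans (lemma (f z) (wt f X) (f w) (wt f (w′ ∷ Y))) (cong (_+ (f z + 0)) (trans (sym (wt-++ f X _)) (eq f))))

  exit : ∀ P {x y} → Reach G x y → x ∈ P → y ∉ P → ∃ λ z → ∃ λ w → z ∉ P × w ∈ P × E z w
  exit P here x∈ y∉ = ⊥-elim (y∉ x∈)
  exit P (step {v = v} e p) x∈ y∉ with v ∈? P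
  ... | yes v∈ = exit P p v∈ y∉
  ... | no v∉  = _ , _ , v∉ , x∈ , E-sym (Reach-E e)

  module Opposite {i j P} (L : Longest (inj₁ i) P (inj₂ j)) (conn : Connected G) {o} (o∉ : o ∉ P) where
    open Longest L
    private
      u v : V
      u = inj₁ i
      v = inj₂ j

    -- The cycle runs from u along P to z, across to v, back along P to z′ and home to u. As o lies
    -- outside, connectedness provides an edge leaving it.
    no-cross : ∀ X z z′ Y → P ≡ X ++ z ∷ z′ ∷ Y → E v z → ¬ E u z′
    no-cross X z z′ Y refl v~z u~z′ with split X wP
    ... | wX , (e ∷ wY) with head≡ wY | exit P (conn u o) (head∈ wP) o∉
    ...   | refl | p , q , p∉ , q∈ , p~q =
      no-exit-from-cycle L (wX ⋈⟨ E-sym v~z ⟩ rev wY) (E-sym u~z′) weights p∉ q∈ p~q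
      where
      weights : ∀ f → wt f ((X ++ z ∷ []) ++ reverse (z′ ∷ Y)) ≡ wt f (X ++ z ∷ z′ ∷ Y)
      weights f = trans (wt-shape f ((‵ X ⊕ ‵ (z ∷ [])) ⊕ ↺ ‵ (z′ ∷ Y)))
        (trans (lemma (wt f X) (f z) (wt f (z′ ∷ Y))) (sym (wt-++ f X _)))
        where
        lemma : ∀ x z y → x + (z + 0) + y ≡ x + (z + y)
        lemma = solve-∀

    not-last : ∀ X z → P ≡ X ++ z ∷ [] → ¬ E v z
    not-last X z refl v~z with proj₂ (split X wP)
    ... | ⟨ _ ⟩ = E-irrefl v~z

    u≁v : ¬ E u v
    u≁v u~v with uncons wP (λ ())
    -- The case z = u: the successor of u on P is a neighbour of u.
    ... | y , ys , P≡ , u~y , _ = no-cross [] u y ys P≡ (E-sym u~v) u~y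

    opposite-count : wt (adj# u) P + wt (adj# v) P ≤ wt nB P
    opposite-count = cross-count wP no-cross not-last

  -- Three legs meet at l: S leads back to u, R on to r, and the branch Q to v. Each contradiction
  -- in `ForkProperties` joins legs differently into a path longer than P.
  record Fork (u : V) (P : List V) (r l : V) (R Q : List V) (v : V) : Set where
    field
      {x q}    : V
      {S}      : List V
      wS       : Walk u S l
      l~x      : E l x
      wR       : Walk x R r
      l~q      : E l q
      wQ       : Walk q Q v
      P≡       : P ≡ S ++ R
      dPQ      : ∀ z → occ z P + occ z Q ≤ 1

  module _ {u P r} (L : Longest u P r) where
    open Longest L

    -- l cannot be the last vertex of P, since Q would then prolong P.
    fork : ∀ {l q Q v} X Y → P ≡ X ++ l ∷ Y → Walk q Q v → E l q → (∀ z → occ z P + occ z Q ≤ 1) → Fork u P r l Y Q v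
    fork {l} {q} {Q} X [] refl wQ l~q d with split X wP
    ... | wX , ⟨ _ ⟩ = ⊥-elim (too-long L [] Q (wX ⋈⟨ l~q ⟩ wQ) d (λ f → trans (+-identityʳ _) (wt-++ f (X ++ l ∷ []) Q)) (size≥1 wQ))
    fork {l} {q} {Q} X (x ∷ Y) refl wQ l~q d with split X wP
    ... | wX , (e ∷ wY) with head≡ wY
    ... | refl = record { wS = wX ; l~x = e ; wR = wY ; l~q = l~q ; wQ = wQ ; P≡ = sym (++-assoc X (l ∷ []) (x ∷ Y)) ; dPQ = d }

    module ForkProperties {l R Q v} (F : Fork u P r l R Q v) where
      open Fork F

      private
        too-long′ : ∀ {x xs y} X → Walk x xs y → (∀ f → wt f xs + wt f X ≡ wt f S + wt f R + wt f Q) → size X < size Q → ⊥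
        too-long′ X w eq lt = too-long L X Q w dPQ
          (λ f → trans (eq f) (cong (_+ wt f Q) (sym (trans (cong (wt f) P≡) (wt-++ f S R))))) lt

      branch≤ : size Q ≤ size R
      branch≤ = ≮⇒≥ λ lt → too-long′ R (wS ⋈⟨ l~q ⟩ wQ)
        (λ f → trans (cong (_+ wt f R) (wt-++ f S Q)) (lemma (wt f S) (wt f Q) (wt f R))) lt
        where
        lemma : ∀ s q r → s + q + r ≡ s + r + q
        lemma = solve-∀

      -- The path v ... q l ... u z ... r omits only X, which is shorter than the branch. For
      -- `v-gap` the path is u ... l q ... v z ... r.
      u-gap : ∀ X z Y → R ≡ X ++ z ∷ Y → size X < size Q → ¬ E u z
      u-gap X z Y refl lt u~z = too-long′ X (rev wQ ⋈⟨ E-sym l~q ⟩ rev wS ⋈⟨ u~z ⟩ proj₂ (split X wR))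
        (λ f → trans (cong (_+ wt f X) (wt-shape f (↺ ‵ Q ⊕ ↺ ‵ S ⊕ ‵ (z ∷ Y))))
          (trans (lemma (wt f S) (wt f X) (wt f (z ∷ Y)) (wt f Q)) (cong (λ k → wt f S + k + wt f Q) (sym (wt-++ f X (z ∷ Y)))))) lt
        where
        lemma : ∀ s x y q → q + (s + y) + x ≡ s + (x + y) + q
        lemma = solve-∀

      v-gap : ∀ X z Y → R ≡ X ++ z ∷ Y → size X < size Q → ¬ E v z
      v-gap X z Y refl lt v~z = too-long′ X (wS ⋈⟨ l~q ⟩ wQ ⋈⟨ v~z ⟩ proj₂ (split X wR))
        (λ f → trans (cong (_+ wt f X) (wt-shape f (‵ S ⊕ ‵ Q ⊕ ‵ (z ∷ Y))))
          (trans (lemma (wt f S) (wt f X) (wt f (z ∷ Y)) (wt f Q)) (cong (λ k → wt f S + k + wt f Q) (sym (wt-++ f X (z ∷ Y)))))) lt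
        where
        lemma : ∀ s x y q → s + (q + y) + x ≡ s + (x + y) + q
        lemma = solve-∀

      v-last : ∀ X z → R ≡ X ++ z ∷ [] → ¬ E v z
      v-last X z refl v~z with split X wR
      ... | wX , ⟨ _ ⟩ = too-long′ [] (wS ⋈⟨ l~q ⟩ wQ ⋈⟨ v~z ⟩ rev wX)
        (λ f → trans (cong (_+ 0) (wt-shape f (‵ S ⊕ ‵ Q ⊕ ↺ ‵ (X ++ z ∷ []))))
          (lemma (wt f S) (wt f Q) (wt f (X ++ z ∷ [])))) (size≥1 wQ)
        where
        lemma : ∀ s q x → s + (q + x) + 0 ≡ s + x + q
        lemma = solve-∀

      -- The path r ... z′ u ... l q ... v z ... x uses all of P and Q.
      no-cross : ∀ X z z′ Y → R ≡ X ++ z ∷ z′ ∷ Y → E v z → ¬ E u z′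
      no-cross X z z′ Y refl v~z u~z′ with split X wR
      ... | wX , (e ∷ wY) with head≡ wY
      ...   | refl = too-long′ [] (rev wY ⋈⟨ E-sym u~z′ ⟩ wS ⋈⟨ l~q ⟩ wQ ⋈⟨ v~z ⟩ rev wX)
        (λ f → trans (cong (_+ 0) (wt-shape f (↺ ‵ (z′ ∷ Y) ⊕ ‵ S ⊕ ‵ Q ⊕ ↺ (‵ X ⊕ ‵ (z ∷ [])))))
          (trans (lemma (wt f S) (wt f X) (f z) (wt f (z′ ∷ Y)) (wt f Q)) (cong (λ k → wt f S + k + wt f Q) (sym (wt-++ f X (z ∷ z′ ∷ Y)))))) (size≥1 wQ)
        where
        lemma : ∀ s x z y q → y + (s + (q + (x + (z + 0)))) + 0 ≡ s + (x + (z + y)) + q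
        lemma = solve-∀

      -- The first |Q| vertices of R carry no neighbour of u or v; they make up
      -- for the neighbours of v on the branch.
      fork-count : ∀ {i j} → u ≡ inj₁ i → v ≡ inj₂ j → (∀ {z} → E v z → z ∈ l ∷ R ++ Q) → deg u + deg v ≤ wt nB P
      fork-count {i} {j} refl refl closed = ≤-by _ _ (+-mono-≤ (+-mono-≤ deg-u deg-v) (+-mono-≤ uS (+-mono-≤ vQ gap)))
        (trans (lemma (deg u) (deg v) (wt (adj# u) S) (wt (adj# u) R) (adj# v l) (wt (adj# v) R) (wt (adj# v) Q) (wt nB S) (wt nB R) (wt nB (take (size Q) R)))
          (cong (_+ _) (sym (trans (cong (wt nB) P≡) (wt-++ nB S R)))))
        where
        deg-u : deg u ≤ wt (adj# u) S + wt (adj# u) R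
        deg-u = ≤-trans (ΣV≤wt {xs = S ++ R} (λ z le → subst (z ∈_) P≡ (start-closed L (E-adj# le)))) (≤-reflexive (wt-++ _ S R))
        deg-v : deg v ≤ adj# v l + (wt (adj# v) R + wt (adj# v) Q)
        deg-v = ≤-trans (ΣV≤wt {xs = l ∷ R ++ Q} (λ z le → closed (E-adj# le))) (≤-reflexive (cong (adj# v l +_) (wt-++ _ R Q)))
        uS : wt (adj# u) S ≤ wt nB S
        uS = wt-mono adj#≤nB S
        -- The walk l Q ends at v in B, so its A-vertices are as many as the B-vertices of Q, and Q
        -- is level with the start of R.
        branch : wt nA (l ∷ Q) ≡ wt nB (take (size Q) R)
        branch = trans (+-cancelʳ-≡ (nB l) _ _ (trans (alternate (l~q ∷ wQ)) (trans (+-identityʳ _) (+-comm (nB l) (wt nB Q)))))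
          (in-step wQ wR (same-side l~q l~x) branch≤)
        vQ : adj# v l + wt (adj# v) Q ≤ wt nB (take (size Q) R)
        vQ = ≤-trans (+-mono-≤ (adj#≤nA l) (wt-mono adj#≤nA Q)) (≤-reflexive branch)
        gap : wt (adj# u) R + wt (adj# v) R + wt nB (take (size Q) R) ≤ wt nB R
        gap = cross-count-gap (size Q) wR (λ X z Y eq lt → u-gap X z Y eq lt , v-gap X z Y eq lt) no-cross v-last
        lemma : ∀ du dv uS uR vl vR vQ bS bR g →
          du + dv + (uS + uR + (vl + (vR + vQ)) + (bS + (g + bR))) ≡ bS + bR + (du + dv + (uS + (vl + vQ + (uR + vR + g))))
        lemma = solve-∀

-- Removing vertices

module Removal {a b : ℕ} (G : BipGraph a b) where
  open Graph G
  open Paths G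
  open LongestPath G

  nthSplit : ∀ n R → n < size R → ∃ λ X → ∃ λ z → ∃ λ Y → R ≡ X ++ z ∷ Y × size X ≡ n
  nthSplit zero    (z ∷ R) lt = [] , z , R , refl , refl
  nthSplit (suc n) (x ∷ R) (s≤s lt) with nthSplit n R lt
  ... | X , z , Y , refl , eq = x ∷ X , z , Y , refl , cong suc eq

  -- A branch leading to an outside B-vertex costs the end u one neighbour.
  end-degree : ∀ {i P r j} → (L : Longest (inj₁ i) P r) → Connected G → inj₂ j ∉ P → deg (inj₁ i) < wt nB P
  end-degree {i} {P} {r} {j} L conn o∉ with simple (conn (inj₂ j) (inj₁ i))
  ... | xs , w , d = body (find l∈P) refl
    where
    open Longest L
    u : V
    u = inj₁ i
    open FirstHit (firstHit P w o∉ (head∈ wP))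
    dQ : Distinct Q
    dQ = distinct-++ˡ Q (subst Distinct xs≡ d)
    dPQ : ∀ z → occ z P + occ z (reverse Q) ≤ 1
    dPQ z = ≡-≤-trans (cong (occ z P +_) (wt-reverse _ Q)) (disjoint-from dP dQ Q∩P z)
    body : ∀ {xs} → At l xs → xs ≡ P → deg u < wt nB P
    body (at X Y) eq = go (nthSplit (size Q ∸ 1) Y lt)
      where
      F : Fork u P r l Y (reverse Q) (inj₂ j)
      F = fork L X Y (sym eq) (rev wQ) (E-sym q~l) dPQ
      open ForkProperties L F
      open Fork F using (S; P≡; wR; l~x; l~q) renaming (wQ to wQ′)
      R : List V
      R = Y
      lt : size Q ∸ 1 < size R
      lt = ≡-≤-trans (m+[n∸m]≡n (size≥1 wQ)) (≡-≤-trans (sym (wt-reverse _ Q)) branch≤)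
      go : (∃ λ X → ∃ λ z → ∃ λ Y → R ≡ X ++ z ∷ Y × size X ≡ size Q ∸ 1) → deg u < wt nB P
      go (X′ , z , Y′ , R≡ , eqX) = begin-strict
        deg u                                                          ≤⟨ ΣV≤wt {xs = P} (λ z le → start-closed L (E-adj# le)) ⟩
        wt (adj# u) P                                                  ≡⟨ weights (adj# u) ⟩
        wt (adj# u) S + (wt (adj# u) X′ + (adj# u z + wt (adj# u) Y′)) <⟨ +-mono-≤-< (wt-mono adj#≤nB S) (+-mono-≤-< (wt-mono adj#≤nB X′) (+-mono-<-≤ z-gap (wt-mono adj#≤nB Y′))) ⟩
        wt nB S + (wt nB X′ + (nB z + wt nB Y′))                       ≡⟨ weights nB ⟨
        wt nB P                                                        ∎
        where
        open ≤-Reasoning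
        weights : ∀ f → wt f P ≡ wt f S + (wt f X′ + (f z + wt f Y′))
        weights f = trans (cong (wt f) P≡) (trans (wt-++ f S R) (cong (wt f S +_) (trans (cong (wt f) R≡) (wt-++ f X′ (z ∷ Y′)))))
        sizes : size X′ + 1 ≡ size Q
        sizes = trans (cong (_+ 1) eqX) (m∸n+n≡m (size≥1 wQ))
        -- z occupies in R the place that the end of the branch occupies in its leg, hence lies on
        -- the same side.
        z∈B : nB (inj₂ j) ≡ nB z
        z∈B = in-step-last wQ′ (proj₁ (split X′ (subst (λ R → Walk _ R r) R≡ wR))) (same-side l~q l~x)
          (trans (wt-reverse _ Q) (trans (sym sizes) (sym (wt-++ _ X′ (z ∷ [])))))
        z-gap : adj# u z < nB z
        z-gap = subst₂ _<_ (sym (adj#-¬E (u-gap X′ z Y′ R≡ (≡-≤-trans (trans (+-comm 1 _) sizes) (≤-reflexive (sym (wt-reverse _ Q))))))) z∈B (s≤s z≤n)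

  module Avoid (S : V → Set) where
    infixr 5 _∷_
    data AReach : V → V → Set where
      done : ∀ {x} → ¬ S x → AReach x x
      _∷_  : ∀ {x y z} → ¬ S x × E x y → AReach y z → AReach x z

    target : ∀ {x y} → AReach x y → ¬ S y
    target (done ¬s) = ¬s
    target (_ ∷ p)   = target p

    source : ∀ {x y} → AReach x y → ¬ S x
    source (done ¬s)       = ¬s
    source ((¬s , _) ∷ _) = ¬s

    _▷▷_ : ∀ {x y z} → AReach x y → AReach y z → AReach x z
    done _  ▷▷ q = q
    (e ∷ p) ▷▷ q = e ∷ (p ▷▷ q)

    asym : ∀ {x y} → AReach x y → AReach y x
    asym (done ¬s) = done ¬s
    asym ((¬s , e) ∷ p) = asym p ▷▷ ((source p , E-sym e) ∷ done ¬s)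

    along : ∀ {x xs y} → Walk x xs y → (∀ {z} → z ∈ xs → ¬ S z) → AReach x y
    along ⟨ x ⟩   ok = done (ok ∈-here)
    along (e ∷ w) ok = (ok ∈-here , e) ∷ along w (ok ∘ ∈-there)

    -- Follow a walk from x to k. Just before it enters S it stands at a neighbour of S, which
    -- reaches k off S by assumption.
    avoid : Connected G → (∀ x → Dec (S x)) → ∀ {k} → (∀ {s z} → S s → E s z → ¬ S z → AReach z k) →
      ¬ S k → ∀ x → ¬ S x → AReach x k
    avoid conn S? {k} nbrs ¬k x ¬x = go (conn x k) ¬x
      where
      go : ∀ {x} → Reach G x k → ¬ S x → AReach x k
      go here ¬x = done ¬x
      go (step {v = v} e p) ¬x with S? v
      ... | yes s = nbrs s (E-sym (Reach-E e)) ¬x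
      ... | no ¬s = (¬x , Reach-E e) ∷ go p ¬s

  Pair : V → V → V → Set
  Pair u v x = x ≡ u ⊎ x ≡ v

  Pair? : ∀ u v x → Dec (Pair u v x)
  Pair? u v x = (x ≟ⱽ u) ⊎-dec (x ≟ⱽ v)

  last∉prefix : ∀ {x z v} X Y → Walk x (X ++ z ∷ Y) v → Distinct (X ++ z ∷ Y) → z ≢ v → v ∉ X ++ z ∷ []
  last∉prefix {x} {z} {v} X Y w d z≢v v∈ with ∈-++⁻ X v∈
  ... | inj₂ v∈z = case ∈-∷⁻ v∈z of λ { (inj₁ z≡v) → z≢v z≡v ; (inj₂ v∈[]) → ∉[] v∈[] }
  ... | inj₁ v∈X = <⇒≱ (s≤s (≡-≤-trans (sym (wt-++ _ X (z ∷ Y))) (once d v)))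
    (+-mono-≤ (multiplicity v∈X) (multiplicity (last∈ (proj₂ (split X w)))))

  ∉-tail : ∀ {x xs} → Distinct (x ∷ xs) → x ∉ xs
  ∉-tail {x} {xs} d x∈ = <⇒≱ (s≤s (≡-≤-trans (cong (_+ occ x xs) (sym (δ-refl x))) (once d x))) (s≤s (multiplicity x∈))

  distinct-≡ : ∀ {xs ys} → xs ≡ ys → Distinct xs → Distinct ys
  distinct-≡ refl d = d

  -- Connectedness of G - S, expressed through a root so that one walk per vertex suffices.
  record Removable (S : V → Set) : Set where
    field
      root     : V
      reaches  : ∀ x → ¬ S x → Avoid.AReach S x root

  module _ {i j P} (L : Longest (inj₁ i) P (inj₂ j)) (conn : Connected G) {o} (o∉ : o ∉ P) where
    open Longest L
    private
      u v : V
      u = inj₁ i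
      v = inj₂ j
    open Avoid (Pair u v)
    open Opposite L conn o∉

    -- All neighbours of the two ends lie on P, and P without its ends is still connected.
    opposite-removable : Removable (Pair u v)
    opposite-removable with uncons wP (λ ())
    ... | y , ys , refl , u~y , w = record
      { root = y ; reaches = avoid conn (Pair? u v) nbrs y∉S }
      where
      y∉S : ¬ Pair u v y
      y∉S (inj₁ refl) = E-irrefl u~y
      y∉S (inj₂ refl) = u≁v u~y
      inP : ∀ {s z} → Pair u v s → E s z → z ∈ P
      inP (inj₁ refl) e = start-closed L e
      inP (inj₂ refl) e = ∈-resp (λ f → wt-reverse f P) (start-closed (reverse-longest L) e)
      nbrs : ∀ {s z} → Pair u v s → E s z → ¬ Pair u v z → AReach z y
      nbrs {s} {z} s∈S s~z z∉S with ∈-∷⁻ (inP s∈S s~z)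
      ... | inj₁ u≡z = ⊥-elim (z∉S (inj₁ (sym u≡z)))
      ... | inj₂ z∈ = body (find z∈) refl
        where
        body : ∀ {zs} → At z zs → zs ≡ y ∷ ys → AReach z y
        body (at X Y) eq = asym (along (proj₁ (split X w′)) ok)
          where
          w′ : Walk y (X ++ z ∷ Y) v
          w′ = subst (λ l → Walk y l v) (sym eq) w
          ok : ∀ {x} → x ∈ X ++ z ∷ [] → ¬ Pair u v x
          ok {x} x∈ (inj₁ refl) = ∉-tail (distinct-≡ (cong (u ∷_) (sym eq)) dP)
            (subst (u ∈_) (++-assoc X (z ∷ []) Y) (∈-++ˡ x∈))
          ok {x} x∈ (inj₂ refl) = last∉prefix X Y w′ (distinct-++ʳ (u ∷ []) (distinct-≡ (cong (u ∷_) (sym eq)) dP)) (λ z≡v → z∉S (inj₂ z≡v)) x∈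

  module _ {u P r l R Q v} (L : Longest u P r) (conn : Connected G) (F : Fork u P r l R Q v)
           (closed : ∀ {z} → E v z → z ∈ l ∷ R ++ Q) where
    open Longest L
    open Fork F
    open Avoid (Pair u v)

    private
      Q∉P : ∀ {z} → z ∈ Q → z ∉ P
      Q∉P {z} z∈Q z∈P = <⇒≱ (s≤s (dPQ z)) (+-mono-≤ (multiplicity z∈P) (multiplicity z∈Q))

      v∉P : v ∉ P
      v∉P = Q∉P (last∈ wQ)

      R⊆P : ∀ {z} → z ∈ R → z ∈ P
      R⊆P z∈ = subst (_ ∈_) (sym P≡) (∈-++ʳ S z∈)

      l∈P : l ∈ P
      l∈P = subst (l ∈_) (sym P≡) (∈-++ˡ (last∈ wS))

      l≢u : l ≢ u
      l≢u refl = Q∉P (head∈ wQ) (start-closed L l~q)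

      u≢r : u ≢ r
      u≢r u≡r = <⇒≱ (s≤s (≡-≤-trans (sym (trans (cong (occ u) P≡) (wt-++ _ S R))) (once dP u)))
        (+-mono-≤ (multiplicity (head∈ wS)) (multiplicity (subst (_∈ R) (sym u≡r) (last∈ wR))))

      P-reach : ∀ {z} → z ∈ P → z ≢ u → AReach z r
      P-reach {z} z∈ z≢u with uncons wP u≢r
      ... | y , ys , refl , u~y , w with ∈-∷⁻ z∈
      ... | inj₁ u≡z = ⊥-elim (z≢u (sym u≡z))
      ... | inj₂ z∈′ = body (find z∈′) refl
        where
        body : ∀ {zs} → At z zs → zs ≡ y ∷ ys → AReach z r
        body (at X Y) eq = along (proj₂ (split X (subst (λ l → Walk y l r) (sym eq) w))) ok
          where
          ok : ∀ {x} → x ∈ z ∷ Y → ¬ Pair u v x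
          ok x∈ (inj₁ refl) = ∉-tail dP (subst (_ ∈_) eq (∈-++ʳ X x∈))
          ok x∈ (inj₂ refl) = v∉P (∈-there (subst (_ ∈_) eq (∈-++ʳ X x∈)))

      Q-reach : ∀ {z} → z ∈ Q → z ≢ v → AReach z r
      Q-reach {z} z∈ z≢v = body (find z∈) refl
        where
        body : ∀ {zs} → At z zs → zs ≡ Q → AReach z r
        body (at X Y) eq = asym (along (proj₁ (split X w′)) ok) ▷▷ ((ok (head∈ (proj₁ (split X w′))) , E-sym l~q) ∷ P-reach l∈P l≢u)
          where
          w′ : Walk q (X ++ z ∷ Y) v
          w′ = subst (λ l → Walk q l v) (sym eq) wQ
          dQ : Distinct Q
          dQ = distinct λ z → ≤-trans (m≤n+m _ (occ z P)) (dPQ z)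
          ok : ∀ {x} → x ∈ X ++ z ∷ [] → ¬ Pair u v x
          ok x∈ (inj₁ refl) = Q∉P (subst (_ ∈_) (trans (++-assoc X (z ∷ []) Y) eq) (∈-++ˡ x∈)) (head∈ wP)
          ok x∈ (inj₂ refl) = last∉prefix X Y w′ (distinct-≡ (sym eq) dQ) z≢v x∈

    fork-u≁v : ¬ E u v
    fork-u≁v u~v = v∉P (start-closed L u~v)

    -- The neighbours of u and v lie on P and Q. From P - u one follows P to r; from Q - v one goes
    -- back to l and then on to r. Here l ≠ u, because the neighbour q of l lies off P.
    fork-removable : Removable (Pair u v)
    fork-removable = record { root = r ; reaches = avoid conn (Pair? u v) nbrs r∉S }
      where
      r∉S : ¬ Pair u v r
      r∉S (inj₁ refl) = u≢r refl
      r∉S (inj₂ refl) = v∉P (last∈ wP)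
      nbrs : ∀ {s z} → Pair u v s → E s z → ¬ Pair u v z → AReach z r
      nbrs (inj₁ refl) s~z z∉S = P-reach (start-closed L s~z) (z∉S ∘ inj₁)
      nbrs (inj₂ refl) s~z z∉S with ∈-∷⁻ (closed s~z)
      ... | inj₁ refl = P-reach l∈P l≢u
      ... | inj₂ z∈ with ∈-++⁻ R z∈
      ...   | inj₁ z∈R = P-reach (R⊆P z∈R) (z∉S ∘ inj₁)
      ...   | inj₂ z∈Q = Q-reach z∈Q (z∉S ∘ inj₂)

  end-removable : ∀ {u P r} → Longest u P r → Connected G → u ≢ r → Removable (_≡ u)
  end-removable {u} {P} {r} L conn u≢r with uncons (Longest.wP L) u≢r
  ... | y , ys , refl , u~y , w = record { root = r ; reaches = avoid conn (_≟ⱽ u) nbrs (λ r≡u → u≢r (sym r≡u)) }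
    where
    open Longest L
    open Avoid (_≡ u)
    nbrs : ∀ {s z} → s ≡ u → E s z → z ≢ u → AReach z r
    nbrs {z = z} refl s~z z≢u with ∈-∷⁻ (start-closed L s~z)
    ... | inj₁ u≡z = ⊥-elim (z≢u (sym u≡z))
    ... | inj₂ z∈ = body (find z∈) refl
      where
      body : ∀ {zs} → At z zs → zs ≡ y ∷ ys → AReach z r
      body (at X Y) eq = along (proj₂ (split X (subst (λ l → Walk y l r) (sym eq) w)))
        λ { x∈ refl → ∉-tail dP (subst (_ ∈_) eq (∈-++ʳ X x∈)) }

  -- Putting u back preserves connectedness, as u keeps its neighbour z.
  single-removable : ∀ {u v z} → Removable (Pair u v) → u ≢ v → E u z → z ≢ v → Removable (_≡ v)
  single-removable {u} {v} {z} R u≢v u~z z≢v = record { root = root ; reaches = go }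
    where
    open Removable R
    weaken : ∀ {x y} → Avoid.AReach (Pair u v) x y → Avoid.AReach (_≡ v) x y
    weaken (Avoid.done ¬s)         = Avoid.done (¬s ∘ inj₂)
    weaken ((¬s , e) Avoid.∷ p) = (¬s ∘ inj₂ , e) Avoid.∷ weaken p
    go : ∀ x → x ≢ v → Avoid.AReach (_≡ v) x root
    go x x≢v with x ≟ⱽ u
    ... | no x≢u   = weaken (reaches x λ { (inj₁ p) → x≢u p ; (inj₂ p) → x≢v p })
    ... | yes refl = (u≢v , u~z) Avoid.∷ weaken (reaches z λ { (inj₁ refl) → E-irrefl u~z ; (inj₂ p) → z≢v p })

-- Spanning trees of maximal depth

module SpanningTree {a b : ℕ} (G : BipGraph a b) where
  open Graph G
  open Paths G
  open LongestPath G
  open Removal G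

  -- A (partial) tree given by the path from each vertex to the root r;
  -- the empty list marks vertices outside the tree.
  record Tree (r : V) : Set where
    field
      rp    : V → List V
      shape : ∀ v → rp v ≡ [] ⊎ (v ≡ r × rp v ≡ r ∷ []) ⊎ ∃ λ w → E v w × rp v ≡ v ∷ rp w × rp w ≢ []

    tree-ind : (Q : V → Set) → (∀ v → rp v ≡ [] → Q v) → (rp r ≡ r ∷ [] → Q r) →
      (∀ v w → E v w → rp v ≡ v ∷ rp w → rp w ≢ [] → Q w → Q v) → ∀ v → Q v
    tree-ind Q out root child v = go (size (rp v)) v ≤-refl
      where
      go : ∀ n v → size (rp v) ≤ n → Q v
      go n v le with shape v
      ... | inj₁ eq = out v eq
      ... | inj₂ (inj₁ (refl , eq)) = root eq
      ... | inj₂ (inj₂ (w , e , eq , ne)) with n | subst (λ l → size l ≤ n) eq le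
      ...   | suc m | s≤s le′ = child v w e eq ne (go m w le′)

    -- Coherence of root paths. It gives that ancestors are in the tree and no deeper, and that two
    -- root paths agree from a common vertex on.
    suffix : ∀ v X {l Y} → rp v ≡ X ++ l ∷ Y → l ∷ Y ≡ rp l
    suffix v X {l} {Y} = tree-ind (λ v → ∀ X → rp v ≡ X ++ l ∷ Y → l ∷ Y ≡ rp l)
      (λ { v eq [] eq′ → case trans (sym eq) eq′ of λ () ; v eq (_ ∷ _) eq′ → case trans (sym eq) eq′ of λ () })
      (λ { eq [] eq′ → case ∷-injective (trans (sym eq) eq′) of λ { (refl , _) → sym eq′ }
         ; eq (_ ∷ []) eq′ → case trans (sym eq) eq′ of λ ()
         ; eq (_ ∷ _ ∷ _) eq′ → case trans (sym eq) eq′ of λ () })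
      (λ { v w e eq ne ih [] eq′ → case ∷-injective (trans (sym eq) eq′) of λ { (refl , _) → sym eq′ }
         ; v w e eq ne ih (_ ∷ X) eq′ → ih X (∷-injectiveʳ (trans (sym eq) eq′)) })
      v X

    rp-walk : ∀ v → rp v ≢ [] → Walk v (rp v) r
    rp-walk = tree-ind _ (λ v eq ne → ⊥-elim (ne eq)) (λ eq _ → subst (λ l → Walk r l r) (sym eq) ⟨ r ⟩)
      (λ v w e eq ne ih _ → subst (λ l → Walk v l r) (sym eq) (e ∷ ih ne))

    rp-self : ∀ {v} → rp v ≢ [] → v ∈ rp v
    rp-self ne = head∈ (rp-walk _ ne)

    ∈rp⇒≢[] : ∀ {z v} → z ∈ rp v → rp z ≢ []
    ∈rp⇒≢[] {z} {v} z∈ = body (find z∈) refl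
      where
      body : ∀ {zs} → At z zs → zs ≡ rp v → rp z ≢ []
      body (at X Y) eq rp≡[] = case trans (suffix v X (sym eq)) rp≡[] of λ ()

    ∈rp⇒size≤ : ∀ {z v} → z ∈ rp v → size (rp z) ≤ size (rp v)
    ∈rp⇒size≤ {z} {v} z∈ = body (find z∈) refl
      where
      body : ∀ {zs} → At z zs → zs ≡ rp v → size (rp z) ≤ size (rp v)
      body (at X Y) eq = ≡-≤-trans (cong size (sym (suffix v X (sym eq))))
        (≤-trans (m≤n+m _ (size X)) (≤-reflexive (trans (sym (wt-++ _ X (z ∷ Y))) (cong size eq))))

    -- If v lay on the path of its parent, its own path would be no longer than that one; but it is
    -- longer by one.
    rp-distinct : ∀ v → Distinct (rp v)
    rp-distinct = tree-ind _ (λ v eq → distinct-≡ (sym eq) (distinct λ _ → z≤n)) (λ eq → distinct-≡ (sym eq) (distinct-one r))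
      (λ v w e eq ne ih → distinct-≡ (sym eq) (distinct-∷
        (λ v∈ → <⇒≱ (≤-reflexive (sym (cong size eq))) (∈rp⇒size≤ v∈)) ih))

  -- Moves the subtree of y below x, or adds y if it is outside the tree, where its path is empty
  -- and has size 0. `y∉x` prevents a cycle, and `deep` makes y and everything below it strictly
  -- deeper.
  module Graft {r} (T : Tree r) {x y} (y~x : E y x) (y∉x : y ∉ Tree.rp T x) (x∈T : Tree.rp T x ≢ [])
               (deep : size (Tree.rp T y) ≤ size (Tree.rp T x)) where
    open Tree T

    gr : List V → List V
    gr []       = []
    gr (z ∷ zs) with z ≟ⱽ y
    ... | yes _ = y ∷ rp x
    ... | no _  = z ∷ gr zs

    gr-here : ∀ zs → gr (y ∷ zs) ≡ y ∷ rp x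
    gr-here zs with y ≟ⱽ y
    ... | yes _ = refl
    ... | no ¬p = ⊥-elim (¬p refl)

    gr-there : ∀ {z} zs → z ≢ y → gr (z ∷ zs) ≡ z ∷ gr zs
    gr-there {z} zs z≢y with z ≟ⱽ y
    ... | yes p = ⊥-elim (z≢y p)
    ... | no _  = refl

    gr-≢[] : ∀ {zs} → zs ≢ [] → gr zs ≢ []
    gr-≢[] {[]}     ne = ⊥-elim (ne refl)
    gr-≢[] {z ∷ zs} ne with z ≟ⱽ y
    ... | yes _ = λ ()
    ... | no _  = λ ()

    gr-∉ : ∀ {zs} → y ∉ zs → gr zs ≡ zs
    gr-∉ {[]}     y∉ = refl
    gr-∉ {z ∷ zs} y∉ = trans (gr-there zs λ { refl → y∉ ∈-here }) (cong (z ∷_) (gr-∉ (y∉ ∘ ∈-there)))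

    -- y is treated apart because `gr (rp y)` stays empty when y is outside the tree.
    new : V → List V
    new v with v ≟ⱽ y
    ... | yes _ = y ∷ rp x
    ... | no _  = gr (rp v)

    new-y : new y ≡ y ∷ rp x
    new-y with y ≟ⱽ y
    ... | yes _ = refl
    ... | no ¬p = ⊥-elim (¬p refl)

    new-≢ : ∀ {v} → v ≢ y → new v ≡ gr (rp v)
    new-≢ {v} v≢y with v ≟ⱽ y
    ... | yes p = ⊥-elim (v≢y p)
    ... | no _  = refl

    x≢y : x ≢ y
    x≢y refl = E-irrefl y~x

    y≢r : y ≢ r
    y≢r refl = y∉x (last∈ (rp-walk x x∈T))

    new-x : new x ≡ rp x
    new-x = trans (new-≢ x≢y) (gr-∉ y∉x)

    gr-rp-y : rp y ≢ [] → gr (rp y) ≡ new y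
    gr-rp-y ne with rp y | rp-walk y ne
    ... | z ∷ zs | w with head≡ w
    ...   | refl = trans (gr-here zs) (sym new-y)

    gr-rp : ∀ w → rp w ≢ [] → gr (rp w) ≡ new w
    gr-rp w ne with w ≟ⱽ y
    ... | yes refl = trans (gr-rp-y ne) new-y
    ... | no w≢y   = refl

    new-child : ∀ {v w} → v ≢ y → rp v ≡ v ∷ rp w → rp w ≢ [] → new v ≡ v ∷ new w
    new-child {v} {w} v≢y eq ne = trans (new-≢ v≢y) (trans (cong gr eq) (trans (gr-there _ v≢y) (cong (v ∷_) (gr-rp w ne))))

    new-≢[] : ∀ {w} → rp w ≢ [] → new w ≢ []
    new-≢[] {w} ne eq = gr-≢[] ne (trans (gr-rp w ne) eq)

    grafted : Tree r
    grafted = record { rp = new ; shape = shape′ }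
      where
      shape′ : ∀ v → new v ≡ [] ⊎ (v ≡ r × new v ≡ r ∷ []) ⊎ ∃ λ w → E v w × new v ≡ v ∷ new w × new w ≢ []
      shape′ v = case v ≟ⱽ y of λ
        { (yes refl) → inj₂ (inj₂ (x , y~x , trans new-y (cong (y ∷_) (sym new-x)) , new-≢[] x∈T))
        ; (no v≢y) → case shape v of λ
          { (inj₁ eq) → inj₁ (trans (new-≢ v≢y) (cong gr eq))
          ; (inj₂ (inj₁ (refl , eq))) → inj₂ (inj₁ (refl , trans (new-≢ v≢y) (trans (cong gr eq) (gr-there [] v≢y))))
          ; (inj₂ (inj₂ (w , e , eq , ne))) → inj₂ (inj₂ (w , e , new-child v≢y eq ne , new-≢[] ne)) } }

    grows-y : size (rp y) < size (new y)
    grows-y = ≤-trans (s≤s deep) (≤-reflexive (sym (cong size new-y)))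

    grows : ∀ v → size (rp v) ≤ size (new v)
    grows = tree-ind _ (λ v eq → ≡-≤-trans (cong size eq) z≤n)
      (λ eq → ≤-reflexive (cong size (trans eq (sym (trans (new-≢ (y≢r ∘ sym)) (trans (cong gr eq) (gr-there [] (y≢r ∘ sym))))))))
      λ v w e eq ne ih → case v ≟ⱽ y of λ
        { (yes refl) → <⇒≤ grows-y
        ; (no v≢y) → ≡-≤-trans (cong size eq) (≤-trans (s≤s ih) (≤-reflexive (sym (cong size (new-child v≢y eq ne))))) }

    grows-above : ∀ v → y ∈ rp v → size (rp v) < size (new v)
    grows-above = tree-ind _ (λ v eq y∈ → ⊥-elim (∉[] (subst (y ∈_) eq y∈)))
      (λ eq y∈ → case ∈-∷⁻ (subst (y ∈_) eq y∈) of λ { (inj₁ r≡y) → ⊥-elim (y≢r (sym r≡y)) ; (inj₂ y∈[]) → ⊥-elim (∉[] y∈[]) })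
      λ v w e eq ne ih y∈ → case v ≟ⱽ y of λ
        { (yes refl) → grows-y
        ; (no v≢y) → case ∈-∷⁻ (subst (y ∈_) eq y∈) of λ
          { (inj₁ v≡y) → ⊥-elim (v≢y v≡y)
          ; (inj₂ y∈w) → ≤-trans (s≤s (≤-reflexive (cong size eq))) (≤-trans (s≤s (ih y∈w)) (≤-reflexive (sym (cong size (new-child v≢y eq ne))))) } }

  dropTo : V → List V → List V
  dropTo v []       = []
  dropTo v (x ∷ xs) with x ≟ⱽ v
  ... | yes _ = x ∷ xs
  ... | no _  = dropTo v xs

  dropTo-here : ∀ x xs → dropTo x (x ∷ xs) ≡ x ∷ xs
  dropTo-here x xs with x ≟ⱽ x
  ... | yes _ = refl
  ... | no ¬p = ⊥-elim (¬p refl)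

  dropTo-there : ∀ {v x} xs → x ≢ v → dropTo v (x ∷ xs) ≡ dropTo v xs
  dropTo-there {v} {x} xs x≢v with x ≟ⱽ v
  ... | yes p = ⊥-elim (x≢v p)
  ... | no _  = refl

  dropTo-∉ : ∀ {v xs} → v ∉ xs → dropTo v xs ≡ []
  dropTo-∉ {v} {[]}     v∉ = refl
  dropTo-∉ {v} {x ∷ xs} v∉ = trans (dropTo-there {v} {x} xs λ { refl → v∉ ∈-here }) (dropTo-∉ (v∉ ∘ ∈-there))

  dropTo-head : ∀ {x xs y} → Walk x xs y → dropTo x xs ≡ xs
  dropTo-head ⟨ x ⟩          = dropTo-here x []
  dropTo-head {x} (_∷_ {ys = ys} e w) = dropTo-here x ys

  -- P itself as a partial tree: the root path of a vertex is the tail of P from it on, and the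
  -- vertices off P are outside.
  path-tree : ∀ {u P r} → Walk u P r → Distinct P → Tree r
  path-tree {u} {P} {r} wP dP = record { rp = λ v → dropTo v P ; shape = λ v → go wP dP v }
    where
    go : ∀ {x xs} → Walk x xs r → Distinct xs → ∀ v → dropTo v xs ≡ [] ⊎ (v ≡ r × dropTo v xs ≡ r ∷ []) ⊎
      ∃ λ w → E v w × dropTo v xs ≡ v ∷ dropTo w xs × dropTo w xs ≢ []
    go ⟨ x ⟩ d v = case x ≟ⱽ v of λ
      { (yes refl) → inj₂ (inj₁ (refl , dropTo-here x []))
      ; (no x≢v)   → inj₁ (dropTo-there [] x≢v) }
    go {x} (_∷_ {y = y} {ys = ys} e w) d v = case x ≟ⱽ v of λ
      { (yes refl) → inj₂ (inj₂ (y , e , trans (dropTo-here x ys) (cong (x ∷_) (sym skip-y)) , λ eq → ne w (trans (sym skip-y) eq)))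
      ; (no x≢v) → case go w (distinct-++ʳ (x ∷ []) d) v of λ
        { (inj₁ eq) → inj₁ (trans (dropTo-there ys x≢v) eq)
        ; (inj₂ (inj₁ (v≡r , eq))) → inj₂ (inj₁ (v≡r , trans (dropTo-there ys x≢v) eq))
        ; (inj₂ (inj₂ (p , v~p , eq , p≢[]))) →
            let x≢p : x ≢ p
                x≢p = λ { refl → p≢[] (dropTo-∉ (∉-tail d)) } in
            inj₂ (inj₂ (p , v~p , trans (dropTo-there ys x≢v) (trans eq (cong (v ∷_) (sym (dropTo-there ys x≢p)))) ,
              λ eq → p≢[] (trans (sym (dropTo-there ys x≢p)) eq))) } }
      where
      skip-y : dropTo y (x ∷ ys) ≡ ys
      skip-y = trans (dropTo-there {y} {x} ys λ { refl → E-irrefl e }) (dropTo-head w)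
      ne : ∀ {y ys} → Walk y ys r → ys ≢ []
      ne ⟨ _ ⟩ ()
      ne (_ ∷ _) ()

  module _ {i i′ P} (L : Longest (inj₁ i) P (inj₁ i′)) (conn : Connected G) (a≤b : a ≤ b) where
    open Longest L
    private
      u r : V
      u = inj₁ i
      r = inj₁ i′

      PTree : Set
      PTree = Σ (Tree r) λ T → Tree.rp T u ≡ P

      depth : PTree → ℕ
      depth (T , _) = ΣV (size ∘ Tree.rp T)

      size-rp≤ : ∀ (T : Tree r) v → size (Tree.rp T v) ≤ size P
      size-rp≤ T v with Tree.rp T v in eq
      ... | []     = z≤n
      ... | z ∷ zs = ≡-≤-trans (cong size (sym eq))
        (longest (Tree.rp-walk T v λ eq′ → case trans (sym eq) eq′ of λ ()) (Tree.rp-distinct T v))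

    -- In a spanning tree through P of maximal total depth the neighbours of a
    -- leaf are ancestors, and since b ≥ a some leaf other than the root lies in B.
    module Deepest (T : Tree r) (rp-u : Tree.rp T u ≡ P) (deepest : ∀ T′ → depth T′ ≤ depth (T , rp-u)) where
      open Tree T

      -- Otherwise y could be grafted below x. If y lies on P, this makes the path from u to r
      -- longer than P; if not, P stays in the tree and the total depth grows.
      no-graft : ∀ {x y} → E y x → y ∉ rp x → rp x ≢ [] → size (rp x) < size (rp y)
      no-graft {x} {y} y~x y∉x x∈T = ≰⇒> λ deep →
        let open Graft T y~x y∉x x∈T deep in
        case y ∈? rp u of λ
          { (yes y∈) → <⇒≱ (≤-trans (s≤s (≤-reflexive (cong size (sym rp-u)))) (grows-above u y∈)) (size-rp≤ grafted u)
          ; (no y∉) → <⇒≱ (ΣV-mono-< grows y grows-y)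
              (deepest (grafted , trans (new-≢ (λ { refl → y∉ (rp-self (λ eq → case trans (sym eq) rp-u of λ { refl → case wP of λ () })) })) (trans (gr-∉ y∉) rp-u))) }

      r∈T : rp r ≢ []
      r∈T = ∈rp⇒≢[] {v = u} (subst (r ∈_) (sym rp-u) (last∈ wP))

      -- A vertex outside the tree has depth 0, so `no-graft` forbids an edge from the tree to it.
      spanning : ∀ v → rp v ≢ []
      spanning v = go (conn r v) r∈T
        where
        go : ∀ {x} → Reach G x v → rp x ≢ [] → rp v ≢ []
        go here x∈T = x∈T
        go (step {u = x} {v = y} e p) x∈T = go p λ y∉T →
          <⇒≱ (no-graft (E-sym (Reach-E e)) (λ y∈ → ∈rp⇒≢[] y∈ y∉T) x∈T) (≡-≤-trans (cong size y∉T) z≤n)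

      Child : Fin b → Fin a → Set
      Child j k = rp (inj₁ k) ≡ inj₁ k ∷ rp (inj₂ j)

      child? : ∀ j → Dec (∃ λ k → Child j k)
      child? j = any? λ k → ≡-dec _≟ⱽ_ (rp (inj₁ k)) (inj₁ k ∷ rp (inj₂ j))

      rp-injective : ∀ {v w} → rp v ≡ rp w → v ≡ w
      rp-injective {v} {w} eq with rp v | rp-walk v (spanning v) | rp w | rp-walk w (spanning w)
      rp-injective refl | [] | () | _ | _
      rp-injective refl | _ ∷ _ | wv | _ | ww = trans (head≡ wv) (sym (head≡ ww))

      rp-r : rp r ≡ r ∷ []
      rp-r with shape r
      ... | inj₁ eq = ⊥-elim (r∈T eq)
      ... | inj₂ (inj₁ (_ , eq)) = eq
      ... | inj₂ (inj₂ (w , e , eq , ne)) = ⊥-elim (∉-tail (distinct-≡ eq (rp-distinct r)) (last∈ (rp-walk w ne)))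

      -- If every B-vertex had a child, choosing one for each would inject B into A and miss the
      -- root, which has no parent, contrary to a ≤ b.
      leaf : ∃ λ j → ¬ ∃ λ k → Child j k
      leaf = ¬∀⟶∃¬ b _ child? no-injection
        where
        no-injection : ¬ (∀ j → ∃ λ k → Child j k)
        no-injection ch = pigeon {a} i′ (proj₁ ∘ ch) inj (λ j eq → case ∷-injectiveʳ (trans (sym (subst (λ k → rp (inj₁ k) ≡ inj₁ k ∷ rp (inj₂ j)) (sym eq) (proj₂ (ch j)))) rp-r) of spanning (inj₂ j)) a≤b
          where
          inj : ∀ {j j′} → proj₁ (ch j) ≡ proj₁ (ch j′) → j ≡ j′
          inj {j} {j′} eq with ch j | ch j′
          inj refl | k , p | .k , q with rp-injective (∷-injectiveʳ (trans (sym p) q))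
          ... | refl = refl
          pigeon : ∀ {a} (i′ : Fin a) (f : Fin b → Fin a) → (∀ {j j′} → f j ≡ f j′ → j ≡ j′) → (∀ j → i′ ≢ f j) → ¬ a ≤ b
          pigeon {suc a} i′ f f-inj miss le =
            <⇒≱ le (injective⇒≤ {f = λ j → punchOut (miss j)} (f-inj ∘ punchOut-injective (miss _) (miss _)))

      module Leaf (j : Fin b) (no-child : ¬ ∃ λ k → Child j k) where
        private
          v : V
          v = inj₂ j

        v∉ : ∀ x → x ≢ v → v ∉ rp x
        v∉ = tree-ind _ (λ x eq _ v∈ → ∉[] (subst (v ∈_) eq v∈))
          (λ eq r≢v v∈ → case ∈-∷⁻ (subst (v ∈_) eq v∈) of λ { (inj₂ v∈[]) → ∉[] v∈[] })
          λ x w e eq ne ih x≢v v∈ → case ∈-∷⁻ (subst (v ∈_) eq v∈) of λ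
            { (inj₁ x≡v) → x≢v x≡v
            ; (inj₂ v∈w) → case w ≟ⱽ v of λ
              { (no w≢v) → ih w≢v v∈w
              ; (yes refl) → only-child x e eq } }
          where
          only-child : ∀ x → E x v → rp x ≡ x ∷ rp v → ⊥
          only-child (inj₁ k) e eq = no-child (k , eq)
          only-child (inj₂ _) (edge ()) eq

        -- The leaf v is an ancestor of no other vertex. If x were no ancestor of v either,
        -- `no-graft` in both directions would make each strictly deeper than the other.
        closed : ∀ {x} → E v x → x ∈ rp v
        closed {x} v~x with x ∈? rp v
        ... | yes x∈ = x∈
        ... | no x∉  = ⊥-elim (<-asym
          (no-graft v~x (v∉ x (λ { refl → E-irrefl v~x })) (spanning x)) (no-graft (E-sym v~x) x∉ (spanning v)))

        v∉P : v ∉ P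
        v∉P = subst (v ∉_) rp-u (v∉ u λ ())

        hit : FirstHit P v (rp v) r
        hit = firstHit P (rp-walk v (spanning v)) v∉P (last∈ wP)
        open FirstHit hit

        dQ : Distinct Q
        dQ = distinct-++ˡ Q (distinct-≡ xs≡ (rp-distinct v))

        result : ∀ {Goal : Set} → (∀ {l R Q} → Fork u P r l R Q v → (∀ {z} → E v z → z ∈ l ∷ R ++ Q) → Goal) → Goal
        result {Goal} k = body (find l∈P) refl
          where
          body : ∀ {xs} → At l xs → xs ≡ P → Goal
          body (at X Y) eq = k (fork L X Y (sym eq) (rev wQ) (E-sym q~l) dPQ) closed′
            where
            dPQ : ∀ z → occ z P + occ z (reverse Q) ≤ 1
            dPQ z = ≡-≤-trans (cong (occ z P +_) (wt-reverse _ Q)) (disjoint-from dP dQ Q∩P z)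
            -- From l on, both P and the root path of v are the root path of l, so the ancestors of
            -- v lie on l, R and the branch.
            rest≡ : l ∷ rest ≡ l ∷ Y
            rest≡ = trans (suffix v Q xs≡) (sym (suffix u X (trans rp-u (sym eq))))
            closed′ : ∀ {z} → E v z → z ∈ l ∷ Y ++ reverse Q
            closed′ {z} v~z = [ (λ z∈Q → ∈-++ʳ (l ∷ Y) (∈-resp (λ f → sym (wt-reverse f Q)) z∈Q))
                          , (λ z∈ → ∈-++ˡ (subst (z ∈_) rest≡ z∈)) ]′ (∈-++⁻ Q (subst (_ ∈_) xs≡ (closed v~z)))

    -- The climb starts from the tree formed by P alone. Root paths are paths, so no vertex is
    -- deeper than |P| and the total depth is bounded.
    B-leaf : ∀ {Goal : Set} → Dec Goal →
      (∀ {j l R Q} → Fork u P r l R Q (inj₂ j) → (∀ {z} → E (inj₂ j) z → z ∈ l ∷ R ++ Q) → Goal) → Goal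
    B-leaf dec k = maximise depth (ΣV (λ _ → size P)) (λ { (T , _) → ΣV-mono (size-rp≤ T) }) dec
      (path-tree wP dP , dropTo-head wP)
      λ { (T , rp-u) deepest → let open Deepest T rp-u deepest in Leaf.result (proj₁ leaf) (proj₂ leaf) k }

-- Embeddings, exchange of the sides, deletion of vertices

Bounded : ∀ {a b} → BipGraph a b → ℕ → Set
Bounded G N = ∀ {x xs y} → Walk x xs y → Distinct xs → size xs ≤ N
  where open Graph G

module Embedding {a b a′ b′ : ℕ} (G : BipGraph a b) (G′ : BipGraph a′ b′)
  (ι : Vertex a′ b′ → Vertex a b) (ι-inj : ∀ {x y} → ι x ≡ ι y → x ≡ y)
  (ι-E : ∀ {x y} → Graph.E G′ x y → Graph.E G (ι x) (ι y)) where
  open Graph G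
  private module G′ = Graph G′

  map-walk : ∀ {x xs y} → G′.Walk x xs y → Walk (ι x) (List.map ι xs) (ι y)
  map-walk G′.⟨ x ⟩     = ⟨ ι x ⟩
  map-walk (e G′.∷ w) = ι-E e ∷ map-walk w

  wt-map : ∀ f xs → wt f (List.map ι xs) ≡ G′.wt (f ∘ ι) xs
  wt-map f []       = refl
  wt-map f (x ∷ xs) = cong (f (ι x) +_) (wt-map f xs)

  δ-ι : ∀ x v → δ (ι x) (ι v) ≡ G′.δ x v
  δ-ι x v with x G′.≟ⱽ v
  ... | yes refl = δ-refl (ι x)
  ... | no x≢v   = δ-≢ (x≢v ∘ ι-inj)

  occ-map : ∀ v xs → occ (ι v) (List.map ι xs) ≡ G′.occ v xs
  occ-map v []       = refl
  occ-map v (x ∷ xs) = cong₂ _+_ (δ-ι x v) (occ-map v xs)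

  ∈-map⁻ : ∀ {z} xs → z ∈ List.map ι xs → ∃ λ x → x G′.∈ xs × ι x ≡ z
  ∈-map⁻ []       z∈ = ⊥-elim (∉[] z∈)
  ∈-map⁻ (x ∷ xs) z∈ with ∈-∷⁻ z∈
  ... | inj₁ p = x , G′.∈-here , p
  ... | inj₂ z∈′ with ∈-map⁻ xs z∈′
  ...   | y , y∈ , p = y , G′.∈-there y∈ , p

  map-distinct : ∀ {xs} → G′.Distinct xs → Distinct (List.map ι xs)
  map-distinct {xs} d = distinct λ z → case z ∈? List.map ι xs of λ
    { (no z∉)  → ≡-≤-trans (∉⇒occ≡0 z∉) z≤n
    ; (yes z∈) → case ∈-map⁻ xs z∈ of λ { (x , _ , refl) → ≡-≤-trans (occ-map x xs) (G′.once d x) } }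

  bounded : ∀ {N} → Bounded G N → Bounded G′ N
  bounded bd {xs = xs} w d = ≡-≤-trans (sym (wt-map (λ _ → 1) xs)) (bd (map-walk w) (map-distinct d))

  module _ {S : Vertex a b → Set} (R : Removal.Removable G S) (avoids : ∀ x → ¬ S (ι x))
    (onto : ∀ z → ¬ S z → ∃ λ x → ι x ≡ z) (back : ∀ {x y} → E (ι x) (ι y) → Adj G′ x y) where
    open Removal G using (module Avoid; module Removable)
    open Avoid S
    open Removable R

    private
      lift : ∀ {p q} → AReach p q → ∀ x y → ι x ≡ p → ι y ≡ q → Reach G′ x y
      lift (done _) x y refl eq with ι-inj eq
      ... | refl = here
      lift ((_ , e) ∷ p) x y refl eq with onto _ (source p)
      ... | z , refl = step (back e) (lift p z y refl eq)

    connected : Connected G′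
    connected x y = lift (reaches (ι x) (avoids x) ▷▷ asym (reaches (ι y) (avoids y))) x y refl refl

module Flip {a b : ℕ} (G : BipGraph a b) where
  flip-E : ∀ {x y} → Graph.E (flip G) x y → Graph.E G (swap x) (swap y)
  flip-E {inj₁ _} {inj₂ _} (Graph.edge e) = Graph.edge e
  flip-E {inj₂ _} {inj₁ _} (Graph.edge e) = Graph.edge e

  swap-inj : ∀ {x y : Vertex b a} → swap x ≡ swap y → x ≡ y
  swap-inj {inj₁ _} {inj₁ _} refl = refl
  swap-inj {inj₂ _} {inj₂ _} refl = refl

  open Embedding G (flip G) swap swap-inj flip-E public using (map-walk; wt-map; map-distinct; bounded; ∈-map⁻)

  flip-reach : ∀ {x y} → Reach G x y → Reach (flip G) (swap x) (swap y)
  flip-reach here = here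
  flip-reach (step {inj₁ _} {inj₂ _} e p) = step e (flip-reach p)
  flip-reach (step {inj₂ _} {inj₁ _} e p) = step e (flip-reach p)

  flip-connected : Connected G → Connected (flip G)
  flip-connected conn (inj₁ x) (inj₁ y) = flip-reach (conn (inj₂ x) (inj₂ y))
  flip-connected conn (inj₁ x) (inj₂ y) = flip-reach (conn (inj₂ x) (inj₁ y))
  flip-connected conn (inj₂ x) (inj₁ y) = flip-reach (conn (inj₁ x) (inj₂ y))
  flip-connected conn (inj₂ x) (inj₂ y) = flip-reach (conn (inj₁ x) (inj₁ y))

delB : ∀ {a b} → Fin (suc b) → BipGraph a (suc b) → BipGraph a b
delB j G i j′ = G i (punchIn j j′)

delA : ∀ {a b} → Fin (suc a) → BipGraph (suc a) b → BipGraph a b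
delA i G i′ = G (punchIn i i′)

edges-delA : ∀ {a b} i (G : BipGraph (suc a) b) → edges G ≡ row G i + edges (delA i G)
edges-delA i G = sum-remove {i = i} (row G)

edges-delB : ∀ {a b} j (G : BipGraph a (suc b)) → edges G ≡ row (flip G) j + edges (delB j G)
edges-delB j G = trans (sym (edges-flip G)) (trans (edges-delA j (flip G)) (cong (row (flip G) j +_) (edges-flip (delB j G))))

row-delB : ∀ {a b} j (G : BipGraph a (suc b)) i → row G i ≡ ⟦ G i j ⟧ + row (delB j G) i
row-delB j G i = sum-remove {i = j} (λ j → ⟦ G i j ⟧)

-- As i and j are not adjacent, no edge is counted in both degrees.
edges-del : ∀ {a b} i j (G : BipGraph (suc a) (suc b)) → G i j ≡ false →
  edges G ≡ row G i + row (flip G) j + edges (delB j (delA i G))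
edges-del i j G eq = begin
  edges G                                                             ≡⟨ edges-delA i G ⟩
  row G i + edges (delA i G)                                          ≡⟨ cong (row G i +_) (edges-delB j (delA i G)) ⟩
  row G i + (row (flip (delA i G)) j + edges (delB j (delA i G)))     ≡⟨ sym (+-assoc (row G i) _ _) ⟩
  row G i + row (flip (delA i G)) j + edges (delB j (delA i G))       ≡⟨ cong (λ k → row G i + k + edges (delB j (delA i G))) (sym col) ⟩
  row G i + row (flip G) j + edges (delB j (delA i G))                ∎
  where
  open ≡-Reasoning
  col : row (flip G) j ≡ row (flip (delA i G)) j
  col = trans (row-delB i (flip G) j) (cong (λ k → ⟦ k ⟧ + row (flip (delA i G)) j) eq)

module Induced {a b a′ b′ : ℕ} (G : BipGraph a b) (ιA : Fin a′ → Fin a) (ιB : Fin b′ → Fin b)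
  (ιA-inj : ∀ {x y} → ιA x ≡ ιA y → x ≡ y) (ιB-inj : ∀ {x y} → ιB x ≡ ιB y → x ≡ y) where

  H : BipGraph a′ b′
  H i j = G (ιA i) (ιB j)

  ι : Vertex a′ b′ → Vertex a b
  ι = Sum.map ιA ιB

  ι-inj : ∀ {x y} → ι x ≡ ι y → x ≡ y
  ι-inj {inj₁ _} {inj₁ _} eq = cong inj₁ (ιA-inj (inj₁-injective eq))
  ι-inj {inj₂ _} {inj₂ _} eq = cong inj₂ (ιB-inj (inj₂-injective eq))

  ι-E : ∀ {x y} → Graph.E H x y → Graph.E G (ι x) (ι y)
  ι-E {inj₁ _} {inj₂ _} (Graph.edge e) = Graph.edge e
  ι-E {inj₂ _} {inj₁ _} (Graph.edge e) = Graph.edge e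

  ι-back : ∀ {x y} → Graph.E G (ι x) (ι y) → Adj H x y
  ι-back {inj₁ _} {inj₂ _} (Graph.edge e) = e
  ι-back {inj₂ _} {inj₁ _} (Graph.edge e) = e

  open Embedding G H ι ι-inj ι-E public

module DelB {a b : ℕ} (G : BipGraph a (suc b)) (j : Fin (suc b)) where
  open Induced G (λ i → i) (punchIn j) (λ eq → eq) (punchIn-injective j _ _) public

  delB-connected : Removal.Removable G (_≡ inj₂ j) → Connected (delB j G)
  delB-connected R = connected R
    (λ { (inj₁ _) () ; (inj₂ j′) eq → punchInᵢ≢i j j′ (inj₂-injective eq) })
    (λ { (inj₁ i) _ → inj₁ i , refl
       ; (inj₂ k) k≢j → let j≢k = λ eq → k≢j (cong inj₂ (sym eq)) in inj₂ (punchOut j≢k) , cong inj₂ (punchIn-punchOut j≢k) })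
    ι-back

module DelPair {a b : ℕ} (G : BipGraph (suc a) (suc b)) (i : Fin (suc a)) (j : Fin (suc b)) where
  open Induced G (punchIn i) (punchIn j) (punchIn-injective i _ _) (punchIn-injective j _ _) public

  pair-connected : Removal.Removable G (Removal.Pair G (inj₁ i) (inj₂ j)) → Connected H
  pair-connected R = connected R
    (λ { (inj₁ i′) (inj₁ eq) → punchInᵢ≢i i i′ (inj₁-injective eq) ; (inj₁ _) (inj₂ ())
       ; (inj₂ j′) (inj₂ eq) → punchInᵢ≢i j j′ (inj₂-injective eq) ; (inj₂ _) (inj₁ ()) })
    (λ { (inj₁ k) k∉ → let i≢k = λ eq → k∉ (inj₁ (cong inj₁ (sym eq))) in inj₁ (punchOut i≢k) , cong inj₁ (punchIn-punchOut i≢k)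
       ; (inj₂ k) k∉ → let j≢k = λ eq → k∉ (inj₂ (cong inj₂ (sym eq))) in inj₂ (punchOut j≢k) , cong inj₂ (punchIn-punchOut j≢k) })
    ι-back

-- Vertices of degree at least two and the extremal bound

heavy? : ∀ {a b} (G : BipGraph a b) i → Dec (2 ≤ row G i)
heavy? G i = 2 ≤? row G i

heavy : ∀ {a b} → BipGraph a b → ℕ
heavy G = ∑ λ i → ⟦ does (heavy? G i) ⟧

row≤b : ∀ {a b} (G : BipGraph a b) i → row G i ≤ b
row≤b {b = b} G i = ≤-trans (∑-mono λ j → ⟦⟧≤1 (G i j)) (≤-reflexive (∑-one b))

-- The bound t b + (a - t), stated without subtraction, and the shape of the
-- extremal graphs: at most t vertices of A have degree at least 2.
Strict : ∀ {a b} → ℕ → BipGraph a b → Set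
Strict {a} {b} t G = edges G + t < t * b + a

Thin : ∀ {a b} → ℕ → BipGraph a b → Set
Thin t G = heavy G ≤ t

-- For a = b the two classes may exchange roles; the isomorphisms of the theorem need not preserve
-- the sides.
Result : ∀ {a b} → ℕ → BipGraph a b → Set
Result {a} {b} t G = Strict t G ⊎ Thin t G ⊎ (a ≡ b × Thin t (flip G))

result? : ∀ {a b} t (G : BipGraph a b) → Dec (Result t G)
result? {a} {b} t G = (edges G + t <? t * b + a) ⊎-dec ((heavy G ≤? t) ⊎-dec ((a Data.Nat.≟ b) ×-dec (heavy (flip G) ≤? t)))

strict-flip : ∀ {n} t (G : BipGraph n n) → Strict t (flip G) → Strict t G
strict-flip {n} t G = subst (λ e → e + t < t * n + n) (edges-flip G)

result-flip : ∀ {n} t (G : BipGraph n n) → Result t (flip G) → Result t G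
result-flip t G (inj₁ s) = inj₁ (strict-flip t G s)
result-flip t G (inj₂ (inj₁ th)) = inj₂ (inj₂ (refl , th))
result-flip t G (inj₂ (inj₂ (_ , th))) = inj₂ (inj₁ th)

module _ {a b : ℕ} (G : BipGraph a b) where
  private
    h : Fin a → ℕ
    h i = ⟦ does (heavy? G i) ⟧

    -- A heavy vertex has degree at most b, a light one at most 1. Summation bounds `edges G` by a +
    -- heavy (b - 1).
    pointwise : ∀ i → row G i + h i ≤ 1 + h i * b
    pointwise i = go (heavy? G i)
      where
      go : (d : Dec (2 ≤ row G i)) → row G i + ⟦ does d ⟧ ≤ 1 + ⟦ does d ⟧ * b
      go (yes _) = ≡-≤-trans (+-comm (row G i) 1) (s≤s (≤-trans (row≤b G i) (≤-reflexive (sym (+-identityʳ b)))))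
      go (no ¬h) = ≡-≤-trans (+-identityʳ _) (≤-pred (≰⇒> ¬h))

    lhs : ∑ (λ i → row G i + h i) ≡ edges G + heavy G
    lhs = ∑-distrib-+ (row G) h

    rhs : ∑ (λ i → 1 + h i * b) ≡ a + heavy G * b
    rhs = trans (∑-distrib-+ (λ _ → 1) (λ i → h i * b)) (cong₂ _+_ (∑-one a) (∑-*ʳ h b))

    -- Raising the number of heavy vertices by d to t adds d b to the right side and only d to the
    -- left; e is slack known beforehand. Strictness follows from e = 1 if b ≥ 1, or from d > 0 if b
    -- ≥ 2.
    slack : ∀ {t} d → heavy G + d ≡ t → ∀ e → edges G + heavy G + e ≤ a + heavy G * b → edges G + t + (e + d * b) ≤ t * b + a + d
    slack d refl e le = ≤-by _ _ le (lemma (edges G) (heavy G) d b a e)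
      where
      lemma : ∀ e h d b a k → e + (h + d) + (k + d * b) + (a + h * b) ≡ (h + d) * b + a + d + (e + h + k)
      lemma = solve-∀

    base : edges G + heavy G ≤ a + heavy G * b
    base = ≡-≤-trans (sym lhs) (≤-trans (∑-mono pointwise) (≤-reflexive rhs))

  -- The extremal family of the theorem, up to the order of the A-vertices.
  record Core (t : ℕ) : Set where
    field
      full    : ∀ {i} → 2 ≤ row G i → row G i ≡ b
      pendant : ∀ {i} → ¬ 2 ≤ row G i → row G i ≡ 1
      count   : heavy G ≡ t

  thin⇒≤ : ∀ {t} → 1 ≤ b → Thin t G → edges G + t ≤ t * b + a
  thin⇒≤ {t} 1≤b th = +-cancelʳ-≤ d _ _ (≤-trans
    (+-monoʳ-≤ (edges G + t) (≡-≤-trans (sym (*-identityʳ d)) (*-monoʳ-≤ d 1≤b)))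
    (slack {t} d (m+[n∸m]≡n th) 0 (≡-≤-trans (+-identityʳ _) base)))
    where
    d : ℕ
    d = t ∸ heavy G

  -- Without strictness all estimates are equalities: one row below its bound, or fewer than t heavy
  -- vertices, would make the total strict.
  thin⇒core : ∀ {t} → 2 ≤ b → Thin t G → ¬ Strict t G → Core t
  thin⇒core {t} 2≤b th ¬strict = record { full = full ; pendant = pendant ; count = count }
    where
    d : ℕ
    d = t ∸ heavy G
    strict-from : edges G + heavy G < a + heavy G * b → ⊥
    strict-from lt = ¬strict (+-cancelʳ-≤ d _ _ (≤-trans
      (≡-≤-trans (sym (+-suc (edges G + t) d))
        (+-monoʳ-≤ (edges G + t) (s≤s (≡-≤-trans (sym (*-identityʳ d)) (*-monoʳ-≤ d (<⇒≤ 2≤b))))))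
      (slack {t} d (m+[n∸m]≡n th) 1 (≡-≤-trans (+-comm _ 1) lt))))
    equal : ∀ i → row G i + h i ≡ 1 + h i * b
    equal i = ≤-antisym (pointwise i) (≮⇒≥ λ lt → strict-from (subst₂ _<_ lhs rhs (∑-mono-< pointwise i lt)))
    full : ∀ {i} → 2 ≤ row G i → row G i ≡ b
    full {i} hv = go (heavy? G i) (equal i)
      where
      go : (d : Dec (2 ≤ row G i)) → row G i + ⟦ does d ⟧ ≡ 1 + ⟦ does d ⟧ * b → row G i ≡ b
      go (yes _) eq = suc-injective (trans (+-comm 1 _) (trans eq (cong suc (+-identityʳ b))))
      go (no ¬h) _  = ⊥-elim (¬h hv)
    pendant : ∀ {i} → ¬ 2 ≤ row G i → row G i ≡ 1
    pendant {i} ¬hv = go (heavy? G i) (equal i)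
      where
      go : (d : Dec (2 ≤ row G i)) → row G i + ⟦ does d ⟧ ≡ 1 + ⟦ does d ⟧ * b → row G i ≡ 1
      go (yes hv) _ = ⊥-elim (¬hv hv)
      go (no _) eq  = trans (sym (+-identityʳ _)) eq
    count : heavy G ≡ t
    count = ≤-antisym th (≮⇒≥ λ lt → ¬strict (+-cancelʳ-≤ d _ _ (≤-trans (d-bound lt) (slack {t} d (m+[n∸m]≡n th) 0 (≡-≤-trans (+-identityʳ _) base)))))
      where
      d-bound : heavy G < t → suc (edges G + t) + d ≤ edges G + t + d * b
      d-bound lt = ≡-≤-trans (sym (+-suc (edges G + t) d)) (+-monoʳ-≤ (edges G + t)
        (≤-trans (≤-trans (+-monoˡ-≤ d (m<n⇒0<n∸m lt)) (≤-reflexive (lemma d))) (*-monoʳ-≤ d 2≤b)))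
        where
        lemma : ∀ d → d + d ≡ d * 2
        lemma = solve-∀

-- Extending extremal graphs

module Zigzag {a b : ℕ} (G : BipGraph a b) where
  open Graph G
  open Paths G
  open Removal G

  fresh : ∀ Bs → wt nB Bs < b → ∃ λ j → inj₂ j ∉ Bs
  fresh Bs lt with any? (λ j → ¬? (inj₂ j ∈? Bs))
  ... | yes p = p
  ... | no ¬p = ⊥-elim (<⇒≱ lt (≡-≤-trans (sym ΣV-nB) (ΣV≤wt {xs = Bs} cover)))
    where
    cover : ∀ y → 1 ≤ nB y → y ∈ Bs
    cover (inj₂ j) _ = decidable-stable (inj₂ j ∈? Bs) λ j∉ → ¬p (j , j∉)

  freshA : ∀ As → wt nA As < a → ∃ λ i → inj₁ i ∉ As
  freshA As lt with any? (λ i → ¬? (inj₁ i ∈? As))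
  ... | yes p = p
  ... | no ¬p = ⊥-elim (<⇒≱ lt (≡-≤-trans (sym ΣV-nA) (ΣV≤wt {xs = As} cover)))
    where
    cover : ∀ y → 1 ≤ nA y → y ∈ As
    cover (inj₁ i) _ = decidable-stable (inj₁ i ∈? As) λ i∉ → ¬p (i , i∉)

  distinct-resp : ∀ {xs ys} → (∀ f → wt f xs ≡ wt f ys) → Distinct xs → Distinct ys
  distinct-resp eq d = distinct λ v → ≡-≤-trans (sym (eq _)) (once d v)

  ∉-∷ : ∀ {v x xs} → x ≢ v → v ∉ xs → v ∉ x ∷ xs
  ∉-∷ x≢v v∉ v∈ with ∈-∷⁻ v∈
  ... | inj₁ x≡v = x≢v x≡v
  ... | inj₂ v∈′ = v∉ v∈′

  -- An alternating path through all of fs that ends at y. Its B-vertices other than y form Ys and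
  -- avoid the reserved list Bs.
  record Zig (fs Bs : List V) (y : V) : Set where
    field
      {start}  : V
      {Z Ys}   : List V
      wZ       : Walk start Z y
      start∈B  : nB start ≡ 1
      weights  : ∀ f → wt f Z ≡ wt f fs + wt f Ys + f y
      dYs      : Distinct (Ys ++ Bs)
      Ys⊆B     : wt nA Ys ≡ 0
      sizeYs   : size Ys ≡ size fs

  -- Greedy choice: each f takes a B-vertex outside Bs, and |fs| of them are left. Ex collects the
  -- B-vertices not known to be joined to fs, so it must be reserved too.
  zig : ∀ Ex fs Bs y → (∀ {f z} → f ∈ fs → nB z ≡ 1 → z ∉ Ex → E f z) → (∀ {z} → z ∈ Ex → z ∈ Bs) →
    nB y ≡ 1 → y ∉ Ex → Distinct Bs → wt nB Bs + size fs ≤ b → Zig fs Bs y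
  zig Ex [] Bs y complete Ex⊆ y∈B y∉ dBs le = record
    { wZ = ⟨ y ⟩ ; start∈B = y∈B ; weights = λ f → +-identityʳ (f y) ; Ys = [] ; dYs = dBs ; Ys⊆B = refl ; sizeYs = refl }
  zig Ex (f ∷ fs) Bs y complete Ex⊆ y∈B y∉ dBs le
    with fresh Bs (≤-trans (≤-trans (s≤s (m≤m+n _ (size fs))) (≤-reflexive (sym (+-suc _ (size fs))))) le)
  ... | j , j∉ = record
    { wZ = wZ ⋈⟨ E-sym (complete ∈-here refl (j∉ ∘ Ex⊆)) ⟩ complete ∈-here y∈B y∉ ∷ ⟨ y ⟩
    ; start∈B = start∈B
    ; weights = λ g → trans (wt-++ g Z (f ∷ y ∷ [])) (trans (cong (_+ (g f + (g y + 0))) (weights g))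
        (trans (lemma (wt g fs) (wt g Ys) (g (inj₂ j)) (g f) (g y)) (cong (λ k → g f + wt g fs + k + g y) (sym (wt-++ g Ys (inj₂ j ∷ []))))))
    ; dYs = distinct-≡ (sym (++-assoc Ys (inj₂ j ∷ []) Bs)) dYs
    ; Ys⊆B = trans (wt-++ nA Ys (inj₂ j ∷ [])) (trans (+-identityʳ _) Ys⊆B)
    ; sizeYs = trans (wt-++ _ Ys (inj₂ j ∷ [])) (trans (+-comm _ 1) (cong suc sizeYs)) }
    where
    open Zig (zig Ex fs (inj₂ j ∷ Bs) (inj₂ j) (complete ∘ ∈-there) (∈-there ∘ Ex⊆) refl (j∉ ∘ Ex⊆)
      (distinct-∷ j∉ dBs) (≡-≤-trans (sym (+-suc _ (size fs))) le))
    lemma : ∀ F Y j f y → F + Y + j + (f + (y + 0)) ≡ f + F + (Y + (j + 0)) + y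
    lemma = solve-∀

  δ≤nA : ∀ i x → δ x (inj₁ i) ≤ nA x
  δ≤nA i (inj₁ _) = ⟦⟧≤1 _
  δ≤nA i (inj₂ _) = z≤n

  δ≤nB : ∀ j x → δ x (inj₂ j) ≤ nB x
  δ≤nB j (inj₁ _) = z≤n
  δ≤nB j (inj₂ _) = ⟦⟧≤1 _

  two-sided : ∀ {xs ys} → Distinct xs → wt nB xs ≡ 0 → Distinct ys → wt nA ys ≡ 0 → ∀ v → occ v xs + occ v ys ≤ 1
  two-sided {xs} {ys} dx x∈A dy y∈B (inj₁ i) = ≤-trans
    (+-monoʳ-≤ (occ (inj₁ i) xs) (≤-trans (wt-mono (δ≤nA i) ys) (≤-reflexive y∈B)))
    (≡-≤-trans (+-identityʳ _) (once dx _))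
  two-sided {xs} {ys} dx x∈A dy y∈B (inj₂ j) =
    ≤-trans (+-monoˡ-≤ (occ (inj₂ j) ys) (≤-trans (wt-mono (δ≤nB j) xs) (≤-reflexive x∈A))) (once dy _)

  module _ {N} (bd : Bounded G N) (Ex : List V) where

    -- The zigzag through fs is prolonged from y by the tail T. As and Bs are the A- and B-vertices
    -- set aside for y and T, and U is the part of them left over. Repetition is excluded on each
    -- side separately.
    zig-path : ∀ fs As Bs {y s T e} U → (∀ {f z} → f ∈ fs → nB z ≡ 1 → z ∉ Ex → E f z) → (∀ {z} → z ∈ Ex → z ∈ Bs) →
      nB y ≡ 1 → y ∉ Ex → wt nB Bs + size fs ≤ b → Distinct (fs ++ As) → wt nB (fs ++ As) ≡ 0 → Distinct Bs → wt nA Bs ≡ 0 →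
      E y s → Walk s T e → (∀ f → wt f (y ∷ T) + wt f U ≡ wt f As + wt f Bs) → size fs + size fs + size (y ∷ T) ≤ N
    zig-path fs As Bs {y} {s} {T} U complete Ex⊆ y∈B y∉ le dA A∈A dB B∈B y~s wT eq =
      ≡-≤-trans sizes (bd (wZ ⋈⟨ y~s ⟩ wT) (distinct λ v → ≤-trans (≤-trans (m≤m+n _ (occ v U)) (≤-reflexive (total v)))
        (two-sided dA A∈A dYs (trans (wt-++ nA Ys Bs) (cong₂ _+_ Ys⊆B B∈B)) v)))
      where
      open Zig (zig Ex fs Bs y complete Ex⊆ y∈B y∉ dB le)
      lemma₁ : ∀ F Y y T U → F + Y + y + T + U ≡ F + Y + (y + T + U)
      lemma₁ = solve-∀
      lemma₂ : ∀ F Y A B → F + Y + (A + B) ≡ F + A + (Y + B)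
      lemma₂ = solve-∀
      total : ∀ v → occ v (Z ++ T) + occ v U ≡ occ v (fs ++ As) + occ v (Ys ++ Bs)
      total v = trans (cong (_+ occ v U) (trans (wt-++ _ Z T) (cong (_+ occ v T) (weights _))))
        (trans (lemma₁ (occ v fs) (occ v Ys) (δ y v) (occ v T) (occ v U)) (trans (cong (occ v fs + occ v Ys +_) (eq _))
        (trans (lemma₂ (occ v fs) (occ v Ys) (occ v As) (occ v Bs)) (sym (cong₂ _+_ (wt-++ _ fs As) (wt-++ _ Ys Bs))))))
      sizes : size fs + size fs + (1 + size T) ≡ size (Z ++ T)
      sizes = sym (trans (wt-++ _ Z T) (trans (cong (_+ size T) (trans (weights _) (cong (λ k → size fs + k + 1) sizeYs))) (+-assoc (size fs + size fs) 1 (size T))))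

  distinct₂ : ∀ {x y} → x ≢ y → Distinct (x ∷ y ∷ [])
  distinct₂ x≢y = distinct-∷ (∉-∷ (x≢y ∘ sym) ∉[]) (distinct-one _)

  private
    -- A final stretch of 4 vertices together with a zigzag through t hub vertices, or of 6 with t -
    -- 1 of them, makes 2t + 4 vertices. In `too-big′` the variable stands for t - 1.
    too-big : ∀ t → ¬ t + t + 4 ≤ 3 + (t + t)
    too-big t le = <⇒≱ (≤-reflexive (+-comm 4 (t + t))) le

    too-big′ : ∀ t → ¬ t + t + 6 ≤ 3 + (suc t + suc t)
    too-big′ t le = <⇒≱ (≤-reflexive (lemma t)) le
      where
      lemma : ∀ t → 4 + (suc t + suc t) ≡ t + t + 6
      lemma = solve-∀

  -- The t full vertices of an extremal subgraph, seen inside the larger graph. Ex holds the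
  -- B-vertices outside that subgraph, to which they may or may not be joined.
  record Hub (Ex fs : List V) : Set where
    field
      complete : ∀ {f z} → f ∈ fs → nB z ≡ 1 → z ∉ Ex → E f z
      fs⊆A     : wt nB fs ≡ 0
      dEx      : Distinct Ex
      Ex⊆B     : wt nA Ex ≡ 0
      short    : Bounded G (3 + (size fs + size fs))

  -- Brings a given hub vertex to the front, where `pendant-inside` expects it.
  hub-∷ : ∀ {Ex F₁ x F₂} → Hub Ex (F₁ ++ x ∷ F₂) → Hub Ex (x ∷ F₁ ++ F₂)
  hub-∷ {Ex} {F₁} {x} {F₂} H = record
    { complete = λ f∈ → complete (∈-resp (sym ∘ eq) f∈) ; fs⊆A = trans (sym (eq nB)) fs⊆A ; dEx = dEx ; Ex⊆B = Ex⊆B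
    ; short = subst (λ s → Bounded G (3 + (s + s))) (eq (λ _ → 1)) short }
    where
    open Hub H
    eq : ∀ f → wt f (F₁ ++ x ∷ F₂) ≡ wt f (x ∷ F₁ ++ F₂)
    eq f = trans (wt-++ f F₁ (x ∷ F₂)) (trans (x∙yz≈y∙xz (wt f F₁) (f x) (wt f F₂)) (cong (f x +_) (sym (wt-++ f F₁ F₂))))

  module _ {Ex fs w u} (H : Hub Ex fs) (dA : Distinct (fs ++ inj₁ w ∷ inj₁ u ∷ [])) (le : 2 + wt nB Ex + size fs ≤ b) where
    open Hub H

    meeting : ∀ {y y′} → E (inj₁ w) (inj₂ y) → E (inj₁ u) (inj₂ y) → E (inj₁ u) (inj₂ y′) → y ≢ y′ → inj₂ y ∉ Ex → inj₂ y′ ∉ Ex → ⊥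
    meeting {y} {y′} w~y u~y u~y′ y≢y′ y∉ y′∉ =
      too-big (size fs) (zig-path short Ex fs (inj₁ w ∷ inj₁ u ∷ []) (inj₂ y′ ∷ inj₂ y ∷ Ex) Ex complete (∈-there ∘ ∈-there)
        refl y′∉ le dA (trans (wt-++ nB fs _) (trans (+-identityʳ _) fs⊆A)) (distinct-∷ (∉-∷ (y≢y′ ∘ inj₂-injective) y′∉) (distinct-∷ y∉ dEx)) Ex⊆B
        (E-sym u~y′) (u~y ∷ E-sym w~y ∷ ⟨ inj₁ w ⟩)
        (λ f → lemma (f (inj₂ y′)) (f (inj₁ u)) (f (inj₂ y)) (f (inj₁ w)) (wt f Ex)))
      where
      lemma : ∀ y′ u y w ex → y′ + (u + (y + (w + 0))) + ex ≡ (w + (u + 0)) + (y′ + (y + ex))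
      lemma = solve-∀

  -- Otherwise w yw f₁ y u y′ … (or w y u y′ … if u and w share y) continues
  -- through all of fs to a path on 2t+4 vertices, t = size fs.
  second-neighbour : ∀ {Ex fs w u} → Hub Ex fs → Distinct (fs ++ inj₁ w ∷ inj₁ u ∷ []) → 2 + wt nB Ex + size fs ≤ b → 1 ≤ size fs →
    ∀ {yw y y′} → E (inj₁ w) (inj₂ yw) → E (inj₁ u) (inj₂ y) → E (inj₁ u) (inj₂ y′) → y ≢ y′ →
    inj₂ yw ∉ Ex → inj₂ y ∉ Ex → inj₂ y′ ∉ Ex → ⊥
  second-neighbour {Ex} {f₁ ∷ fs} {w} {u} H dA le _ {yw} {y} {y′} w~yw u~y u~y′ y≢y′ yw∉ y∉ y′∉ with yw Fin.≟ y | yw Fin.≟ y′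
  ... | yes refl | _ = meeting H dA le w~yw u~y u~y′ y≢y′ yw∉ y′∉
  ... | no _ | yes refl = meeting H dA le w~yw u~y′ u~y (y≢y′ ∘ sym) yw∉ y∉
  ... | no yw≢y | no yw≢y′ =
    too-big′ (size fs) (zig-path short Ex fs (f₁ ∷ inj₁ w ∷ inj₁ u ∷ []) (inj₂ y′ ∷ inj₂ y ∷ inj₂ yw ∷ Ex) Ex (complete ∘ ∈-there) (∈-there ∘ ∈-there ∘ ∈-there)
      refl y′∉ (≡-≤-trans (lemma₀ (wt nB Ex) (size fs)) le) (distinct-resp rot dA)
      (trans (sym (rot nB)) (trans (wt-++ nB (f₁ ∷ fs) _) (trans (+-identityʳ _) fs⊆A)))
      (distinct-∷ (∉-∷ (y≢y′ ∘ inj₂-injective) (∉-∷ (yw≢y′ ∘ inj₂-injective) y′∉)) (distinct-∷ (∉-∷ (yw≢y ∘ inj₂-injective) y∉) (distinct-∷ yw∉ dEx))) Ex⊆B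
      (E-sym u~y′) (u~y ∷ E-sym (complete ∈-here refl y∉) ∷ complete ∈-here refl yw∉ ∷ E-sym w~yw ∷ ⟨ inj₁ w ⟩)
      (λ f → lemma (f (inj₂ y′)) (f (inj₁ u)) (f (inj₂ y)) (f (inj₁ w)) (f f₁) (f (inj₂ yw)) (wt f Ex)))
    where
    open Hub H
    lemma₀ : ∀ e s → 3 + e + s ≡ 2 + e + suc s
    lemma₀ = solve-∀
    lemma : ∀ y′ u y w g yw ex → y′ + (u + (y + (g + (yw + (w + 0))))) + ex ≡ (g + (w + (u + 0))) + (y′ + (y + (yw + ex)))
    lemma = solve-∀
    rot : ∀ f → wt f (f₁ ∷ fs ++ inj₁ w ∷ inj₁ u ∷ []) ≡ wt f (fs ++ f₁ ∷ inj₁ w ∷ inj₁ u ∷ [])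
    rot f = trans (cong (f f₁ +_) (wt-++ f fs _)) (trans (x∙yz≈y∙xz (f f₁) (wt f fs) _) (sym (wt-++ f fs _)))

  -- Here the paths on 2t+4 vertices are … y w v x (x ∉ fs), … y w v x y₂ w₂ and,
  -- if the pendant vertices w and w₂ share y, … k x v w y w₂ with k new.
  module _ {v : Fin b} where
    private
      Ex : List V
      Ex = inj₂ v ∷ []

    pendant-outside : ∀ {fs w x y} → Hub Ex fs → Distinct (fs ++ inj₁ w ∷ inj₁ x ∷ []) → 2 + size fs ≤ b →
      E (inj₁ w) (inj₂ v) → E (inj₁ x) (inj₂ v) → E (inj₁ w) (inj₂ y) → inj₂ y ∉ Ex → ⊥
    pendant-outside {fs} {w} {x} {y} H dA le w~v x~v w~y y∉ =
      too-big (size fs) (zig-path short Ex fs (inj₁ w ∷ inj₁ x ∷ []) (inj₂ y ∷ Ex) [] complete ∈-there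
        refl y∉ le dA (trans (wt-++ nB fs _) (trans (+-identityʳ _) fs⊆A)) (distinct-∷ y∉ dEx) refl
        (E-sym w~y) (w~v ∷ E-sym x~v ∷ ⟨ inj₁ x ⟩)
        (λ f → lemma (f (inj₂ y)) (f (inj₁ w)) (f (inj₂ v)) (f (inj₁ x))))
      where
      open Hub H
      lemma : ∀ y w v x → y + (w + (v + (x + 0))) + 0 ≡ (w + (x + 0)) + (y + (v + 0))
      lemma = solve-∀

    pendant-inside : ∀ {fs w w₂ x y y₂} → Hub Ex (x ∷ fs) → Distinct (x ∷ fs ++ inj₁ w ∷ inj₁ w₂ ∷ []) → 3 + size fs ≤ b →
      E (inj₁ w) (inj₂ v) → E x (inj₂ v) → E (inj₁ w) (inj₂ y) → inj₂ y ∉ Ex → E (inj₁ w₂) (inj₂ y₂) → inj₂ y₂ ∉ Ex → ⊥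
    pendant-inside {fs} {w} {w₂} {x} {y} {y₂} H dA le w~v x~v w~y y∉ w₂~y₂ y₂∉ with y Fin.≟ y₂
    ... | no y≢y₂ = too-big′ (size fs) (zig-path short Ex fs (inj₁ w ∷ x ∷ inj₁ w₂ ∷ []) (inj₂ y ∷ inj₂ y₂ ∷ Ex) [] (complete ∘ ∈-there) (∈-there ∘ ∈-there)
        refl y∉ le (distinct-resp rot dA) (trans (sym (rot nB)) (trans (wt-++ nB (x ∷ fs) _) (trans (+-identityʳ _) fs⊆A)))
        (distinct-∷ (∉-∷ (y≢y₂ ∘ sym ∘ inj₂-injective) y∉) (distinct-∷ y₂∉ dEx)) refl
        (E-sym w~y) (w~v ∷ E-sym x~v ∷ complete ∈-here refl y₂∉ ∷ E-sym w₂~y₂ ∷ ⟨ inj₁ w₂ ⟩)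
        (λ f → lemma (f (inj₂ y)) (f (inj₁ w)) (f (inj₂ v)) (f x) (f (inj₂ y₂)) (f (inj₁ w₂))))
      where
      open Hub H
      lemma : ∀ y w v x y₂ w₂ → y + (w + (v + (x + (y₂ + (w₂ + 0))))) + 0 ≡ (w + (x + (w₂ + 0))) + (y + (y₂ + (v + 0)))
      lemma = solve-∀
      rot : ∀ f → wt f (x ∷ fs ++ inj₁ w ∷ inj₁ w₂ ∷ []) ≡ wt f (fs ++ inj₁ w ∷ x ∷ inj₁ w₂ ∷ [])
      rot f = trans (cong (f x +_) (wt-++ f fs _)) (trans (swap₁ (f x) (wt f fs) (f (inj₁ w)) (f (inj₁ w₂))) (sym (wt-++ f fs _)))
        where
        swap₁ : ∀ p q r s → p + (q + (r + (s + 0))) ≡ q + (r + (p + (s + 0)))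
        swap₁ = solve-∀
    ... | yes refl with fresh (inj₂ y ∷ Ex) (≤-trans (s≤s (s≤s (s≤s z≤n))) le)
    ...   | k , k∉ = too-big′ (size fs) (zig-path short Ex fs (x ∷ inj₁ w ∷ inj₁ w₂ ∷ []) (inj₂ k ∷ inj₂ y ∷ Ex) [] (complete ∘ ∈-there) (∈-there ∘ ∈-there)
        refl (k∉ ∘ ∈-there) le (distinct-resp rot dA) (trans (sym (rot nB)) (trans (wt-++ nB (x ∷ fs) _) (trans (+-identityʳ _) fs⊆A)))
        (distinct-∷ k∉ (distinct-∷ y∉ dEx)) refl
        (E-sym (complete ∈-here refl (k∉ ∘ ∈-there))) (x~v ∷ E-sym w~v ∷ w~y ∷ E-sym w₂~y₂ ∷ ⟨ inj₁ w₂ ⟩)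
        (λ f → lemma (f (inj₂ k)) (f (inj₁ w)) (f (inj₂ v)) (f x) (f (inj₂ y)) (f (inj₁ w₂))))
      where
      open Hub H
      lemma : ∀ k w v x y w₂ → k + (x + (v + (w + (y + (w₂ + 0))))) + 0 ≡ (x + (w + (w₂ + 0))) + (k + (y + (v + 0)))
      lemma = solve-∀
      rot : ∀ f → wt f (x ∷ fs ++ inj₁ w ∷ inj₁ w₂ ∷ []) ≡ wt f (fs ++ x ∷ inj₁ w ∷ inj₁ w₂ ∷ [])
      rot f = trans (cong (f x +_) (wt-++ f fs _)) (trans (x∙yz≈y∙xz (f x) (wt f fs) _) (sym (wt-++ f fs _)))

full-row : ∀ {a b} (G : BipGraph a b) i → row G i ≡ b → ∀ j → G i j ≡ true
full-row {b = b} G i eq j with G i j in q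
... | true  = refl
... | false = ⊥-elim (<-irrefl eq (subst (row G i <_) (∑-one b)
  (∑-mono-< {g = λ _ → 1} (λ j → ⟦⟧≤1 (G i j)) j (s≤s (≤-reflexive (cong ⟦_⟧ q))))))

neighbour : ∀ {a b} (G : BipGraph a b) i → 1 ≤ row G i → ∃ λ j → G i j ≡ true
neighbour {b = b} G i le with any? (λ j → G i j Data.Bool.≟ true)
... | yes p = p
... | no ¬p = ⊥-elim (<⇒≱ le (≤-trans (∑-mono {g = λ _ → 0} zeros) (≤-reflexive (∑-zero b))))
  where
  zeros : ∀ j → ⟦ G i j ⟧ ≤ 0
  zeros j with G i j in q
  ... | true  = ⊥-elim (¬p (j , q))
  ... | false = z≤n

second : ∀ {a b} (G : BipGraph a b) i → 2 ≤ row G i → ∀ j → ∃ λ j′ → j ≢ j′ × G i j′ ≡ true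
second {b = suc b} G i le j with neighbour (delB j G) i (≤-pred (≤-trans le (≡-≤-trans (row-delB j G i) (+-monoˡ-≤ _ (⟦⟧≤1 (G i j))))))
... | k , p = punchIn j k , (λ eq → punchInᵢ≢i j k (sym eq)) , p

module Select {a b : ℕ} (G : BipGraph a b) where
  open Graph G

  selectFrom : ∀ {n} → (Fin n → Bool) → (Fin n → V) → List V
  selectFrom {zero}  p g = []
  selectFrom {suc n} p g with p zero
  ... | true  = g zero ∷ selectFrom (p ∘ suc) (g ∘ suc)
  ... | false = selectFrom (p ∘ suc) (g ∘ suc)

  wt-selectFrom : ∀ {n} f (p : Fin n → Bool) g → wt f (selectFrom p g) ≡ ∑ λ i → ⟦ p i ⟧ * f (g i)
  wt-selectFrom {zero}  f p g = refl
  wt-selectFrom {suc n} f p g with p zero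
  ... | true  = cong₂ _+_ (sym (+-identityʳ _)) (wt-selectFrom f (p ∘ suc) (g ∘ suc))
  ... | false = wt-selectFrom f (p ∘ suc) (g ∘ suc)

  select : (Fin a → Bool) → List V
  select p = selectFrom p inj₁

  occ-select₁ : ∀ i p → occ (inj₁ i) (select p) ≡ ⟦ p i ⟧
  occ-select₁ i p = trans (wt-selectFrom _ p inj₁) (trans (sum-cong-≗ λ k → trans (*-comm ⟦ p k ⟧ _) (cong (_* ⟦ p k ⟧) (δ-sym k)))
    (∑-pick i (λ k → ⟦ p k ⟧)))
    where
    δ-sym : ∀ k → ⟦ does (k Fin.≟ i) ⟧ ≡ ⟦ does (i Fin.≟ k) ⟧
    δ-sym k with k Fin.≟ i | i Fin.≟ k
    ... | yes _ | yes _ = refl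
    ... | no _  | no _  = refl
    ... | yes p | no ¬p = ⊥-elim (¬p (sym p))
    ... | no ¬p | yes p = ⊥-elim (¬p (sym p))

  occ-select₂ : ∀ j p → occ (inj₂ j) (select p) ≡ 0
  occ-select₂ j p = trans (wt-selectFrom _ p inj₁) (trans (sum-cong-≗ λ k → *-zeroʳ ⟦ p k ⟧) (∑-zero a))

  select-distinct : ∀ p → Distinct (select p)
  select-distinct p = distinct λ
    { (inj₁ i) → ≡-≤-trans (occ-select₁ i p) (⟦⟧≤1 (p i))
    ; (inj₂ j) → ≡-≤-trans (occ-select₂ j p) z≤n }

⟦does⟧-yes : ∀ {A : Set} (d : Dec A) → A → ⟦ does d ⟧ ≡ 1
⟦does⟧-yes (yes _) _ = refl
⟦does⟧-yes (no ¬x) x = ⊥-elim (¬x x)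

⟦does⟧-no : ∀ {A : Set} (d : Dec A) → ¬ A → ⟦ does d ⟧ ≡ 0
⟦does⟧-no (yes x) ¬x = ⊥-elim (¬x x)
⟦does⟧-no (no _)  _  = refl

⟦does⟧-mono : ∀ {A B : Set} (d : Dec A) (e : Dec B) → (A → B) → ⟦ does d ⟧ ≤ ⟦ does e ⟧
⟦does⟧-mono (yes x) e f = ≤-reflexive (sym (⟦does⟧-yes e (f x)))
⟦does⟧-mono (no _)  e f = z≤n

⟦does⟧⁻ : ∀ {A : Set} (d : Dec A) → 1 ≤ ⟦ does d ⟧ → A
⟦does⟧⁻ (yes x) _ = x

other-light : ∀ {a b} (G : BipGraph a b) → heavy G + 2 ≤ a → ∀ i → ∃ λ k → i ≢ k × ¬ 2 ≤ row G k
other-light {a} G le i with any? (λ k → ¬? (i Fin.≟ k) ×-dec ¬? (heavy? G k))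
... | yes p = p
... | no ¬p = ⊥-elim (<⇒≱ (≡-≤-trans (+-comm 2 (heavy G)) le) (begin
  a                                                              ≡⟨ ∑-one a ⟨
  ∑ {a} (λ _ → 1)                                                ≤⟨ ∑-mono cover ⟩
  ∑ (λ k → ⟦ does (i Fin.≟ k) ⟧ * 1 + ⟦ does (heavy? G k) ⟧)     ≡⟨ ∑-distrib-+ (λ k → ⟦ does (i Fin.≟ k) ⟧ * 1) _ ⟩
  ∑ (λ k → ⟦ does (i Fin.≟ k) ⟧ * 1) + heavy G                   ≡⟨ cong (_+ heavy G) (∑-pick i (λ _ → 1)) ⟩
  1 + heavy G                                                    ∎))
  where
  open ≤-Reasoning
  cover : ∀ k → 1 ≤ ⟦ does (i Fin.≟ k) ⟧ * 1 + ⟦ does (heavy? G k) ⟧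
  cover k with i Fin.≟ k
  ... | yes _  = s≤s z≤n
  ... | no i≢k = ≤-reflexive (sym (⟦does⟧-yes (heavy? G k) (decidable-stable (heavy? G k) λ ¬h → ¬p (k , i≢k , ¬h))))

-- H is an induced subgraph attaining the bound, given by maps of its two classes; Ex lists the
-- B-vertices outside it. With identity maps the module also treats G itself.
module Tight {a b a′ b′ : ℕ} (G : BipGraph a b) (ιA : Fin a′ → Fin a) (ιB : Fin b′ → Fin b)
  (ιA-inj : ∀ {x y} → ιA x ≡ ιA y → x ≡ y) (ιB-inj : ∀ {x y} → ιB x ≡ ιB y → x ≡ y) where
  open Induced G ιA ιB ιA-inj ιB-inj
  open Graph G
  open Paths G
  open Removal G
  open Zigzag G
  private
    module H = Graph H
    open Select H

  module _ {t : ℕ} (core : Core H t) (bd : Bounded G (3 + (t + t))) (Ex : List V)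
    (onto : ∀ {z} → nB z ≡ 1 → z ∉ Ex → ∃ λ j → inj₂ (ιB j) ≡ z) (dEx : Distinct Ex) (Ex⊆B : wt nA Ex ≡ 0) where
    open Core core

    hs : List (Vertex a′ b′)
    hs = select λ i → does (heavy? H i)

    fs : List V
    fs = List.map ι hs

    size-fs : size fs ≡ t
    size-fs = trans (wt-map (λ _ → 1) hs) (trans (wt-selectFrom _ _ inj₁) (trans (sum-cong-≗ λ i → *-identityʳ ⟦ does (heavy? H i) ⟧) count))

    ∈hs⇒heavy : ∀ {x} → x H.∈ hs → ∃ λ i → x ≡ inj₁ i × 2 ≤ row H i
    ∈hs⇒heavy {inj₁ i} (Graph.occurs le) = i , refl , ⟦does⟧⁻ (heavy? H i) (≤-trans le (≤-reflexive (occ-select₁ i _)))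
    ∈hs⇒heavy {inj₂ j} (Graph.occurs le) = ⊥-elim (<⇒≱ le (≤-reflexive (occ-select₂ j _)))

    light∉fs : ∀ {i} → ¬ 2 ≤ row H i → inj₁ (ιA i) ∉ fs
    light∉fs ¬h w∈ with ∈-map⁻ hs w∈
    ... | x , x∈ , eq with ∈hs⇒heavy x∈
    ...   | k , refl , h with ιA-inj (inj₁-injective eq)
    ...     | refl = ¬h h

    distinct-fs : Distinct fs
    distinct-fs = map-distinct (select-distinct _)

    complete : ∀ {f z} → f ∈ fs → nB z ≡ 1 → z ∉ Ex → E f z
    complete f∈ z∈B z∉ with ∈-map⁻ hs f∈ | onto z∈B z∉
    ... | x , x∈ , refl | j , refl with ∈hs⇒heavy x∈
    ...   | i , refl , h = edge (full-row H i (full h) j)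

    hub : Hub Ex fs
    hub = record { complete = complete ; dEx = dEx ; Ex⊆B = Ex⊆B
      ; fs⊆A = trans (wt-map nB hs) (trans (wt-selectFrom (nB ∘ ι) _ inj₁) (trans (sum-cong-≗ λ i → *-zeroʳ ⟦ does (heavy? H i) ⟧) (∑-zero a′)))
      ; short = subst (λ s → Bounded G (3 + (s + s))) (sym size-fs) bd }

    distinct-fs₂ : ∀ {x y} → x ∉ fs → y ∉ fs → x ≢ y → Distinct (fs ++ x ∷ y ∷ [])
    distinct-fs₂ {x} {y} x∉ y∉ x≢y = distinct λ v → ≡-≤-trans (wt-++ _ fs (x ∷ y ∷ []))
      (disjoint-from distinct-fs (distinct₂ x≢y) (λ z∈ → case ∈-∷⁻ z∈ of λ
        { (inj₁ refl) → x∉ ; (inj₂ z∈′) → case ∈-∷⁻ z∈′ of λ { (inj₁ refl) → y∉ ; (inj₂ z∈[]) → ⊥-elim (∉[] z∈[]) } }) v)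

    light-neighbour : ∀ {i} → ¬ 2 ≤ row H i → ∃ λ j → E (inj₁ (ιA i)) (inj₂ (ιB j))
    light-neighbour {i} ¬h with neighbour H i (≤-reflexive (sym (pendant ¬h)))
    ... | j , e = j , edge e

    module _ (ιB∉Ex : ∀ j → inj₂ (ιB j) ∉ Ex) (t+2≤a′ : t + 2 ≤ a′) where

      private
        light : ∀ i → ∃ λ k → i ≢ k × ¬ 2 ≤ row H k
        light = other-light H (≡-≤-trans (cong (_+ 2) count) t+2≤a′)

        anyLight : ∃ λ k → ¬ 2 ≤ row H k
        anyLight = from {a′} light (≤-trans (m≤n+m 1 (suc t)) (≡-≤-trans (lemma t) t+2≤a′))
          where
          from : ∀ {n} {A : Fin n → Set} → ((i : Fin n) → ∃ λ k → i ≢ k × A k) → 1 ≤ n → ∃ A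
          from {suc n} f _ = proj₁ (f zero) , proj₂ (proj₂ (f zero))
          lemma : ∀ t → suc t + 1 ≡ t + 2
          lemma = solve-∀

      -- Any light vertex of H serves as the pendant vertex w in `second-neighbour`.
      new-A-light : ∀ {u} → (∀ i → ιA i ≢ u) → 1 ≤ t → 2 + wt nB Ex + t ≤ b → ∀ {y y′} → G u y ≡ true → G u y′ ≡ true → y ≢ y′ →
        inj₂ y ∉ Ex → inj₂ y′ ∉ Ex → ⊥
      new-A-light {u} new 1≤t le {y} {y′} u~y u~y′ y≢y′ y∉ y′∉ with anyLight
      ... | k , ¬h with light-neighbour ¬h
      ...   | j , e = second-neighbour hub (distinct-fs₂ (light∉fs ¬h) u∉fs (new k ∘ inj₁-injective))
        (≡-≤-trans (cong (2 + wt nB Ex +_) size-fs) le) (≤-trans 1≤t (≤-reflexive (sym size-fs)))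
        e (edge u~y) (edge u~y′) y≢y′ (ιB∉Ex j) y∉ y′∉
        where
        u∉fs : inj₁ u ∉ fs
        u∉fs u∈ with ∈-map⁻ hs u∈
        ... | inj₁ i , _ , eq = new i (inj₁-injective eq)

      module _ {v : Fin b} (Ex≡ : Ex ≡ inj₂ v ∷ []) (le : 3 + t ≤ b) where

        -- If v were joined to a pendant vertex w, a second neighbour x of v would be outside or
        -- inside the hub; the two pendant lemmas give a path on 2t + 4 vertices in either case. The
        -- inside case uses another light vertex.
        new-B-avoids-light : 2 ≤ row (flip G) v → ∀ {i} → ¬ 2 ≤ row H i → G (ιA i) v ≡ false
        new-B-avoids-light 2≤v {i} ¬h with G (ιA i) v in w~v
        ... | false = refl
        ... | true with second (flip G) v 2≤v (ιA i) | light-neighbour ¬h | light i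
        ...   | x , w≢x , x~v | y , w~y | k , i≢k , ¬h₂ with light-neighbour ¬h₂ | inj₁ x ∈? fs
        ...     | y₂ , w₂~y₂ | no x∉ = ⊥-elim (pendant-outside hub′ (distinct-fs₂ (light∉fs ¬h) x∉ (w≢x ∘ inj₁-injective))
          (≡-≤-trans (cong (2 +_) size-fs) (≤-trans (n≤1+n _) le)) (edge w~v) (edge x~v) w~y (subst (_ ∉_) Ex≡ (ιB∉Ex y)))
          where
          hub′ : Hub (inj₂ v ∷ []) fs
          hub′ = subst (λ Ex → Hub Ex fs) Ex≡ hub
        ...     | y₂ , w₂~y₂ | yes x∈ = ⊥-elim (body (find x∈) refl)
          where
          body : ∀ {gs} → At (inj₁ x) gs → gs ≡ fs → ⊥
          body (at X Y) eq = pendant-inside (hub-∷ {F₁ = X} (subst₂ Hub Ex≡ (sym eq) hub))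
            (distinct-resp rot (distinct-≡ (cong (_++ _) (sym eq)) (distinct-fs₂ (light∉fs ¬h) (light∉fs ¬h₂) (i≢k ∘ ιA-inj ∘ inj₁-injective))))
            (≡-≤-trans (cong (2 +_) (trans (sym (mid (λ _ → 1))) (trans (cong size eq) size-fs))) (≤-trans (n≤1+n _) le))
            (edge w~v) (edge x~v) w~y (subst (_ ∉_) Ex≡ (ιB∉Ex y)) w₂~y₂ (subst (_ ∉_) Ex≡ (ιB∉Ex y₂))
            where
            mid : ∀ f → wt f (X ++ inj₁ x ∷ Y) ≡ wt f (inj₁ x ∷ X ++ Y)
            mid f = trans (wt-++ f X _) (trans (x∙yz≈y∙xz (wt f X) (f (inj₁ x)) (wt f Y)) (cong (f (inj₁ x) +_) (sym (wt-++ f X Y))))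
            rot : ∀ f → wt f ((X ++ inj₁ x ∷ Y) ++ inj₁ (ιA i) ∷ inj₁ (ιA k) ∷ []) ≡ wt f (inj₁ x ∷ (X ++ Y) ++ inj₁ (ιA i) ∷ inj₁ (ιA k) ∷ [])
            rot f = trans (wt-++ f (X ++ inj₁ x ∷ Y) _) (trans (cong (_+ _) (mid f)) (sym (wt-++ f (inj₁ x ∷ X ++ Y) _)))

onto-punchIn : ∀ {a b} (G : BipGraph a (suc b)) v → let open Graph G in
  ∀ {z} → nB z ≡ 1 → z ∉ inj₂ v ∷ [] → ∃ λ j → inj₂ (punchIn v j) ≡ z
onto-punchIn G v {inj₂ k} _ z∉ = punchOut v≢k , cong inj₂ (punchIn-punchOut v≢k)
  where
  v≢k : v ≢ k
  v≢k refl = z∉ (Graph.∈-here G)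

-- Putting back a B-vertex or a pair

module StepB {t a b : ℕ} (G : BipGraph a (suc b)) (v : Fin (suc b)) (2≤t : 2 ≤ t) (t+2≤a : t + 2 ≤ a) (a≤b : a ≤ b)
  (bd : Bounded G (3 + (t + t))) (col≤t : row (flip G) v ≤ t) (¬strict : ¬ Strict t G) where
  private
    H : BipGraph a b
    H = delB v G
    c : ℕ
    c = row (flip G) v

    2≤a : 2 ≤ a
    2≤a = ≤-trans (m≤n+m 2 t) t+2≤a

    -- Deleting v lowers t b + a by t, so G is strict as soon as the slack s of H exceeds c - t.
    -- With c ≤ t this excludes a strict H, and with s = 0 it gives c ≥ t.
    strict-G : ∀ {s} → edges H + t + s ≤ t * b + a → c + 1 ≤ t + s → ⊥
    strict-G {s} le₁ le₂ = ¬strict (subst (λ e → suc (e + t) ≤ t * suc b + a) (sym (edges-delB v G))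
      (≤-by _ _ (+-mono-≤ le₁ le₂) (lemma (edges H) t b a c s)))
      where
      lemma : ∀ e t b a c s → suc (c + e + t) + (t * b + a + (t + s)) ≡ t * suc b + a + (e + t + s + (c + 1))
      lemma = solve-∀

  not-strict : ¬ Strict t H
  not-strict lt = strict-G {1} (≡-≤-trans (+-comm _ 1) lt) (+-monoˡ-≤ 1 col≤t)

  private
    t≤c : edges H + t ≤ t * b + a → t ≤ c
    t≤c le = ≮⇒≥ λ lt → strict-G {0} (≡-≤-trans (+-identityʳ _) le) (≡-≤-trans (+-comm c 1) (≤-trans lt (≤-reflexive (sym (+-identityʳ t)))))

  -- v has at least t ≥ 2 neighbours, hence no light one by `new-B-avoids-light`, and so it makes no
  -- light vertex heavy.
  thin-step : Thin t H → Thin t G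
  thin-step th = ≤-trans (∑-mono λ i → ⟦does⟧-mono (heavy? G i) (heavy? H i) (down i)) th
    where
    open Tight G (λ i → i) (punchIn v) (λ eq → eq) (punchIn-injective v _ _)
    core : Core H t
    core = thin⇒core H (≤-trans 2≤a a≤b) th not-strict
    avoids : ∀ {i} → ¬ 2 ≤ row H i → G i v ≡ false
    avoids = new-B-avoids-light core bd (inj₂ v ∷ []) (onto-punchIn G v) (Paths.distinct-one G _) refl
      (λ j v∈ → case Graph.∈-∷⁻ G v∈ of λ
        { (inj₁ eq) → punchInᵢ≢i v j (sym (inj₂-injective eq)) ; (inj₂ v∈[]) → Graph.∉[] G v∈[] })
      t+2≤a refl (≤-trans (s≤s (≡-≤-trans (+-comm 2 t) t+2≤a)) (s≤s a≤b))
      (≤-trans 2≤t (t≤c (thin⇒≤ H (≤-trans (<⇒≤ 2≤a) a≤b) th)))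
    down : ∀ i → 2 ≤ row G i → 2 ≤ row H i
    down i h = decidable-stable (heavy? H i) λ ¬h →
      ¬h (≤-trans h (≤-reflexive (trans (row-delB v G i) (cong (λ k → ⟦ k ⟧ + row H i) (avoids ¬h)))))

  -- In `flip H` the new v takes the part of an A-vertex; its t ≥ 2 neighbours contradict
  -- `new-A-light`.
  no-flipped : a ≡ b → ¬ Thin t (flip H)
  no-flipped refl th with neighbour (flip G) v 1≤c
    where
    1≤c : 1 ≤ c
    1≤c = ≤-trans (<⇒≤ 2≤t) (t≤c (subst (λ e → e + t ≤ t * b + a) (edges-flip H) (thin⇒≤ (flip H) (<⇒≤ 2≤a) th)))
  ... | y , v~y with second (flip G) v (≤-trans 2≤t (t≤c (subst (λ e → e + t ≤ t * b + a) (edges-flip H) (thin⇒≤ (flip H) (<⇒≤ 2≤a) th)))) y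
  ...   | y′ , y≢y′ , v~y′ = new-A-light core (Flip.bounded G bd) [] (λ { {inj₂ j} _ _ → j , refl }) (Graph.distinct λ _ → z≤n) refl
    (λ _ → Graph.∉[] (flip G)) t+2≤a (λ i → punchInᵢ≢i v i) (<⇒≤ 2≤t)
    (≡-≤-trans (+-comm 2 t) t+2≤a) v~y v~y′ y≢y′ (Graph.∉[] (flip G)) (Graph.∉[] (flip G))
    where
    open Tight (flip G) (punchIn v) (λ i → i) (punchIn-injective v _ _) (λ eq → eq)
    core : Core (flip H) t
    core = thin⇒core (flip H) 2≤a th (not-strict ∘ strict-flip t H)

step-B : ∀ {t a b} (G : BipGraph a (suc b)) v → 2 ≤ t → t + 2 ≤ a → a ≤ b → Bounded G (3 + (t + t)) →
  row (flip G) v ≤ t → Result t (delB v G) → Result t G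
step-B {t} {a} {b} G v 2≤t t+2≤a a≤b bd col≤t res with edges G + t <? t * suc b + a
... | yes s = inj₁ s
... | no ¬s = case res of λ
  { (inj₁ s) → ⊥-elim (not-strict s)
  ; (inj₂ (inj₁ th)) → inj₂ (inj₁ (thin-step th))
  ; (inj₂ (inj₂ (a≡b , th))) → ⊥-elim (no-flipped a≡b th) }
  where open StepB G v 2≤t t+2≤a a≤b bd col≤t ¬s

module StepPair {t n : ℕ} (G : BipGraph (suc n) (suc n)) (u v : Fin (suc n)) (2≤t : 2 ≤ t) (t+2≤n : t + 2 ≤ n)
  (bd : Bounded G (3 + (t + t))) (u≁v : G u v ≡ false) (deg≤ : row G u + row (flip G) v ≤ suc t) (¬strict : ¬ Strict t G) where
  private
    H : BipGraph n n
    H = delB v (delA u G)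
    r c : ℕ
    r = row G u
    c = row (flip G) v

    2≤n : 2 ≤ n
    2≤n = ≤-trans (m≤n+m 2 t) t+2≤n

    -- Deleting the pair lowers the bound by t + 1, one for u and t for v.
    strict-G : ∀ {s} → edges H + t + s ≤ t * n + n → r + c + 1 ≤ suc t + s → ⊥
    strict-G {s} le₁ le₂ = ¬strict (subst (λ e → suc (e + t) ≤ t * suc n + suc n) (sym (edges-del u v G u≁v))
      (≤-by _ _ (+-mono-≤ le₁ le₂) (lemma (edges H) t n r c s)))
      where
      lemma : ∀ e t n r c s → suc (r + c + e + t) + (t * n + n + (suc t + s)) ≡ t * suc n + suc n + (e + t + s + (r + c + 1))
      lemma = solve-∀

  not-strict : ¬ Strict t H
  not-strict lt = strict-G {1} (≡-≤-trans (+-comm _ 1) lt) (+-monoˡ-≤ 1 deg≤)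

  -- u is light by `new-A-light`, as its neighbours differ from v. Since the two degrees sum to t +
  -- 1, v has degree at least t ≥ 2 and therefore no light neighbour in H.
  thin-step : Thin t H → Thin t G
  thin-step th = ≡-≤-trans (sum-remove {i = u} (λ i → ⟦ does (heavy? G i) ⟧))
    (≤-trans (+-mono-≤ (≤-reflexive (⟦does⟧-no (heavy? G u) u-light)) (∑-mono λ i → ⟦does⟧-mono (heavy? G (punchIn u i)) (heavy? H i) (down i))) th)
    where
    open Tight G (punchIn u) (punchIn v) (punchIn-injective u _ _) (punchIn-injective v _ _)
    core : Core H t
    core = thin⇒core H 2≤n th not-strict
    Ex : List (Vertex (suc n) (suc n))
    Ex = inj₂ v ∷ []
    dEx : Graph.Distinct G Ex
    dEx = Paths.distinct-one G _
    avoidsEx : ∀ j → Graph._∉_ G (inj₂ (punchIn v j)) Ex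
    avoidsEx j v∈ = case Graph.∈-∷⁻ G v∈ of λ
      { (inj₁ eq) → punchInᵢ≢i v j (sym (inj₂-injective eq)) ; (inj₂ v∈[]) → Graph.∉[] G v∈[] }
    big : 3 + t ≤ suc n
    big = s≤s (≡-≤-trans (+-comm 2 t) t+2≤n)
    not-Ex : ∀ {y} → G u y ≡ true → Graph._∉_ G (inj₂ y) Ex
    not-Ex u~y v∈ = case Graph.∈-∷⁻ G v∈ of λ
      { (inj₁ refl) → case trans (sym u~y) u≁v of λ () ; (inj₂ v∈[]) → Graph.∉[] G v∈[] }
    u-light : ¬ 2 ≤ r
    u-light h with neighbour G u (<⇒≤ h)
    ... | y , u~y with second G u h y
    ...   | y′ , y≢y′ , u~y′ = new-A-light core bd Ex (onto-punchIn G v) dEx refl avoidsEx t+2≤n (λ i → punchInᵢ≢i u i)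
      (<⇒≤ 2≤t) big u~y u~y′ y≢y′ (not-Ex u~y) (not-Ex u~y′)
    suct≤ : suc t ≤ r + c
    suct≤ = ≮⇒≥ λ lt → strict-G {0} (≡-≤-trans (+-identityʳ _) (thin⇒≤ H (<⇒≤ 2≤n) th))
      (≡-≤-trans (+-comm (r + c) 1) (≤-trans lt (≤-reflexive (sym (+-identityʳ _)))))
    t≤c : t ≤ c
    t≤c = ≤-pred (≤-trans suct≤ (+-monoˡ-≤ c (≤-pred (≰⇒> u-light))))
    avoids : ∀ {i} → ¬ 2 ≤ row H i → G (punchIn u i) v ≡ false
    avoids = new-B-avoids-light core bd Ex (onto-punchIn G v) dEx refl avoidsEx t+2≤n refl big (≤-trans 2≤t t≤c)
    down : ∀ i → 2 ≤ row G (punchIn u i) → 2 ≤ row H i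
    down i h = decidable-stable (heavy? H i) λ ¬h →
      ¬h (≤-trans h (≤-reflexive (trans (row-delB v (delA u G) i) (cong (λ k → ⟦ k ⟧ + row H i) (avoids ¬h)))))

step-pair : ∀ {t n} (G : BipGraph (suc n) (suc n)) u v → 2 ≤ t → t + 2 ≤ n → Bounded G (3 + (t + t)) → G u v ≡ false →
  row G u + row (flip G) v ≤ suc t → Result t (delB v (delA u G)) → Result t G
step-pair {t} {n} G u v 2≤t t+2≤n bd u≁v deg≤ res with edges G + t <? t * suc n + suc n
... | yes s = inj₁ s
... | no ¬s = case res of λ
  { (inj₁ s) → ⊥-elim (not-strict s)
  ; (inj₂ (inj₁ th)) → inj₂ (inj₁ (thin-step th))
  ; (inj₂ (inj₂ (_ , th))) → inj₂ (inj₂ (refl , Flipped.thin-step th)) }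
  where
  open StepPair G u v 2≤t t+2≤n bd u≁v deg≤ ¬s
  module Flipped = StepPair (flip G) v u 2≤t t+2≤n (Flip.bounded G bd) u≁v (≡-≤-trans (+-comm (row (flip G) v) _) deg≤)
    (¬s ∘ strict-flip t G)

-- The case a = b = t + 2

module Rotation {a b : ℕ} (G : BipGraph a b) where
  open Graph G
  open Paths G
  open LongestPath G
  open Removal G
  open Zigzag G using (distinct-resp)

  -- The vertices preceding a neighbour of u: the new starts after a rotation at u.
  predsFrom : V → V → List V → List V
  predsFrom u z []        = []
  predsFrom u z (z′ ∷ ys) with E? u z′
  ... | yes _ = z ∷ predsFrom u z′ ys
  ... | no _  = predsFrom u z′ ys

  preds : V → List V → List V
  preds u []       = []
  preds u (z ∷ ys) = predsFrom u z ys

  wt-predsFrom≤ : ∀ f u z ys → wt f (predsFrom u z ys) ≤ f z + wt f ys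
  wt-predsFrom≤ f u z []        = z≤n
  wt-predsFrom≤ f u z (z′ ∷ ys) with E? u z′
  ... | yes _ = +-monoʳ-≤ (f z) (wt-predsFrom≤ f u z′ ys)
  ... | no _  = ≤-trans (wt-predsFrom≤ f u z′ ys) (m≤n+m _ (f z))

  wt-preds≤ : ∀ f u xs → wt f (preds u xs) ≤ wt f xs
  wt-preds≤ f u []       = z≤n
  wt-preds≤ f u (z ∷ ys) = wt-predsFrom≤ f u z ys

  size-preds : ∀ u z ys → size (preds u (z ∷ ys)) ≡ wt (adj# u) ys
  size-preds u z []        = refl
  size-preds u z (z′ ∷ ys) with E? u z′
  ... | yes e = cong₂ _+_ (sym (adj#-E e)) (size-preds u z′ ys)
  ... | no ¬e = trans (size-preds u z′ ys) (cong (_+ wt (adj# u) ys) (sym (adj#-¬E ¬e)))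

  ∈-predsFrom : ∀ {u z} x ys → z ∈ predsFrom u x ys → ∃ λ X → ∃ λ z′ → ∃ λ Y → x ∷ ys ≡ X ++ z ∷ z′ ∷ Y × E u z′
  ∈-predsFrom x [] z∈ = ⊥-elim (∉[] z∈)
  ∈-predsFrom {u} x (z′ ∷ ys) z∈ with E? u z′
  ... | no _ = case ∈-predsFrom z′ ys z∈ of λ { (X , z″ , Y , eq , e) → x ∷ X , z″ , Y , cong (x ∷_) eq , e }
  ... | yes e with ∈-∷⁻ z∈
  ...   | inj₁ refl = [] , z′ , ys , refl , e
  ...   | inj₂ z∈′ = case ∈-predsFrom z′ ys z∈′ of λ { (X , z″ , Y , eq , e) → x ∷ X , z″ , Y , cong (x ∷_) eq , e }

  ∈-preds : ∀ {u z} xs → z ∈ preds u xs → ∃ λ X → ∃ λ z′ → ∃ λ Y → xs ≡ X ++ z ∷ z′ ∷ Y × E u z′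
  ∈-preds []       z∈ = ⊥-elim (∉[] z∈)
  ∈-preds (x ∷ ys) z∈ = ∈-predsFrom x ys z∈

  module _ {u P r} (L : Longest u P r) where
    open Longest L

    rotations : List V
    rotations = preds u P

    rotations-distinct : Distinct rotations
    rotations-distinct = distinct λ v → ≤-trans (wt-preds≤ _ u P) (once dP v)

    deg≡wt : deg u ≡ wt (adj# u) P
    deg≡wt = ≤-antisym (ΣV≤wt {xs = P} (λ z le → start-closed L (E-adj# le))) (wt≤ΣV (adj# u) dP)

    size-rotations : size rotations ≡ deg u
    size-rotations = trans (go wP) (sym deg≡wt)
      where
      go : ∀ {P r} → Walk u P r → size (preds u P) ≡ wt (adj# u) P
      go ⟨ _ ⟩ = sym (trans (+-identityʳ _) (adj#-¬E {u} {u} E-irrefl))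
      go (_∷_ {ys = ys} e w) = trans (size-preds u u ys) (cong (_+ wt (adj# u) ys) (sym (adj#-¬E {u} {u} E-irrefl)))

    module Rotate {z} (z∈ : z ∈ rotations) where
      side : nA z ≡ nA u
      side with ∈-preds P z∈
      ... | X , z′ , Y , refl , u~z′ with split X wP
      ...   | _ , (e ∷ wY) with head≡ wY
      ...     | refl = trans (nA≡nB e) (sym (nA≡nB u~z′))

      rotated : ∃ λ P′ → Longest z P′ r × (∀ f → wt f P′ ≡ wt f P)
      rotated with ∈-preds P z∈
      ... | X , z′ , Y , refl , u~z′ with split X wP
      ...   | wX , (e ∷ wY) with head≡ wY
      ...     | refl = _ , same-size-longest L (rev wX ⋈⟨ u~z′ ⟩ wY) weights , weights
        where
        lemma : ∀ x z y → x + (z + 0) + y ≡ x + (z + y)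
        lemma = solve-∀
        weights : ∀ f → wt f (reverse (X ++ z ∷ []) ++ z′ ∷ Y) ≡ wt f (X ++ z ∷ z′ ∷ Y)
        weights f = trans (wt-shape f (↺ (‵ X ⊕ ‵ (z ∷ [])) ⊕ ‵ (z′ ∷ Y))) (trans (lemma (wt f X) (f z) (wt f (z′ ∷ Y))) (sym (wt-++ f X _)))

      rotated∈P : z ∈ P
      rotated∈P = occurs (≤-trans (multiplicity z∈) (wt-preds≤ _ u P))

      ≢r : z ≢ r
      ≢r refl with ∈-preds P z∈
      ... | X , z′ , Y , refl , _ with split X wP
      ...   | _ , (e ∷ wY) with head≡ wY
      ...     | refl = ∉-tail (distinct-++ʳ X dP) (last∈ wY)

    -- z starts a longest path on the same vertices, so its neighbours lie on P.
    outside≁rotations : ∀ {o z} → o ∉ P → z ∈ rotations → ¬ E o z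
    outside≁rotations {o} o∉ z∈ o~z with Rotate.rotated z∈
    ... | P′ , L′ , eq = o∉ (∈-resp eq (start-closed L′ (E-sym o~z)))

  two-missing : ∀ {i x z} P → x ∈ P → z ∈ P → x ≢ z → nB x ≡ 1 → nB z ≡ 1 → ¬ E (inj₁ i) x → ¬ E (inj₁ i) z →
    wt (adj# (inj₁ i)) P + 2 ≤ wt nB P
  two-missing {i} {x} {z} P x∈ z∈ x≢z x∈B z∈B u≁x u≁z = begin
    wt (adj# u) P + 2                              ≤⟨ +-monoʳ-≤ (wt (adj# u) P) (+-mono-≤ (multiplicity x∈) (multiplicity z∈)) ⟩
    wt (adj# u) P + (occ x P + occ z P)            ≡⟨ wt-+₃ P ⟨
    wt (λ w → adj# u w + (δ w x + δ w z)) P        ≤⟨ wt-mono pointwise P ⟩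
    wt nB P                                        ∎
    where
    open ≤-Reasoning
    u : V
    u = inj₁ i
    wt-+₃ : ∀ P → wt (λ w → adj# u w + (δ w x + δ w z)) P ≡ wt (adj# u) P + (occ x P + occ z P)
    wt-+₃ [] = refl
    wt-+₃ (w ∷ P) = trans (cong (_ +_) (wt-+₃ P)) (lemma (adj# u w) (δ w x) (δ w z) (wt (adj# u) P) (occ x P) (occ z P))
      where
      lemma : ∀ p q r s t w → p + (q + r) + (s + (t + w)) ≡ p + s + (q + t + (r + w))
      lemma = solve-∀
    pointwise : ∀ w → adj# u w + (δ w x + δ w z) ≤ nB w
    pointwise w with w ≟ⱽ x | w ≟ⱽ z
    ... | yes refl | yes refl = ⊥-elim (x≢z refl)
    ... | yes refl | no _ rewrite adj#-¬E u≁x = ≤-reflexive (sym x∈B)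
    ... | no _ | yes refl rewrite adj#-¬E u≁z = ≤-reflexive (sym z∈B)
    ... | no _ | no _ = ≡-≤-trans (+-identityʳ _) (adj#≤nB w)

  onA : (Fin a → ℕ) → V → ℕ
  onA m (inj₁ i) = m i
  onA m (inj₂ _) = 0

  wt-onA≤ : ∀ m {xs} → Distinct xs → wt (onA m) xs ≤ ∑ m
  wt-onA≤ m d = ≤-trans (wt≤ΣV (onA m) d) (≤-reflexive (trans (cong (∑ m +_) (∑-zero b)) (+-identityʳ _)))

  ≤wt-onA : ∀ m c xs → (∀ {x} → x ∈ xs → ∃ λ i → x ≡ inj₁ i × c ≤ m i) → size xs * c ≤ wt (onA m) xs
  ≤wt-onA m c []       all = z≤n
  ≤wt-onA m c (x ∷ xs) all with all ∈-here
  ... | i , refl , le = +-mono-≤ le (≤wt-onA m c xs (all ∘ ∈-there))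

  A-list : ∀ m c xs → Distinct xs → (∀ {x} → x ∈ xs → ∃ λ i → x ≡ inj₁ i × c ≤ m i) → size xs * c ≤ ∑ m
  A-list m c xs d all = ≤-trans (≤wt-onA m c xs all) (wt-onA≤ m d)

  light-list : ∀ xs → Distinct xs → (∀ {x} → x ∈ xs → ∃ λ i → x ≡ inj₁ i × row G i ≤ 1) → heavy G + size xs ≤ a
  light-list xs d all = ≤-trans (+-monoʳ-≤ (heavy G) (≡-≤-trans (sym (*-identityʳ (size xs))) (A-list m 1 xs d all′))) (≤-reflexive total)
    where
    m : Fin a → ℕ
    m i = 1 ∸ ⟦ does (heavy? G i) ⟧
    all′ : ∀ {x} → x ∈ xs → ∃ λ i → x ≡ inj₁ i × 1 ≤ m i
    all′ x∈ with all x∈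
    ... | i , eq , le = i , eq , ≤-reflexive (sym (cong (1 ∸_) (⟦does⟧-no (heavy? G i) (<⇒≱ (s≤s le)))))
    total : heavy G + ∑ m ≡ a
    total = trans (sym (∑-distrib-+ (λ i → ⟦ does (heavy? G i) ⟧) m))
      (trans (sum-cong-≗ λ i → m+[n∸m]≡n (⟦⟧≤1 (does (heavy? G i)))) (∑-one a))

  co-row : Fin a → ℕ
  co-row i = b ∸ row G i

  edges+co-rows : edges G + ∑ co-row ≡ a * b
  edges+co-rows = trans (sym (∑-distrib-+ (row G) co-row)) (trans (sum-cong-≗ λ i → m+[n∸m]≡n (row≤b G i)) (∑-const a b))

  -- Each vertex of the list misses at least b - j vertices of B.
  low-list : ∀ j xs → Distinct xs → (∀ {x} → x ∈ xs → ∃ λ i → x ≡ inj₁ i × row G i ≤ j) → edges G + size xs * (b ∸ j) ≤ a * b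
  low-list j xs d all = ≤-trans (+-monoʳ-≤ (edges G) (A-list co-row (b ∸ j) xs d λ x∈ → case all x∈ of λ { (i , eq , le) → i , eq , ∸-monoʳ-≤ b le })) (≤-reflexive edges+co-rows)

module Base {t : ℕ} (2≤t : 2 ≤ t) (G : BipGraph (2 + t) (2 + t)) (conn : Connected G) where
  open Graph G
  open Paths G
  open LongestPath G
  open Removal G
  open Rotation G
  open Zigzag G using (fresh; ∉-∷; distinct-resp)
  private
    n : ℕ
    n = 2 + t

  deg≥1 : ∀ {x y} → x ≢ y → 1 ≤ deg x
  deg≥1 {x} x≢y with has-neighbour conn x≢y
  ... | z , e = ≡-≤-trans (sym (trans (+-identityʳ _) (adj#-E e))) (wt≤ΣV (adj# x) (distinct-one z))

  few-lights : ∀ xs → Distinct xs → 2 ≤ size xs → (∀ {x} → x ∈ xs → ∃ λ i → x ≡ inj₁ i × row G i ≤ 1) → Thin t G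
  few-lights xs d 2≤s all = +-cancelʳ-≤ 2 _ _ (≤-trans (+-monoʳ-≤ (heavy G) 2≤s) (≤-trans (light-list xs d all) (≤-reflexive (+-comm 2 t))))

  -- At least (j+1)(t+2-j) edges are missing. This is concave in j and equals the permitted 2t + 2
  -- at j = 1 and at j = t, so it is larger in between. With j = 2 + p and t = j + 1 + q the excess
  -- is 1 + p + q + pq.
  many-low : ∀ j xs → Distinct xs → suc j ≤ size xs → 2 ≤ j → j < t → (∀ {x} → x ∈ xs → ∃ λ i → x ≡ inj₁ i × row G i ≤ j) → Strict t G
  many-low j xs d lt 2≤j j<t all = go (j ∸ 2) (t ∸ suc j) (sym (m+[n∸m]≡n 2≤j)) (sym (m+[n∸m]≡n j<t)) (low-list j xs d all)
    where
    go : ∀ p q → j ≡ 2 + p → t ≡ suc j + q → edges G + size xs * (n ∸ j) ≤ n * n → Strict t G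
    go p q refl refl le = ≤-trans (m≤m+n _ (p * q + p + q)) (≤-by _ _ (+-mono-≤ le (*-monoˡ-≤ (3 + q) lt))
      (trans (cong (λ k → suc (edges G + t) + (p * q + p + q) + (n * n + k)) refl)
        (trans (lemma (edges G) p q (size xs)) (cong (λ k → t * n + n + (edges G + size xs * k + suc j * (3 + q))) (sym n∸j)))))
      where
      n∸j : n ∸ j ≡ 3 + q
      n∸j = trans (cong (_∸ (2 + p)) (eq p q)) (m+n∸m≡n (2 + p) (3 + q))
        where
        eq : ∀ p q → 2 + (3 + p + q) ≡ 2 + p + (3 + q)
        eq = solve-∀
      lemma : ∀ e p q s → suc (e + (3 + p + q)) + (p * q + p + q) + ((2 + (3 + p + q)) * (2 + (3 + p + q)) + s * (3 + q)) ≡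
        (3 + p + q) * (2 + (3 + p + q)) + (2 + (3 + p + q)) + (e + s * (3 + q) + (3 + p) * (3 + q))
      lemma = solve-∀

  pair-edge : ∀ {x y z} → Walk x (x ∷ y ∷ []) z → E x y
  pair-edge (e ∷ ⟨ _ ⟩) = e

  A-vertex : ∀ {x} → nA x ≡ 1 → ∃ λ i → x ≡ inj₁ i
  A-vertex {inj₁ i} _ = i , refl

  all-A : ∀ {P} → Distinct P → n ≤ wt nA P → ∀ i → inj₁ i ∈ P
  all-A {P} dP le i with inj₁ i ∈? P
  ... | yes i∈ = i∈
  ... | no i∉  = ⊥-elim (<⇒≱ (s≤s le) (≤-trans (wt≤ΣV nA (distinct-∷ i∉ dP)) (≤-reflexive ΣV-nA)))

  module SameEnds {i i′ P} (L : Longest (inj₁ i) P (inj₁ i′)) (short : size P ≤ 3 + (t + t))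
    (max : ∀ {k k′ P′} → Longest (inj₁ k) P′ (inj₁ k′) → row G k ≤ row G i) where
    open Longest L
    private
      u r : V
      u = inj₁ i
      r = inj₁ i′
      m : ℕ
      m = wt nB P

      A≡suc : wt nA P ≡ suc m
      A≡suc = trans (sym (+-identityʳ _)) (trans (alternate wP) (+-comm m 1))

      m≤ : m ≤ suc t
      m≤ = half-same P A≡suc short

      outside : ∃ λ k → inj₂ k ∉ P
      outside = fresh P (s≤s m≤)

      o : V
      o = inj₂ (proj₁ outside)
      o∉ : o ∉ P
      o∉ = proj₂ outside

      j : ℕ
      j = row G i

      j<m : j < m
      j<m = subst (_< m) (deg-inj₁ i) (end-degree L conn o∉)

      -- These are j + 1 starts of longest paths with both ends in A, all of degree at most j by the
      -- choice of u.
      ends : List V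
      ends = r ∷ rotations L

      ends-distinct : Distinct ends
      ends-distinct = distinct-∷ (λ r∈ → Rotate.≢r L r∈ refl) (rotations-distinct L)

      size-rot : size (rotations L) ≡ j
      size-rot = trans (size-rotations L) (deg-inj₁ i)

      rot-low : ∀ {x} → x ∈ rotations L → ∃ λ k → x ≡ inj₁ k × row G k ≤ j
      rot-low x∈ with A-vertex (Rotate.side L x∈)
      ... | k , refl = k , refl , max (proj₁ (proj₂ (Rotate.rotated L x∈)))

      ends-low : ∀ {x} → x ∈ ends → ∃ λ k → x ≡ inj₁ k × row G k ≤ j
      ends-low x∈ with ∈-∷⁻ x∈
      ... | inj₁ refl = i′ , refl , max (reverse-longest L)
      ... | inj₂ x∈′  = rot-low x∈′

      r-closed : ∀ {z} → E r z → z ∈ P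
      r-closed e = ∈-resp (λ f → wt-reverse f P) (start-closed (reverse-longest L) e)

    -- If u misses only one vertex of P ∩ B then r misses two, so that ends
    -- has more than the required number of missing edges.
    module Extreme (j≡t : j ≡ t) where
      private
        m≡ : m ≡ suc t
        m≡ = ≤-antisym m≤ (≡-≤-trans (cong suc (sym j≡t)) j<m)

      LowEnd : Set
      LowEnd = wt (adj# r) P + 2 ≤ m

      private
        longer : ∀ {x xs y} → Walk x xs y → (∀ f → wt f xs ≡ wt f P + f o) → ⊥
        longer w eq = too-long L [] (o ∷ []) w (disjoint-one dP o∉)
          (λ f → trans (+-identityʳ _) (trans (eq f) (cong (wt f P +_) (sym (+-identityʳ (f o)))))) (s≤s z≤n)

        lemma₁ : ∀ o l X p R → o + (l + (X + (p + 0) + R)) ≡ X + (p + (l + R)) + o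
        lemma₁ = solve-∀
        lemma₂ : ∀ o l X p R → o + (l + (R + (X + (p + 0)))) ≡ X + (p + (l + R)) + o
        lemma₂ = solve-∀
        lemma₃ : ∀ o l X p x Y q r → o + (l + (X + (p + 0) + (x + (Y + (q + 0)) + (r + 0)))) ≡ X + (p + (l + (x + (Y + (q + (r + 0)))))) + o
        lemma₃ = solve-∀
        lemma₄ : ∀ o l x r p₁ ys u → o + (l + (x + (r + (p₁ + ys + (u + 0))))) ≡ u + (p₁ + ys) + (l + (x + (r + 0))) + o
        lemma₄ = solve-∀

      module Decomposed {X₀ p l x Y} (P≡ : P ≡ X₀ ++ p ∷ inj₁ l ∷ x ∷ Y) (o~l : E o (inj₁ l))
        (wX : Walk u (X₀ ++ p ∷ []) p) (p~l : E p (inj₁ l)) (l~x : E (inj₁ l) x) (wY : Walk x (x ∷ Y) r) where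

        wtP : ∀ f → wt f P ≡ wt f X₀ + (f p + (f (inj₁ l) + wt f (x ∷ Y)))
        wtP f = trans (cong (wt f) P≡) (wt-++ f X₀ _)

        tail-distinct : Distinct (p ∷ inj₁ l ∷ x ∷ Y)
        tail-distinct = distinct-++ʳ X₀ (distinct-≡ P≡ dP)

        x∈B : nB x ≡ 1
        x∈B = sym (nA≡nB l~x)

        p∈B : nB p ≡ 1
        p∈B = sym (nA≡nB (E-sym p~l))

        p∈P : p ∈ P
        p∈P = subst (p ∈_) (sym P≡) (∈-++ʳ X₀ ∈-here)

        x∈P : x ∈ P
        x∈P = subst (x ∈_) (sym P≡) (∈-++ʳ X₀ (∈-there (∈-there ∈-here)))

        p≢x : p ≢ x
        p≢x refl = ∉-tail tail-distinct (∈-there ∈-here)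

        u≁x : ¬ E u x
        u≁x u~x = longer (o~l ∷ E-sym p~l ∷ (rev wX ⋈⟨ u~x ⟩ wY)) λ f →
          trans (cong (λ k → f o + (f (inj₁ l) + k)) (wt-shape f (↺ (‵ X₀ ⊕ ‵ (p ∷ [])) ⊕ ‵ (x ∷ Y))))
            (trans (lemma₁ (f o) (f (inj₁ l)) (wt f X₀) (f p) (wt f (x ∷ Y))) (cong (_+ f o) (sym (wtP f))))

        r≁p : ¬ E r p
        r≁p r~p = longer (o~l ∷ l~x ∷ (wY ⋈⟨ r~p ⟩ rev wX)) λ f →
          trans (cong (λ k → f o + (f (inj₁ l) + k)) (wt-shape f (‵ (x ∷ Y) ⊕ ↺ (‵ X₀ ⊕ ‵ (p ∷ [])))))
            (trans (lemma₂ (f o) (f (inj₁ l)) (wt f X₀) (f p) (wt f (x ∷ Y))) (cong (_+ f o) (sym (wtP f))))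

        u~others : ∀ {z} → z ∈ P → nB z ≡ 1 → z ≢ x → E u z
        u~others {z} z∈ z∈B z≢x = decidable-stable (E? u z) λ u≁z → <⇒≱
          (≤-trans (s≤s m≤) (≤-reflexive (trans (+-comm 2 t) (cong (_+ 2) (trans (sym j≡t) (trans (sym (deg-inj₁ i)) (deg≡wt L)))))))
          (two-missing P x∈P z∈ (z≢x ∘ sym) x∈B z∈B u≁x u≁z)

        -- r misses x as well as p: with q the neighbour of r on P, u ~ q by `u~others`, and r ~ x
        -- would give the path o l p ... u q ... x r.
        long : ∀ Y₃ q r₀ → Y ≡ Y₃ ++ q ∷ r₀ ∷ [] → LowEnd
        long Y₃ q r₀ refl with split (x ∷ Y₃) wY
        ... | wA , (q~r ∷ ⟨ _ ⟩) = two-missing P x∈P p∈P (p≢x ∘ sym) x∈B p∈B r≁x r≁p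
          where
          q≢x : q ≢ x
          q≢x refl = ∉-tail (distinct-++ʳ (p ∷ inj₁ l ∷ []) tail-distinct) (∈-++ʳ Y₃ ∈-here)
          u~q : E u q
          u~q = u~others (subst (q ∈_) (sym P≡) (∈-++ʳ X₀ (∈-there (∈-there (∈-there (∈-++ʳ Y₃ ∈-here)))))) (sym (nA≡nB (E-sym q~r))) q≢x
          r≁x : ¬ E r x
          r≁x r~x = longer (o~l ∷ E-sym p~l ∷ (rev wX ⋈⟨ u~q ⟩ rev wA ⋈⟨ E-sym r~x ⟩ ⟨ r ⟩)) λ f →
            trans (cong (λ k → f o + (f (inj₁ l) + k)) (wt-shape f (↺ (‵ X₀ ⊕ ‵ (p ∷ [])) ⊕ ↺ (‵ (x ∷ []) ⊕ (‵ Y₃ ⊕ ‵ (q ∷ []))) ⊕ ‵ (r ∷ []))))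
              (trans (cong (λ k → f o + (f (inj₁ l) + (wt f X₀ + (f p + 0) + (k + (wt f Y₃ + (f q + 0)) + (f r + 0))))) (+-identityʳ (f x)))
              (trans (lemma₃ (f o) (f (inj₁ l)) (wt f X₀) (f p) (f x) (wt f Y₃) (f q) (f r))
              (cong (_+ f o) (sym (trans (wtP f) (cong (λ k → wt f X₀ + (f p + (f (inj₁ l) + (f x + k)))) (wt-++ f Y₃ _)))))))

        -- Here x is the neighbour of r on P, and the successor p₁ of u takes its place: r ~ p₁
        -- would give o l x r p₁ ... p u.
        short-tail : Y ≡ r ∷ [] → LowEnd
        short-tail refl with uncons wX (λ { refl → case p∈B of λ () })
        -- P would have five vertices, but its t + 1 ≥ 3 B-vertices require at least seven.
        ... | p₁ , [] , X≡ , u~p₁ , _ = ⊥-elim (<⇒≱ (≤-trans (s≤s (≤-reflexive size≡5)) (s≤s (s≤s (s≤s (s≤s (s≤s (s≤s z≤n))))))) (≤-trans (s≤s (+-mono-≤ 3≤m 3≤m)) (≤-reflexive (sym (trans (nA+nB P) (cong (_+ m) A≡suc))))))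
          where
          3≤m : 3 ≤ m
          3≤m = ≤-trans (s≤s 2≤t) (≤-reflexive (sym m≡))
          size≡5 : size P ≡ 5
          size≡5 = trans (wtP (λ _ → 1)) (trans (sym (+-assoc (size X₀) 1 3)) (cong (_+ 3) (trans (sym (wt-++ _ X₀ (p ∷ []))) (cong size X≡))))
        ... | p₁ , y ∷ ys , X≡ , u~p₁ , (e ∷ w) = two-missing P p₁∈P p∈P p₁≢p p₁∈B p∈B r≁p₁ r≁p
          where
          P≡′ : P ≡ (u ∷ p₁ ∷ y ∷ ys) ++ inj₁ l ∷ x ∷ r ∷ []
          P≡′ = trans P≡ (trans (sym (++-assoc X₀ (p ∷ []) _)) (cong (_++ inj₁ l ∷ x ∷ r ∷ []) X≡))
          p₁∈P : p₁ ∈ P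
          p₁∈P = subst (p₁ ∈_) (sym P≡′) (∈-there ∈-here)
          p₁∈B : nB p₁ ≡ 1
          p₁∈B = sym (nA≡nB u~p₁)
          p₁≢p : p₁ ≢ p
          p₁≢p refl = ∉-tail (distinct-++ʳ (u ∷ []) (distinct-≡ P≡′ dP)) (∈-++ˡ {xs = y ∷ ys} (last∈ w))
          r≁p₁ : ¬ E r p₁
          r≁p₁ r~p₁ = longer (o~l ∷ l~x ∷ pair-edge wY ∷ r~p₁ ∷ ((e ∷ w) ⋈⟨ E-sym (u~others p∈P p∈B p≢x) ⟩ ⟨ u ⟩)) λ f →
            trans (cong (λ k → f o + (f (inj₁ l) + (f x + (f r + k)))) (wt-++ f (p₁ ∷ y ∷ ys) (u ∷ [])))
              (trans (lemma₄ (f o) (f (inj₁ l)) (f x) (f r) (f p₁) (wt f (y ∷ ys)) (f u))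
              (cong (_+ f o) (sym (trans (cong (wt f) P≡′) (wt-++ f (u ∷ p₁ ∷ y ∷ ys) _)))))

        low-end : LowEnd
        low-end with initLast Y
        ... | [] = case wY of λ { ⟨ _ ⟩ → case x∈B of λ () }
        ... | Y₂ ∷ʳ′ r₀ with proj₂ (split (x ∷ Y₂) wY)
        ...   | ⟨ _ ⟩ with initLast Y₂
        ...     | [] = short-tail refl
        ...     | Y₃ ∷ʳ′ q = long Y₃ q r (++-assoc Y₃ (q ∷ []) (r ∷ []))

      -- P has t + 2 A-vertices and so contains every neighbour l of o. Such an l is not an end of
      -- P, because the neighbours of the ends lie on P.
      r-low : LowEnd
      r-low with has-neighbour conn {o} {u} (λ ())
      ... | inj₂ _ , edge ()
      ... | inj₁ l , o~l = body (find (all-A dP (≤-reflexive (sym (trans A≡suc (cong suc m≡)))) l)) refl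
        where
        body : ∀ {xs} → At (inj₁ l) xs → xs ≡ P → LowEnd
        body (at X Y) eq with initLast X
        ... | [] = ⊥-elim (o∉ (start-closed L (subst (λ z → E z o) (sym (head≡ (subst (λ l → Walk u l r) (sym eq) wP))) (E-sym o~l))))
        ... | X₀ ∷ʳ′ p with Y
        ...   | [] with split (X₀ ++ p ∷ []) (subst (λ l → Walk u l r) (sym eq) wP)
        ...     | _ , ⟨ _ ⟩ = ⊥-elim (o∉ (r-closed (E-sym o~l)))
        body (at X Y) eq | X₀ ∷ʳ′ p | x ∷ Y₁ = inner (split X₀ (subst (λ l → Walk u l r) P≡ wP))
          where
          P≡ : P ≡ X₀ ++ p ∷ inj₁ l ∷ x ∷ Y₁
          P≡ = trans (sym eq) (++-assoc X₀ (p ∷ []) _)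
          inner : Walk u (X₀ ++ p ∷ []) p × Walk p (p ∷ inj₁ l ∷ x ∷ Y₁) r → LowEnd
          inner (wX , (e₁ ∷ w)) with head≡ w
          inner (wX , (e₁ ∷ (e₂ ∷ w))) | refl with head≡ w
          ... | refl = Decomposed.low-end P≡ o~l wX e₁ e₂ w

      -- r misses at least three vertices of B and each of the t rotations at least two: 2t + 3
      -- missing edges, one more than permitted.
      strict : Strict t G
      strict = ≤-by _ _ (≤-trans (+-monoʳ-≤ (edges G) (≤-trans missing (wt-onA≤ co-row ends-distinct))) (≤-reflexive edges+co-rows)) (lemma (edges G) t)
        where
        r-row : row G i′ + 1 ≤ t
        r-row = ≤-pred (≡-≤-trans (sym (+-suc (row G i′) 1)) (≤-trans
          (+-monoˡ-≤ 2 (≡-≤-trans (sym (deg-inj₁ i′)) (ΣV≤wt {xs = P} (λ z le → r-closed (E-adj# le))))) (≤-trans r-low m≤)))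
        missing : 3 + t * 2 ≤ wt (onA co-row) ends
        missing = +-mono-≤ (≡-≤-trans (sym (m+n∸m≡n (row G i′) 3)) (∸-monoˡ-≤ (row G i′) (≡-≤-trans (sym (shift (row G i′))) (+-monoʳ-≤ 2 r-row))))
          (≡-≤-trans (cong (_* 2) (sym (trans size-rot j≡t))) (≤wt-onA co-row 2 (rotations L) λ x∈ → case rot-low x∈ of λ
            { (k , eq , le) → k , eq , ≡-≤-trans (sym (m+n∸n≡m 2 t)) (∸-monoʳ-≤ n (≤-trans le (≤-reflexive j≡t))) }))
          where
          shift : ∀ k → 2 + (k + 1) ≡ k + 3
          shift = solve-∀
        lemma : ∀ e t → suc (e + t) + (2 + t) * (2 + t) ≡ t * (2 + t) + (2 + t) + (e + (3 + t * 2))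
        lemma = solve-∀

    result : Result t G
    result with j ≤? 1 | j Data.Nat.≟ t
    ... | yes j≤1 | _ = inj₂ (inj₁ (few-lights ends ends-distinct
      (s≤s (≤-trans (subst (1 ≤_) (deg-inj₁ i) (deg≥1 {inj₁ i} {o} λ ())) (≤-reflexive (sym size-rot))))
      λ x∈ → case ends-low x∈ of λ { (k , eq , le) → k , eq , ≤-trans le j≤1 }))
    ... | no _ | yes j≡t = inj₁ (Extreme.strict j≡t)
    ... | no j≰1 | no j≢t = inj₁ (many-low j ends ends-distinct (s≤s (≤-reflexive (sym size-rot))) (≰⇒> j≰1)
      (≤∧≢⇒< (≤-pred (≤-trans j<m m≤)) j≢t) ends-low)

-- Double counting, and longest paths with ends on both sides

∑∑ : ∀ {m n} → (Fin m → Fin n → ℕ) → ℕ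
∑∑ f = ∑ λ i → ∑ (f i)

∑∑-mono : ∀ {m n} {f g : Fin m → Fin n → ℕ} → (∀ i j → f i j ≤ g i j) → ∑∑ f ≤ ∑∑ g
∑∑-mono le = ∑-mono λ i → ∑-mono (le i)

∑∑-+ : ∀ {m n} (f g : Fin m → Fin n → ℕ) → ∑∑ (λ i j → f i j + g i j) ≡ ∑∑ f + ∑∑ g
∑∑-+ f g = trans (sum-cong-≗ λ i → ∑-distrib-+ (f i) (g i)) (∑-distrib-+ (λ i → ∑ (f i)) (λ i → ∑ (g i)))

∑-*ˡ : ∀ {n} c (f : Fin n → ℕ) → ∑ (λ i → c * f i) ≡ c * ∑ f
∑-*ˡ c f = trans (sum-cong-≗ λ i → *-comm c (f i)) (trans (∑-*ʳ f c) (*-comm (∑ f) c))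

∑∑-* : ∀ {m n} (f : Fin m → ℕ) (g : Fin n → ℕ) → ∑∑ (λ i j → f i * g j) ≡ ∑ f * ∑ g
∑∑-* f g = trans (sum-cong-≗ λ i → ∑-*ˡ (f i) g) (∑-*ʳ f (∑ g))

-- Inclusion–exclusion for the missing edges in a set of rows and a set of columns
-- (α and β are their indicators), plus two missing edges outside both.
module Indicators {n : ℕ} (G : BipGraph n n) (α β : Fin n → ℕ) (α≤1 : ∀ i → α i ≤ 1) (β≤1 : ∀ j → β j ≤ 1)
  {x p : Fin n} {q y : Fin n} (αx : α x ≡ 0) (αp : α p ≡ 0) (βq : β q ≡ 0) (βy : β y ≡ 0)
  (x≁q : G x q ≡ false) (p≁y : G p y ≡ false) (x≢p : x ≢ p) where

  private
    ind : Fin n → Fin n → ℕ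
    ind i k = ⟦ does (i Fin.≟ k) ⟧

    ∑-ind : ∀ i → ∑ (ind i) ≡ 1
    ∑-ind i = trans (sum-cong-≗ λ k → sym (*-identityʳ (ind i k))) (∑-pick i (λ _ → 1))

    -- This is (1-g)(1-c)(1-d) + gcd ≥ 0 multiplied out. The factors 1 match the form of the double
    -- sums below.
    bits : ∀ g c d → g ≤ 1 → c ≤ 1 → d ≤ 1 → g + c * 1 + 1 * d ≤ 1 + c * d + c * g + d * g
    bits 0 0 0 _ _ _ = z≤n
    bits 1 0 0 _ _ _ = s≤s z≤n
    bits 0 1 0 _ _ _ = s≤s z≤n
    bits 0 0 1 _ _ _ = s≤s z≤n
    bits 1 1 0 _ _ _ = s≤s (s≤s z≤n)
    bits 1 0 1 _ _ _ = s≤s (s≤s z≤n)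
    bits 0 1 1 _ _ _ = s≤s (s≤s z≤n)
    bits 1 1 1 _ _ _ = s≤s (s≤s (s≤s z≤n))
    bits (suc (suc _)) _ _ (s≤s ()) _ _
    bits 0 (suc (suc _)) _ _ (s≤s ()) _
    bits 1 (suc (suc _)) _ _ (s≤s ()) _
    bits 0 0 (suc (suc _)) _ _ (s≤s ())
    bits 0 1 (suc (suc _)) _ _ (s≤s ())
    bits 1 0 (suc (suc _)) _ _ (s≤s ())
    bits 1 1 (suc (suc _)) _ _ (s≤s ())

    pointwise : ∀ i j → ⟦ G i j ⟧ + α i * 1 + 1 * β j + (ind x i * ind q j + ind p i * ind y j) ≤ 1 + α i * β j + α i * ⟦ G i j ⟧ + β j * ⟦ G i j ⟧
    pointwise i j with x Fin.≟ i | q Fin.≟ j | p Fin.≟ i | y Fin.≟ j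
    ... | yes refl | _ | yes refl | _ = ⊥-elim (x≢p refl)
    ... | yes refl | yes refl | no _ | _ rewrite αx | βq | x≁q = s≤s z≤n
    ... | no _ | _ | yes refl | yes refl rewrite αp | βy | p≁y = s≤s z≤n
    ... | yes refl | no _ | no _ | _ = ≡-≤-trans (+-identityʳ _) (bits ⟦ G i j ⟧ (α i) (β j) (⟦⟧≤1 _) (α≤1 i) (β≤1 j))
    ... | no _ | _ | yes refl | no _ = ≡-≤-trans (+-identityʳ _) (bits ⟦ G i j ⟧ (α i) (β j) (⟦⟧≤1 _) (α≤1 i) (β≤1 j))
    ... | no _ | _ | no _ | _ = ≡-≤-trans (+-identityʳ _) (bits ⟦ G i j ⟧ (α i) (β j) (⟦⟧≤1 _) (α≤1 i) (β≤1 j))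

  indicators : edges G + ∑ α * n + n * ∑ β + 2 ≤ n * n + ∑ α * ∑ β + ∑ (λ i → α i * row G i) + ∑ (λ j → β j * row (flip G) j)
  indicators = subst₂ _≤_ lhs rhs (∑∑-mono pointwise)
    where
    A B C : Fin n → Fin n → ℕ
    A i j = ⟦ G i j ⟧
    B i j = A i j + α i * 1
    C i j = B i j + 1 * β j
    D D₁ D₂ : Fin n → Fin n → ℕ
    D i j = 1 + α i * β j
    D₁ i j = D i j + α i * A i j
    D₂ i j = D₁ i j + β j * A i j
    lhs : ∑∑ (λ i j → C i j + (ind x i * ind q j + ind p i * ind y j)) ≡ edges G + ∑ α * n + n * ∑ β + 2
    lhs = trans (∑∑-+ C _) (cong₂ _+_
      (trans (∑∑-+ B (λ i j → 1 * β j)) (cong₂ _+_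
        (trans (∑∑-+ A (λ i j → α i * 1)) (cong (edges G +_) (trans (∑∑-* {n} {n} α (λ _ → 1)) (cong (∑ α *_) (∑-one n)))))
        (trans (∑∑-* {n} {n} (λ _ → 1) β) (cong (_* ∑ β) (∑-one n)))))
      (trans (∑∑-+ (λ i j → ind x i * ind q j) (λ i j → ind p i * ind y j))
        (cong₂ _+_ (trans (∑∑-* (ind x) (ind q)) (cong₂ _*_ (∑-ind x) (∑-ind q))) (trans (∑∑-* (ind p) (ind y)) (cong₂ _*_ (∑-ind p) (∑-ind y))))))
    rhs : ∑∑ D₂ ≡ n * n + ∑ α * ∑ β + ∑ (λ i → α i * row G i) + ∑ (λ j → β j * row (flip G) j)
    rhs = trans (∑∑-+ D₁ (λ i j → β j * A i j)) (cong₂ _+_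
      (trans (∑∑-+ D (λ i j → α i * A i j)) (cong₂ _+_
        (trans (∑∑-+ (λ _ _ → 1) (λ i j → α i * β j)) (cong₂ _+_ (trans (sum-cong-≗ {n} λ _ → ∑-one n) (∑-const n n)) (∑∑-* α β)))
        (sum-cong-≗ λ i → ∑-*ˡ (α i) (A i))))
      (trans (∑-comm (λ i j → β j * A i j)) (sum-cong-≗ λ j → ∑-*ˡ (β j) (λ i → A i j))))

longest-flip : ∀ {a b} (G : BipGraph a b) {u P r} → LongestPath.Longest G u P r → LongestPath.Longest (flip G) (swap u) (List.map swap P) (swap r)
longest-flip G {P = P} L = record
  { wP = Flip.map-walk (flip G) wP
  ; dP = Flip.map-distinct (flip G) dP
  ; longest = λ {_} {xs} w d → ≡-≤-trans (sym (Flip.wt-map G (λ _ → 1) xs))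
      (≤-trans (longest (Flip.map-walk G w) (Flip.map-distinct G d)) (≤-reflexive (sym (Flip.wt-map (flip G) (λ _ → 1) P)))) }
  where open LongestPath.Longest L

module BaseOpposite {t : ℕ} (2≤t : 2 ≤ t) (G : BipGraph (2 + t) (2 + t)) (conn : Connected G)
  {i j : Fin (2 + t)} {P : List (Vertex (2 + t) (2 + t))} (L : LongestPath.Longest G (inj₁ i) P (inj₂ j))
  (short : Graph.size G P ≤ 3 + (t + t))
  (max : ∀ {k l P′} → LongestPath.Longest G (inj₁ k) P′ (inj₂ l) → row G k + row (flip G) l ≤ row G i + row (flip G) j) where
  open Graph G
  open Paths G
  open LongestPath G
  open Removal G
  open Rotation G
  open Base 2≤t G conn
  open Zigzag G using (fresh; freshA)
  open Longest L
  private
    n : ℕ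
    n = 2 + t
    u v : V
    u = inj₁ i
    v = inj₂ j
    d e m : ℕ
    d = row G i
    e = row (flip G) j
    m = wt nB P

    A≡B : wt nA P ≡ m
    A≡B = trans (sym (+-identityʳ _)) (trans (alternate wP) (+-identityʳ _))

    m≤ : m ≤ suc t
    m≤ = half-opposite P A≡B short

  outside-B : ∃ λ y → inj₂ y ∉ P
  outside-B = fresh P (s≤s m≤)

  outside-A : ∃ λ x → inj₁ x ∉ P
  outside-A = freshA P (s≤s (≡-≤-trans A≡B m≤))

  private
    L′ : Longest v (reverse P) u
    L′ = reverse-longest L

    d≡ : d ≡ wt (adj# u) P
    d≡ = trans (sym (deg-inj₁ i)) (deg≡wt L)

    e≡ : e ≡ wt (adj# v) P
    e≡ = trans (sym (deg-inj₂ j)) (trans (deg≡wt L′) (wt-reverse _ P))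

    d+e≤ : d + e ≤ suc t
    d+e≤ = ≡-≤-trans (cong₂ _+_ d≡ e≡) (≤-trans (Opposite.opposite-count L conn (proj₂ outside-A)) m≤)

    1≤d : 1 ≤ d
    1≤d = subst (1 ≤_) (deg-inj₁ i) (deg≥1 {u} {v} λ ())

    1≤e : 1 ≤ e
    1≤e = subst (1 ≤_) (deg-inj₂ j) (deg≥1 {v} {u} λ ())

    SA SB : List V
    SA = rotations L
    SB = rotations L′

    size-SA : size SA ≡ d
    size-SA = trans (size-rotations L) (deg-inj₁ i)

    size-SB : size SB ≡ e
    size-SB = trans (size-rotations L′) (deg-inj₂ j)

    SA⊆P : ∀ {z} → z ∈ SA → z ∈ P
    SA⊆P z∈ = Rotate.rotated∈P L z∈

    SB⊆P : ∀ {z} → z ∈ SB → z ∈ P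
    SB⊆P z∈ = ∈-resp (λ f → wt-reverse f P) (Rotate.rotated∈P L′ z∈)

    -- A rotation at u keeps the other end v, so e cancels in the maximality of d + e.
    SA-low : ∀ {z} → z ∈ SA → ∃ λ k → z ≡ inj₁ k × row G k ≤ d
    SA-low z∈ with A-vertex (Rotate.side L z∈)
    ... | k , refl = k , refl , +-cancelʳ-≤ e _ _ (max (proj₁ (proj₂ (Rotate.rotated L z∈))))

    B-vertex : ∀ {z} → nA z ≡ 0 → ∃ λ k → z ≡ inj₂ k
    B-vertex {inj₂ k} _ = k , refl

    SB-low : ∀ {z} → z ∈ SB → ∃ λ k → z ≡ inj₂ k × row (flip G) k ≤ e
    SB-low z∈ with B-vertex (Rotate.side L′ z∈)
    ... | k , refl = k , refl , +-cancelˡ-≤ d _ _ (max (reverse-longest (proj₁ (proj₂ (Rotate.rotated L′ z∈)))))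

    SA≁v : ∀ {z} → z ∈ SA → ¬ E v z
    SA≁v z∈ v~z with A-vertex (Rotate.side L z∈) | Rotate.rotated L z∈
    ... | k , refl | P′ , L″ , eq = Opposite.u≁v L″ conn (proj₂ outside-A ∘ ∈-resp eq) (E-sym v~z)

    SB≁u : ∀ {z} → z ∈ SB → ¬ E u z
    SB≁u z∈ u~z with B-vertex (Rotate.side L′ z∈) | Rotate.rotated L′ z∈
    ... | k , refl | P′ , L″ , eq = Opposite.u≁v (reverse-longest L″) conn
      (proj₂ outside-A ∘ ∈-resp (λ f → trans (wt-reverse f P′) (trans (eq f) (wt-reverse f P)))) u~z

    -- Exchanging the first vertex for an outside neighbour of the second keeps the length.
    replace-start : ∀ {u P r p ys x} (L : Longest u P r) → P ≡ u ∷ p ∷ ys → Walk p (p ∷ ys) r → x ∉ P → E x p → Longest x (x ∷ p ∷ ys) r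
    replace-start {p = p} {ys} {x} L refl w x∉ x~p = record
      { wP = x~p ∷ w ; dP = distinct-∷ (x∉ ∘ ∈-there) (distinct-++ʳ (_ ∷ []) (Longest.dP L)) ; longest = Longest.longest L }

    first : ∃ λ q → E u (inj₂ q) × ∃ λ ys → P ≡ u ∷ inj₂ q ∷ ys × Walk (inj₂ q) (inj₂ q ∷ ys) v
    first with uncons wP (λ ())
    ... | inj₂ q , ys , eq , e , w = q , e , ys , eq , w
    ... | inj₁ _ , _ , _ , edge () , _

    last : ∃ λ p → E v (inj₁ p) × ∃ λ ys → reverse P ≡ v ∷ inj₁ p ∷ ys × Walk (inj₁ p) (inj₁ p ∷ ys) u
    last with uncons (Longest.wP L′) (λ ())
    ... | inj₁ q , ys , eq , e , w = q , e , ys , eq , w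
    ... | inj₂ _ , _ , _ , edge () , _

    q p : Fin n
    q = proj₁ first
    p = proj₁ last

    ∉reverse : ∀ {z} → z ∉ P → z ∉ reverse P
    ∉reverse z∉ = z∉ ∘ ∈-resp (λ f → wt-reverse f P)

    x~q⇒low : ∀ {x} → inj₁ x ∉ P → E (inj₁ x) (inj₂ q) → row G x ≤ d
    x~q⇒low x∉ x~q with first
    ... | _ , _ , _ , eq , w = +-cancelʳ-≤ e _ _ (max (replace-start L eq w x∉ x~q))

    y~p⇒low : ∀ {y} → inj₂ y ∉ P → E (inj₂ y) (inj₁ p) → row (flip G) y ≤ e
    y~p⇒low y∉ y~p with last
    ... | _ , _ , _ , eq , w = +-cancelˡ-≤ d _ _ (max (reverse-longest (replace-start L′ eq w (∉reverse y∉) y~p)))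

    p∉SA : inj₁ p ∉ SA
    p∉SA p∈ = SA≁v p∈ (proj₁ (proj₂ last))

    q∉SB : inj₂ q ∉ SB
    q∉SB q∈ = SB≁u q∈ (proj₁ (proj₂ first))

    extended-distinct : ∀ {x} → inj₁ x ∉ P → Distinct (inj₁ x ∷ SA)
    extended-distinct x∉ = distinct-∷ (x∉ ∘ SA⊆P) (rotations-distinct L)

    extended-low : ∀ {x z} → row G x ≤ d → z ∈ inj₁ x ∷ SA → ∃ λ k → z ≡ inj₁ k × row G k ≤ d
    extended-low {x} low z∈ with ∈-∷⁻ z∈
    ... | inj₁ refl = x , refl , low
    ... | inj₂ z∈′  = SA-low z∈′

  -- x and the rotations at u are d + 1 vertices of degree at most d. If d ≤ 1, two of them are
  -- light; if 1 < d < t, `many-low` applies; d = t forces e ≤ 1, and then y and v are two light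
  -- vertices of B.
  low-outside : ∀ {x y} → inj₁ x ∉ P → inj₂ y ∉ P → row G x ≤ d → Result t G
  low-outside {x} {y} x∉ y∉ low with d ≤? 1 | d Data.Nat.≟ t
  ... | yes d≤1 | _ = inj₂ (inj₁ (few-lights (inj₁ x ∷ SA) (extended-distinct x∉) (s≤s (≤-trans 1≤d (≤-reflexive (sym size-SA))))
    λ z∈ → case extended-low low z∈ of λ { (k , eq , le) → k , eq , ≤-trans le d≤1 }))
  ... | no d≰1 | no d≢t = inj₁ (many-low d (inj₁ x ∷ SA) (extended-distinct x∉) (s≤s (≤-reflexive (sym size-SA))) (≰⇒> d≰1)
    (≤∧≢⇒< (+-cancelʳ-≤ 1 _ _ (≤-trans (+-monoʳ-≤ d 1≤e) (≤-trans d+e≤ (≤-reflexive (+-comm 1 t))))) d≢t) (extended-low low))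
  ... | no _ | yes d≡t = inj₂ (inj₂ (refl , Base.few-lights 2≤t (flip G) (Flip.flip-connected G conn)
    (inj₁ y ∷ inj₁ j ∷ []) (Zigzag.distinct₂ (flip G) λ { refl → y∉ (last∈ wP) }) ≤-refl
    λ z∈ → case Graph.∈-∷⁻ (flip G) z∈ of λ
      { (inj₁ refl) → y , refl , y-low
      ; (inj₂ z∈′) → case Graph.∈-∷⁻ (flip G) z∈′ of λ { (inj₁ refl) → j , refl , e≤1 ; (inj₂ z∈[]) → ⊥-elim (Graph.∉[] (flip G) z∈[]) } }))
    where
    e≤1 : e ≤ 1
    e≤1 = +-cancelˡ-≤ t _ _ (≡-≤-trans (cong (_+ e) (sym d≡t)) (≤-trans d+e≤ (≤-reflexive (+-comm 1 t))))
    y-low : row (flip G) y ≤ 1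
    y-low with E? (inj₂ y) (inj₁ p)
    ... | yes y~p = ≤-trans (y~p⇒low y∉ y~p) e≤1
    ... | no y≁p = +-cancelʳ-≤ (suc t) _ _ (≤-trans (+-monoʳ-≤ (row (flip G) y) missing) (≤-reflexive total))
      where
      miss : Fin n → ℕ
      miss k = 1 ∸ ⟦ G k y ⟧
      total : row (flip G) y + ∑ miss ≡ 1 + suc t
      total = trans (sym (∑-distrib-+ (λ k → ⟦ G k y ⟧) miss)) (trans (sum-cong-≗ λ k → m+[n∸m]≡n (⟦⟧≤1 (G k y))) (∑-one n))
      non : ∀ {k} → ¬ E (inj₂ y) (inj₁ k) → 1 ≤ miss k
      non y≁k = ≤-reflexive (sym (cong (1 ∸_) (adj#-¬E y≁k)))
      -- y is adjacent neither to the t rotations nor to p, which leaves one possible neighbour.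
      missing : suc t ≤ ∑ miss
      missing = ≡-≤-trans (cong suc (trans (sym d≡t) (trans (sym size-SA) (sym (*-identityʳ _)))))
        (A-list miss 1 (inj₁ p ∷ SA) (distinct-∷ p∉SA (rotations-distinct L)) λ z∈ → case ∈-∷⁻ z∈ of λ
          { (inj₁ refl) → p , refl , non y≁p
          ; (inj₂ z∈′) → case SA-low z∈′ of λ { (k , refl , _) → k , refl , non (outside≁rotations L y∉ z∈′) } })

  -- x misses q and y misses p, since otherwise x or y could replace an end of P and would have
  -- small degree. Besides these two, at least d(n-d) + e(n-e) - de edges are missing at the
  -- rotations. With d = 1 + p, e = 1 + q and t + 1 = d + e + r the total exceeds 2t + 2 by 1 +
  -- (p+q)r + pq.
  strict : ∀ {x y} → inj₁ x ∉ P → inj₂ y ∉ P → d < row G x → e < row (flip G) y → Strict t G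
  strict {x} {y} x∉ y∉ high-x high-y = finish (d ∸ 1) (e ∸ 1) (suc t ∸ (d + e)) (sym (m+[n∸m]≡n 1≤d)) (sym (m+[n∸m]≡n 1≤e)) (sym (m+[n∸m]≡n d+e≤)) bound
    where
    α β : Fin n → ℕ
    α k = occ (inj₁ k) SA
    β l = occ (inj₂ l) SB
    onB : (Fin n → ℕ) → V → ℕ
    onB m (inj₁ _) = 0
    onB m (inj₂ l) = m l
    ∑α : ∀ f → ∑ (λ k → α k * f k) ≡ wt (onA f) SA
    ∑α f = sym (trans (wt-ΣV (onA f) SA) (trans (cong (∑ (λ k → α k * f k) +_) (trans (sum-cong-≗ λ l → *-zeroʳ (occ (inj₂ l) SA)) (∑-zero n))) (+-identityʳ _)))
    ∑β : ∀ f → ∑ (λ l → β l * f l) ≡ wt (onB f) SB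
    ∑β f = sym (trans (wt-ΣV (onB f) SB) (cong (_+ ∑ (λ l → β l * f l)) (trans (sum-cong-≗ λ k → *-zeroʳ (occ (inj₁ k) SB)) (∑-zero n))))
    wtA≤ : ∀ f c xs → (∀ {z} → z ∈ xs → ∃ λ k → z ≡ inj₁ k × f k ≤ c) → wt (onA f) xs ≤ size xs * c
    wtA≤ f c [] all = z≤n
    wtA≤ f c (z ∷ xs) all with all ∈-here
    ... | k , refl , le = +-mono-≤ le (wtA≤ f c xs (all ∘ ∈-there))
    wtB≤ : ∀ f c xs → (∀ {z} → z ∈ xs → ∃ λ k → z ≡ inj₂ k × f k ≤ c) → wt (onB f) xs ≤ size xs * c
    wtB≤ f c [] all = z≤n
    wtB≤ f c (z ∷ xs) all with all ∈-here
    ... | k , refl , le = +-mono-≤ le (wtB≤ f c xs (all ∘ ∈-there))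
    wtA≡ : ∀ xs → (∀ {z} → z ∈ xs → ∃ λ k → z ≡ inj₁ k × row G k ≤ d) → wt (onA (λ _ → 1)) xs ≡ size xs
    wtA≡ [] all = refl
    wtA≡ (z ∷ xs) all with all ∈-here
    ... | k , refl , _ = cong suc (wtA≡ xs (all ∘ ∈-there))
    wtB≡ : ∀ xs → (∀ {z} → z ∈ xs → ∃ λ k → z ≡ inj₂ k × row (flip G) k ≤ e) → wt (onB (λ _ → 1)) xs ≡ size xs
    wtB≡ [] all = refl
    wtB≡ (z ∷ xs) all with all ∈-here
    ... | k , refl , _ = cong suc (wtB≡ xs (all ∘ ∈-there))
    ∑α≡ : ∑ α ≡ d
    ∑α≡ = trans (sum-cong-≗ λ k → sym (*-identityʳ (α k))) (trans (∑α (λ _ → 1)) (trans (wtA≡ SA SA-low) size-SA))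
    ∑β≡ : ∑ β ≡ e
    ∑β≡ = trans (sum-cong-≗ λ k → sym (*-identityʳ (β k))) (trans (∑β (λ _ → 1)) (trans (wtB≡ SB SB-low) size-SB))
    bound : edges G + d * n + n * e + 2 ≤ n * n + d * e + d * d + e * e
    bound = ≡-≤-trans (sym (cong₂ (λ a b → edges G + a * n + n * b + 2) ∑α≡ ∑β≡))
      (≤-trans (Indicators.indicators G α β (once (rotations-distinct L) ∘ inj₁) (once (rotations-distinct L′) ∘ inj₂)
        (∉⇒occ≡0 (x∉ ∘ SA⊆P)) (∉⇒occ≡0 p∉SA) (∉⇒occ≡0 q∉SB) (∉⇒occ≡0 (y∉ ∘ SB⊆P))
        (¬E⇒false λ x~q → <⇒≱ high-x (x~q⇒low x∉ x~q)) (¬E⇒false λ p~y → <⇒≱ high-y (y~p⇒low y∉ (E-sym p~y)))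
        (λ { refl → x∉ (∈-resp (λ f → wt-reverse f P) (start-closed L′ (proj₁ (proj₂ last)))) }))
      (+-mono-≤ (+-mono-≤ (≤-reflexive (cong (n * n +_) (cong₂ _*_ ∑α≡ ∑β≡)))
        (≡-≤-trans (∑α (row G)) (≤-trans (wtA≤ (row G) d SA SA-low) (≤-reflexive (cong (_* d) size-SA)))))
        (≡-≤-trans (∑β (row (flip G))) (≤-trans (wtB≤ (row (flip G)) e SB SB-low) (≤-reflexive (cong (_* e) size-SB))))))
    finish : ∀ p q r {d e} → d ≡ 1 + p → e ≡ 1 + q → suc t ≡ d + e + r →
      edges G + d * n + n * e + 2 ≤ n * n + d * e + d * d + e * e → Strict t G
    finish p q r refl refl eq le with suc-injective eq
    ... | refl = ≤-trans (m≤m+n _ ((p + q) * r + p * q)) (≤-by _ _ le (lemma (edges G) p q r))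
      where
      lemma : ∀ E p q r → let t = p + suc q + r; n = 2 + t; d = 1 + p; e = 1 + q in
        suc (E + t) + ((p + q) * r + p * q) + (n * n + d * e + d * d + e * e) ≡ t * n + n + (E + d * n + n * e + 2)
      lemma = solve-∀

-- Unless both outside vertices have larger degree than the end on their side, `low-outside` applies
-- to G or, with the path reversed, to `flip G`.
base-opposite : ∀ {t} (2≤t : 2 ≤ t) (G : BipGraph (2 + t) (2 + t)) (conn : Connected G) {i j P}
  (L : LongestPath.Longest G (inj₁ i) P (inj₂ j)) → Graph.size G P ≤ 3 + (t + t) →
  (∀ {k l P′} → LongestPath.Longest G (inj₁ k) P′ (inj₂ l) → row G k + row (flip G) l ≤ row G i + row (flip G) j) → Result t G
base-opposite {t} 2≤t G conn {i} {j} {P} L short max with outside-A | outside-B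
  where open BaseOpposite 2≤t G conn L short max
... | x , x∉ | y , y∉ with row G x ≤? row G i | row (flip G) y ≤? row (flip G) j
... | yes low | _ = BaseOpposite.low-outside 2≤t G conn L short max x∉ y∉ low
... | no high | no high′ = inj₁ (BaseOpposite.strict 2≤t G conn L short max x∉ y∉ (≰⇒> high) (≰⇒> high′))
... | no _ | yes low = result-flip t G (BaseOpposite.low-outside 2≤t (flip G) (Flip.flip-connected G conn) Lᶠ shortᶠ maxᶠ (∉ᶠ y∉) (∉ᶠ x∉) low)
  where
  open LongestPath using (reverse-longest)
  Lᶠ : LongestPath.Longest (flip G) (inj₁ j) (List.map swap (reverse P)) (inj₂ i)
  Lᶠ = longest-flip G (reverse-longest G L)
  shortᶠ : Graph.size (flip G) (List.map swap (reverse P)) ≤ 3 + (t + t)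
  shortᶠ = ≡-≤-trans (trans (Flip.wt-map (flip G) (λ _ → 1) (reverse P)) (Graph.wt-reverse G _ P)) short
  maxᶠ : ∀ {k l P′} → LongestPath.Longest (flip G) (inj₁ k) P′ (inj₂ l) → row (flip G) k + row G l ≤ row (flip G) j + row G i
  maxᶠ {k} {l} L″ = subst₂ _≤_ (+-comm (row G l) _) (+-comm (row G i) _) (max (reverse-longest G (longest-flip (flip G) L″)))
  ∉ᶠ : ∀ {z} → Graph._∉_ G (swap z) P → Graph._∉_ (flip G) z (List.map swap (reverse P))
  ∉ᶠ {z} z∉ z∈ with Flip.∈-map⁻ (flip G) (reverse P) z∈
  ... | w , w∈ , refl = z∉ (subst (λ z → Graph._∈_ G z P) (swap-swap w) (Graph.∈-resp G (λ f → Graph.wt-reverse G f P) w∈))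
    where
    swap-swap : ∀ (w : Vertex (2 + t) (2 + t)) → w ≡ swap (swap w)
    swap-swap (inj₁ _) = refl
    swap-swap (inj₂ _) = refl

-- The induction

record RemovablePair {a b} (t : ℕ) (G : BipGraph a b) : Set where
  field
    i         : Fin a
    j         : Fin b
    i≁j       : G i j ≡ false
    1≤row     : 1 ≤ row G i
    degrees   : row G i + row (flip G) j ≤ suc t
    removable : Removal.Removable G (Removal.Pair G (inj₁ i) (inj₂ j))

module Ends {t a b : ℕ} (G : BipGraph a b) (conn : Connected G) (t+2≤a : t + 2 ≤ a) (a≤b : a ≤ b) (bd : Bounded G (3 + (t + t))) where
  open Graph G
  open Paths G
  open LongestPath G
  open Removal G
  open Zigzag G using (freshA)

  private
    suct<a : suc t < a
    suct<a = ≡-≤-trans (+-comm 2 t) t+2≤a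

    row≥1 : ∀ {i j} → E (inj₁ i) (inj₂ j) → 1 ≤ row G i
    row≥1 {i} {j} e = ≡-≤-trans (sym (adj#-E e)) (∑-lookup≤ (λ j → ⟦ G i j ⟧) j)

    row≥1′ : ∀ i → Fin b → 1 ≤ row G i
    row≥1′ i j with has-neighbour conn {inj₁ i} {inj₂ j} (λ ())
    ... | inj₂ _ , e = row≥1 e
    ... | inj₁ _ , edge ()

    size≤ : ∀ {u P r} → Longest u P r → size P ≤ 3 + (t + t)
    size≤ L = bd (Longest.wP L) (Longest.dP L)

  opposite-pair : ∀ {i j P} → Longest (inj₁ i) P (inj₂ j) → RemovablePair t G
  opposite-pair {i} {j} {P} L = record
    { i = i ; j = j ; i≁j = ¬E⇒false (Opposite.u≁v L conn (proj₂ out)) ; 1≤row = row≥1′ i j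
    ; degrees = ≡-≤-trans (cong₂ _+_ (trans (sym (deg-inj₁ i)) (Rotation.deg≡wt G L))
        (trans (sym (deg-inj₂ j)) (trans (Rotation.deg≡wt G (reverse-longest L)) (wt-reverse _ P))))
        (≤-trans (Opposite.opposite-count L conn (proj₂ out)) m≤)
    ; removable = opposite-removable L conn (proj₂ out) }
    where
    A≡B : wt nA P ≡ wt nB P
    A≡B = trans (sym (+-identityʳ _)) (trans (alternate (Longest.wP L)) (+-identityʳ _))
    m≤ : wt nB P ≤ suc t
    m≤ = half-opposite P A≡B (size≤ L)
    out : ∃ λ x → inj₁ x ∉ P
    out = freshA P (≤-trans (s≤s (≡-≤-trans A≡B m≤)) suct<a)

  same-pair : ∀ {i i′ P} → Longest (inj₁ i) P (inj₁ i′) → ∀ {Goal : Set} → Dec Goal → (RemovablePair t G → Goal) → Goal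
  same-pair {i} {i′} {P} L dec k = SpanningTree.B-leaf G L conn a≤b dec λ {j} F closed → k (record
    { i = i ; j = j ; i≁j = ¬E⇒false (fork-u≁v L conn F closed) ; 1≤row = row≥1′ i j
    ; degrees = ≡-≤-trans (cong₂ _+_ (sym (deg-inj₁ i)) (sym (deg-inj₂ j)))
        (≤-trans (ForkProperties.fork-count L F refl refl closed)
          (half-same P (trans (sym (+-identityʳ _)) (trans (alternate (Longest.wP L)) (+-comm (wt nB P) 1))) (size≤ L)))
    ; removable = fork-removable L conn F closed })

  -- P has at most t + 1 < a A-vertices, so one lies outside, and `end-degree` in `flip G` makes the
  -- degree of j less than t + 1.
  B-end : ∀ {j j′ P} → Longest (inj₂ j) P (inj₂ j′) → row (flip G) j ≤ t × Removable (_≡ inj₂ j)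
  B-end {j} {j′} {P} L = ≤-pred (≤-trans (≡-≤-trans (cong suc (sym (Graph.deg-inj₁ (flip G) j)))
      (Removal.end-degree (flip G) (longest-flip G L) (Flip.flip-connected G conn) o∉)) (≡-≤-trans nB≡nA m≤)) ,
    end-removable L conn u≢r
    where
    open Longest L
    nB≡nA : Graph.wt (flip G) (Graph.nB (flip G)) (List.map swap P) ≡ wt nA P
    nB≡nA = trans (Flip.wt-map (flip G) (Graph.nB (flip G)) P) (cong-wt P)
      where
      cong-wt : ∀ P → wt (Graph.nB (flip G) ∘ swap) P ≡ wt nA P
      cong-wt []           = refl
      cong-wt (inj₁ _ ∷ P) = cong suc (cong-wt P)
      cong-wt (inj₂ _ ∷ P) = cong-wt P
    B≡suc : wt nB P ≡ suc (wt nA P)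
    B≡suc = sym (trans (+-comm 1 _) (trans (alternate wP) (+-identityʳ _)))
    m≤ : wt nA P ≤ suc t
    m≤ = ≡-≤-trans (sym nB≡nA) (Graph.half-same (flip G) (List.map swap P)
      (trans (trans (Flip.wt-map (flip G) (Graph.nA (flip G)) P) (cong-wt P)) (trans B≡suc (cong suc (sym nB≡nA))))
      (≡-≤-trans (Flip.wt-map (flip G) (λ _ → 1) P) (size≤ L)))
      where
      cong-wt : ∀ P → wt (Graph.nA (flip G) ∘ swap) P ≡ wt nB P
      cong-wt []           = refl
      cong-wt (inj₁ _ ∷ P) = cong-wt P
      cong-wt (inj₂ _ ∷ P) = cong suc (cong-wt P)
    o : ∃ λ x → inj₁ x ∉ P
    o = freshA P (≤-trans (s≤s m≤) suct<a)
    o∉ : Graph._∉_ (flip G) (inj₂ (proj₁ o)) (List.map swap P)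
    o∉ o∈ with Flip.∈-map⁻ (flip G) P o∈
    ... | inj₁ _ , w∈ , refl = proj₂ o w∈
    u≢r : inj₂ j ≢ inj₂ j′
    u≢r refl with has-neighbour conn {inj₂ j} {inj₁ (proj₁ o)} (λ ())
    ... | z , e = <⇒≱ (≤-trans (s≤s (closed-trivial wP dP)) ≤-refl) (longest (e ∷ ⟨ z ⟩) (Zigzag.distinct₂ G λ { refl → E-irrefl e }))
      where
      closed-trivial : ∀ {x P} → Walk x P x → Distinct P → size P ≤ 1
      closed-trivial ⟨ _ ⟩   d = ≤-refl
      closed-trivial (e ∷ w) d = ⊥-elim (∉-tail d (last∈ w))

  longest-exists : Fin a → ∀ {Goal : Set} → Dec Goal → (∀ {u P r} → Longest u P r → Goal) → Goal
  longest-exists i dec k = maximise {X = Σ V λ u → Σ (List V) λ P → Σ V λ r → Walk u P r × Distinct P}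
    (λ { (_ , P , _) → size P }) (3 + (t + t)) (λ { (_ , _ , _ , w , d) → bd w d }) dec
    (inj₁ i , _ , _ , ⟨ inj₁ i ⟩ , distinct-one _)
    λ { (_ , _ , _ , w , d) max → k (record { wP = w ; dP = d ; longest = λ w′ d′ → max (_ , _ , _ , w′ , d′) }) }

base-same : ∀ {t} → 2 ≤ t → (G : BipGraph (2 + t) (2 + t)) → Connected G → Bounded G (3 + (t + t)) →
  ∀ {i i′ P} → LongestPath.Longest G (inj₁ i) P (inj₁ i′) → Result t G
base-same {t} 2≤t G conn bd L = maximise {X = Σ (Fin (2 + t)) λ i → ∃ λ i′ → ∃ λ P → LongestPath.Longest G (inj₁ i) P (inj₁ i′)}
  (λ { (i , _) → row G i }) (2 + t) (λ { (i , _) → row≤b G i }) (result? t G) (_ , _ , _ , L)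
  λ { (_ , _ , _ , L′) max → Base.SameEnds.result 2≤t G conn L′ (bd (Longest.wP L′) (Longest.dP L′)) λ L″ → max (_ , _ , _ , L″) }
  where open LongestPath G

base-opp : ∀ {t} → 2 ≤ t → (G : BipGraph (2 + t) (2 + t)) → Connected G → Bounded G (3 + (t + t)) →
  ∀ {i j P} → LongestPath.Longest G (inj₁ i) P (inj₂ j) → Result t G
base-opp {t} 2≤t G conn bd L = maximise {X = Σ (Fin (2 + t)) λ i → Σ (Fin (2 + t)) λ j → ∃ λ P → LongestPath.Longest G (inj₁ i) P (inj₂ j)}
  (λ { (i , j , _) → row G i + row (flip G) j }) ((2 + t) + (2 + t)) (λ { (i , j , _) → +-mono-≤ (row≤b G i) (row≤b (flip G) j) })
  (result? t G) (_ , _ , _ , L)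
  λ { (_ , _ , _ , L′) max → base-opposite 2≤t G conn L′ (bd (Longest.wP L′) (Longest.dP L′)) λ L″ → max (_ , _ , _ , L″) }
  where open LongestPath G

base : ∀ {t} → 2 ≤ t → (G : BipGraph (2 + t) (2 + t)) → Connected G → Bounded G (3 + (t + t)) → Result t G
base {t} 2≤t G conn bd = Ends.longest-exists G conn (≤-reflexive (+-comm t 2)) ≤-refl bd zero (result? t G) λ
  { {inj₁ _} {_} {inj₁ _} L → base-same 2≤t G conn bd L
  ; {inj₁ _} {_} {inj₂ _} L → base-opp 2≤t G conn bd L
  ; {inj₂ _} {_} {inj₁ _} L → base-opp 2≤t G conn bd (LongestPath.reverse-longest G L)
  ; {inj₂ _} {_} {inj₂ _} L → result-flip t G (base-same 2≤t (flip G) (Flip.flip-connected G conn) (Flip.bounded G bd) (longest-flip G L)) }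

Claim : ℕ → ℕ → ℕ → Set
Claim t a b = (G : BipGraph a b) → Connected G → Bounded G (3 + (t + t)) → Result t G

unbalanced : ∀ {t a b} → 2 ≤ t → t + 2 ≤ a → a ≤ b → Claim t a b → Claim t a (suc b)
unbalanced {t} {zero} 2≤t t+2≤a = case ≤-trans (m≤n+m 2 t) t+2≤a of λ ()
unbalanced {t} {suc a} {b} 2≤t t+2≤a a≤b ih G conn bd =
  longest-exists zero (result? t G) λ
    { {inj₁ _} {_} {inj₁ _} L → same-pair L (result? t G) by-pair
    ; {inj₁ _} {_} {inj₂ _} L → by-pair (opposite-pair L)
    ; {inj₂ _} {_} {inj₁ _} L → by-pair (opposite-pair (LongestPath.reverse-longest G L))
    ; {inj₂ j} {_} {inj₂ _} L → remove j (proj₁ (B-end L)) (proj₂ (B-end L)) }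
  where
  open Ends G conn t+2≤a (≤-trans a≤b (n≤1+n b)) bd
  remove : ∀ j → row (flip G) j ≤ t → Removal.Removable G (_≡ inj₂ j) → Result t G
  remove j low R = step-B G j 2≤t t+2≤a a≤b bd low (ih (delB j G) (delB-connected R) (bounded bd))
    where open DelB G j
  by-pair : RemovablePair t G → Result t G
  -- i has degree at least 1, which leaves at most t for j; so j alone is deleted and i stays.
  by-pair pr = remove j (≤-pred (≤-trans (+-monoˡ-≤ _ 1≤row) degrees)) (single (neighbour G i 1≤row))
    where
    open RemovablePair pr
    single : (∃ λ k → G i k ≡ true) → Removal.Removable G (_≡ inj₂ j)
    single (k , i~k) = Removal.single-removable G {z = inj₂ k} removable (λ ()) (Graph.edge i~k) λ { refl → case trans (sym i~k) i≁j of λ () }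

balanced : ∀ {t n} → 2 ≤ t → t + 2 ≤ n → Claim t n n → Claim t (suc n) (suc n)
balanced {t} {n} 2≤t t+2≤n ih G conn bd =
  Ends.longest-exists G conn t+2≤suc ≤-refl bd zero (result? t G) λ
    { {inj₁ _} {_} {inj₁ _} L → from-same G conn bd L
    ; {inj₁ _} {_} {inj₂ _} L → by-pair G bd (Ends.opposite-pair G conn t+2≤suc ≤-refl bd L)
    ; {inj₂ _} {_} {inj₁ _} L → by-pair G bd (Ends.opposite-pair G conn t+2≤suc ≤-refl bd (LongestPath.reverse-longest G L))
    ; {inj₂ _} {_} {inj₂ _} L → result-flip t G (from-same (flip G) (Flip.flip-connected G conn) (Flip.bounded G bd) (longest-flip G L)) }
  where
  t+2≤suc : t + 2 ≤ suc n
  t+2≤suc = ≤-trans t+2≤n (n≤1+n n)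
  by-pair : ∀ G → Bounded G (3 + (t + t)) → RemovablePair t G → Result t G
  by-pair G bd pr = step-pair G i j 2≤t t+2≤n bd i≁j degrees (ih H (pair-connected removable) (bounded bd))
    where
    open RemovablePair pr
    open DelPair G i j
  from-same : ∀ G → Connected G → Bounded G (3 + (t + t)) → ∀ {i i′ P} → LongestPath.Longest G (inj₁ i) P (inj₁ i′) → Result t G
  from-same G conn bd L = Ends.same-pair G conn t+2≤suc ≤-refl bd L (result? t G) (by-pair G bd)

claim-balanced : ∀ {t} → 2 ≤ t → ∀ d → Claim t (d + (2 + t)) (d + (2 + t))
claim-balanced 2≤t zero    = base 2≤t
claim-balanced {t} 2≤t (suc d) = balanced 2≤t (≡-≤-trans (+-comm t 2) (m≤n+m (2 + t) d)) (claim-balanced 2≤t d)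

claim : ∀ {t a} → 2 ≤ t → t + 2 ≤ a → ∀ d → Claim t a (d + a)
claim {t} {a} 2≤t t+2≤a zero = subst (λ n → Claim t n n) (m∸n+n≡m {a} {2 + t} (≡-≤-trans (+-comm 2 t) t+2≤a)) (claim-balanced 2≤t (a ∸ (2 + t)))
claim {t} {a} 2≤t t+2≤a (suc d) = unbalanced 2≤t t+2≤a (m≤n+m a d) (claim 2≤t t+2≤a d)

-- Isomorphism with B₁(a,b,k)

module ToContainsPath {a b : ℕ} (G : BipGraph a b) where
  open Graph G
  open Paths G
  open Removal G

  size≡length : ∀ xs → size xs ≡ length xs
  size≡length []       = refl
  size≡length (x ∷ xs) = cong suc (size≡length xs)

  lookup-∈ : ∀ xs i → lookup xs i ∈ xs
  lookup-∈ (x ∷ xs) zero    = ∈-here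
  lookup-∈ (x ∷ xs) (suc i) = ∈-there (lookup-∈ xs i)

  lookup-injective : ∀ {xs} → Distinct xs → ∀ {i j} → lookup xs i ≡ lookup xs j → i ≡ j
  lookup-injective {x ∷ xs} d {zero}  {zero}  eq = refl
  lookup-injective {x ∷ xs} d {zero}  {suc j} eq = ⊥-elim (∉-tail d (subst (_∈ xs) (sym eq) (lookup-∈ xs j)))
  lookup-injective {x ∷ xs} d {suc i} {zero}  eq = ⊥-elim (∉-tail d (subst (_∈ xs) eq (lookup-∈ xs i)))
  lookup-injective {x ∷ xs} d {suc i} {suc j} eq = cong suc (lookup-injective (distinct-++ʳ (x ∷ []) d) eq)

  E⇒Adj : ∀ {x y} → E x y → Adj G x y
  E⇒Adj {inj₁ _} {inj₂ _} (edge e) = e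
  E⇒Adj {inj₂ _} {inj₁ _} (edge e) = e

  lookup-adj : ∀ {x xs y} → Walk x xs y → ∀ i j → toℕ j ≡ suc (toℕ i) → Adj G (lookup xs i) (lookup xs j)
  lookup-adj ⟨ _ ⟩ zero zero ()
  lookup-adj (_∷_ {ys = y ∷ ys} e w) zero (suc zero) eq with head≡ w
  ... | refl = E⇒Adj e
  lookup-adj (_∷_ {ys = y ∷ ys} e w) zero (suc (suc _)) ()
  lookup-adj (e ∷ w) (suc i) (suc j) eq = lookup-adj w i j (suc-injective eq)

  containsPath : ∀ {k x xs y} → Walk x xs y → Distinct xs → k ≤ size xs → ContainsPath k G
  containsPath {k} {xs = xs} w d le = (λ i → lookup xs (inject≤ i le′)) ,
    (λ eq → inject≤-injective le′ le′ _ _ (lookup-injective d eq)) ,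
    (λ i j eq → lookup-adj w _ _ (trans (toℕ-inject≤ j le′) (trans eq (cong suc (sym (toℕ-inject≤ i le′))))))
    where
    le′ : k ≤ length xs
    le′ = ≤-trans le (≤-reflexive (size≡length xs))

  bounded-by : ∀ {k} → ¬ ContainsPath (suc k) G → Bounded G k
  bounded-by ¬path w d = ≤-pred (≰⇒> λ le → ¬path (containsPath w d le))

∑-splitAt : ∀ {a b} (f : Vertex a b → ℕ) → ∑ (f ∘ splitAt a) ≡ ∑ (f ∘ inj₁) + ∑ (f ∘ inj₂)
∑-splitAt {zero}  f = refl
∑-splitAt {suc a} f = trans (cong (f (inj₁ zero) +_) (∑-splitAt (f ∘ Sum.map suc (λ j → j)))) (sym (+-assoc (f (inj₁ zero)) _ _))

-- The isomorphism may mix the classes, so the graphs are compared by their degree sums, which are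
-- twice the numbers of edges.
≅⇒edges≡ : ∀ {a b} (G H : BipGraph a b) → G ≅ H → edges G ≡ edges H
≅⇒edges≡ {a} {b} G H (φ , iso) = halve (trans (sym (degree-sum G)) (trans sums (degree-sum H)))
  where
  open Inverse φ using (to)
  ΣV-φ : ∀ f → Graph.ΣV G f ≡ Graph.ΣV G (f ∘ to)
  ΣV-φ f = trans (sym (∑-splitAt f)) (trans (sum-permute (f ∘ splitAt a) π) (trans (sum-cong-≗ λ k → cong f (eq k)) (∑-splitAt (f ∘ to))))
    where
    π : Permutation (a + b) (a + b)
    π = ↔-sym (+↔⊎ {a} {b}) ↔-∘ (φ ↔-∘ +↔⊎ {a} {b})
    eq : ∀ k → splitAt a (π ⟨$⟩ʳ k) ≡ to (splitAt a k)
    eq k = Inverse.strictlyInverseˡ (+↔⊎ {a} {b}) (to (splitAt a k))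
  degree-sum : ∀ (K : BipGraph a b) → Graph.ΣV K (Graph.deg K) ≡ edges K + edges K
  degree-sum K = cong₂ _+_ (sum-cong-≗ (Graph.deg-inj₁ K)) (trans (sum-cong-≗ (Graph.deg-inj₂ K)) (edges-flip K))
  E⇔ : ∀ x y → Graph.adj G x y ≡ Graph.adj H (to x) (to y)
  E⇔ x y with Graph.adj G x y in eqG | Graph.adj H (to x) (to y) in eqH
  ... | true  | true  = refl
  ... | false | false = refl
  ... | true  | false = ⊥-elim (case trans (sym eqH) (Graph.isEdge (Paths.Reach-E H (Equivalence.to (iso x y) (ToContainsPath.E⇒Adj G (Graph.edge eqG))))) of λ ())
  ... | false | true  = ⊥-elim (case trans (sym eqG) (Graph.isEdge (Paths.Reach-E G (Equivalence.from (iso x y) (ToContainsPath.E⇒Adj H (Graph.edge eqH))))) of λ ())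
  sums : Graph.ΣV G (Graph.deg G) ≡ Graph.ΣV H (Graph.deg H)
  sums = trans (Graph.ΣV-cong G λ x → trans (Graph.ΣV-cong G λ y → cong ⟦_⟧ (E⇔ x y)) (sym (ΣV-φ (Graph.adj# H (to x))))) (sym (ΣV-φ (Graph.deg H)))
  halve : ∀ {m n} → m + m ≡ n + n → m ≡ n
  halve {m} {n} eq = *-cancelˡ-≡ m n 2 (trans (lemma m) (trans eq (sym (lemma n))))
    where
    lemma : ∀ m → 2 * m ≡ m + m
    lemma = solve-∀

count< : ∀ {a t} → t ≤ a → ∑ {a} (λ i → ⟦ toℕ i <ᵇ t ⟧) ≡ t
count< {zero}  {zero} _ = refl
count< {suc a} {zero} _ = ∑-zero a
count< {suc a} {suc t} (s≤s le) = cong suc (count< le)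

module _ {a b : ℕ} (k : ℕ) (f : Fin a → Fin b) where
  private
    t : ℕ
    t = tOf k
    B : BipGraph a b
    B = B1 a b k f
    χ : Fin a → ℕ
    χ i = ⟦ toℕ i <ᵇ t ⟧

  row-B1 : ∀ i → row B i + χ i ≡ 1 + χ i * b
  row-B1 i with toℕ i <ᵇ t
  ... | true  = trans (+-comm _ 1) (cong suc (trans (∑-const b 1) (trans (*-identityʳ b) (sym (+-identityʳ b)))))
  ... | false = trans (+-identityʳ _) (trans (sum-cong-≗ λ j → trans (cong ⟦_⟧ (isYes≗does (f i Fin.≟ j))) (sym (*-identityʳ ⟦ does (f i Fin.≟ j) ⟧))) (∑-pick (f i) (λ _ → 1)))

  edges-B1 : t ≤ a → edges B + t ≡ t * b + a
  edges-B1 t≤a = begin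
    edges B + t                    ≡⟨ cong (edges B +_) (sym (count< t≤a)) ⟩
    edges B + ∑ χ                  ≡⟨ sym (∑-distrib-+ (row B) χ) ⟩
    ∑ (λ i → row B i + χ i)        ≡⟨ sum-cong-≗ row-B1 ⟩
    ∑ (λ i → 1 + χ i * b)          ≡⟨ ∑-distrib-+ (λ _ → 1) (λ i → χ i * b) ⟩
    ∑ ones + ∑ (λ i → χ i * b)     ≡⟨ cong₂ _+_ (∑-one a) (∑-*ʳ χ b) ⟩
    a + ∑ χ * b                    ≡⟨ cong (λ s → a + s * b) (count< t≤a) ⟩
    a + t * b                      ≡⟨ +-comm a (t * b) ⟩
    t * b + a                      ∎
    where
    open ≡-Reasoning
    ones : Fin a → ℕ
    ones _ = 1

-- Element `zero` goes to the front if p holds for it and to the very end if not; the others are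
-- arranged by recursion.
sortᵖ : ∀ {n} (p : Fin n → Bool) → Σ (Permutation n n) λ σ → ∀ i → (toℕ (σ ⟨$⟩ʳ i) <ᵇ ∑ (λ i → ⟦ p i ⟧)) ≡ p i
sortᵖ {zero}  p = Perm.id , λ ()
sortᵖ {suc n} p with p zero in eq | sortᵖ (p ∘ suc)
... | true | σ , ok = insert zero zero σ , λ
  { zero    → sym eq
  ; (suc i) → trans (cong (λ k → toℕ k <ᵇ suc (∑ (λ i → ⟦ p (suc i) ⟧))) (insert-punchIn zero zero σ i)) (ok i) }
... | false | σ , ok = insert zero (fromℕ n) σ , λ
  { zero    → trans (trans (cong (_<ᵇ ∑ (λ i → ⟦ p (suc i) ⟧)) (toℕ-fromℕ n)) (≥⇒<ᵇ≡false count≤n)) (sym eq)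
  ; (suc i) → trans (cong (_<ᵇ ∑ (λ i → ⟦ p (suc i) ⟧)) (trans (cong toℕ (insert-punchIn zero (fromℕ n) σ i)) (punchIn-last (σ ⟨$⟩ʳ i)))) (ok i) }
  where
  count≤n : ∑ (λ i → ⟦ p (suc i) ⟧) ≤ n
  count≤n = ≤-trans (∑-mono λ i → ⟦⟧≤1 (p (suc i))) (≤-reflexive (∑-one n))
  ≥⇒<ᵇ≡false : ∀ {m n} → m ≤ n → (n <ᵇ m) ≡ false
  ≥⇒<ᵇ≡false {zero}  _ = refl
  ≥⇒<ᵇ≡false {suc m} (s≤s le) = ≥⇒<ᵇ≡false le
  punchIn-last : ∀ {n} (k : Fin n) → toℕ (punchIn (fromℕ n) k) ≡ toℕ k
  punchIn-last zero    = refl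
  punchIn-last (suc k) = cong suc (punchIn-last k)

two-neighbours : ∀ {a b} (G : BipGraph a b) {i j j′} → G i j ≡ true → G i j′ ≡ true → j ≢ j′ → 2 ≤ row G i
two-neighbours {b = suc b} G {i} {j} {j′} e e′ j≢j′ = ≤-trans (+-mono-≤ (≤-reflexive (cong ⟦_⟧ (sym e)))
  (≡-≤-trans (cong ⟦_⟧ (sym (trans (cong (G i) (punchIn-punchOut j≢j′)) e′))) (∑-lookup≤ (λ k → ⟦ delB j G i k ⟧) (punchOut j≢j′))))
  (≤-reflexive (sym (row-delB j G i)))

-- Sorting the heavy vertices to the front yields the normal form. B stays fixed, and nb is
-- precomposed with the inverse permutation.
core⇒≅ : ∀ {a b} k (G : BipGraph a b) → Core G (tOf k) → (nb : Fin a → Fin b) → (∀ i → ¬ 2 ≤ row G i → G i (nb i) ≡ true) →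
  Σ (Fin a → Fin a) λ τ → G ≅ B1 a b k (nb ∘ τ)
core⇒≅ {a} {b} k G core nb nb-ok = σ ⟨$⟩ˡ_ , (σ ⊎-↔ ↔-id (Fin b)) , iso
  where
  open Core core
  σ : Permutation a a
  σ = proj₁ (sortᵖ λ i → does (heavy? G i))
  f : Fin a → Fin b
  f = nb ∘ (σ ⟨$⟩ˡ_)
  front : ∀ i → (toℕ (σ ⟨$⟩ʳ i) <ᵇ tOf k) ≡ does (heavy? G i)
  front i = trans (cong (toℕ (σ ⟨$⟩ʳ i) <ᵇ_) (sym count)) (proj₂ (sortᵖ λ i → does (heavy? G i)) i)
  light-row : ∀ i j → ¬ 2 ≤ row G i → ⌊ nb i Fin.≟ j ⌋ ≡ G i j
  light-row i j ¬h with nb i Fin.≟ j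
  ... | yes refl = sym (nb-ok i ¬h)
  ... | no nb≢j with G i j in eq
  ...   | false = refl
  ...   | true  = ⊥-elim (¬h (two-neighbours G (nb-ok i ¬h) eq nb≢j))
  same : ∀ i j → B1 a b k f (σ ⟨$⟩ʳ i) j ≡ G i j
  same i j = trans (cong (λ c → if c then true else ⌊ f (σ ⟨$⟩ʳ i) Fin.≟ j ⌋) (front i)) (go (heavy? G i))
    where
    go : (d : Dec (2 ≤ row G i)) → (if does d then true else ⌊ f (σ ⟨$⟩ʳ i) Fin.≟ j ⌋) ≡ G i j
    go (yes h) = sym (full-row G i (full h) j)
    go (no ¬h) = trans (cong (λ c → ⌊ nb c Fin.≟ j ⌋) (inverseˡ σ)) (light-row i j ¬h)
  iso : ∀ u v → Adj G u v ⇔ Adj (B1 a b k f) (Sum.map (σ ⟨$⟩ʳ_) (λ j → j) u) (Sum.map (σ ⟨$⟩ʳ_) (λ j → j) v)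
  iso (inj₁ i) (inj₂ j) = mk⇔ (trans (same i j)) (trans (sym (same i j)))
  iso (inj₂ j) (inj₁ i) = mk⇔ (trans (same i j)) (trans (sym (same i j)))
  iso (inj₁ _) (inj₁ _) = mk⇔ (λ e → e) (λ e → e)
  iso (inj₂ _) (inj₂ _) = mk⇔ (λ e → e) (λ e → e)

flip-≅ : ∀ {a b a′ b′} (G : BipGraph a b) {H : BipGraph a′ b′} → flip G ≅ H → G ≅ H
flip-≅ G (φ , iso) = φ ↔-∘ swap↔ , λ u v → iso (swap u) (swap v) ⇔-∘ swap-Adj u v
  where
  swap-swap : ∀ {A B : Set} (x : A ⊎ B) → swap (swap x) ≡ x
  swap-swap (inj₁ _) = refl
  swap-swap (inj₂ _) = refl
  swap↔ = mk↔ₛ′ swap swap swap-swap swap-swap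
  swap-Adj : ∀ u v → Adj G u v ⇔ Adj (flip G) (swap u) (swap v)
  swap-Adj (inj₁ _) (inj₂ _) = mk⇔ (λ e → e) (λ e → e)
  swap-Adj (inj₂ _) (inj₁ _) = mk⇔ (λ e → e) (λ e → e)
  swap-Adj (inj₁ _) (inj₁ _) = mk⇔ (λ e → e) (λ e → e)
  swap-Adj (inj₂ _) (inj₂ _) = mk⇔ (λ e → e) (λ e → e)

-- Two pendant vertices with different neighbours would be the ends of a path on 2t+3 vertices.
module SameNeighbour {t a b : ℕ} (G : BipGraph a b) (core : Core G t) (1≤t : 1 ≤ t) (t+2≤b : t + 2 ≤ b)
  (bd : Bounded G (2 + (t + t))) where
  open Graph G
  open Paths G
  open Removal G
  open Zigzag G
  private
    bd′ : Bounded G (3 + (t + t))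
    bd′ w d = ≤-trans (bd w d) (n≤1+n _)
  open Tight G (λ i → i) (λ j → j) (λ eq → eq) (λ eq → eq)
  private
    onto : ∀ {z} → nB z ≡ 1 → z ∉ [] → ∃ λ j → inj₂ j ≡ z
    onto {inj₂ j} _ _ = j , refl
    d[] : Distinct []
    d[] = distinct λ _ → z≤n

    hs′ : List V
    hs′ = fs core bd′ [] onto d[] refl

    -- The path is w′ y′ f, then a zigzag through the other hub vertices to y, then w: 2t + 3
    -- vertices.
    build : ∀ f gs {w w′ y y′} → f ∷ gs ≡ hs′ → ¬ 2 ≤ row G w → ¬ 2 ≤ row G w′ → w ≢ w′ →
      E (inj₁ w) (inj₂ y) → E (inj₁ w′) (inj₂ y′) → y ≢ y′ → ⊥
    build f gs {w} {w′} {y} {y′} eq ¬h ¬h′ w≢w′ w~y w′~y′ y≢y′ = <⇒≱ (≤-reflexive (sym sizes))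
      (bd (w′~y′ ∷ E-sym (complete′ ∈-here refl) ∷ complete′ ∈-here start∈B ∷ (wZ ⋈⟨ E-sym w~y ⟩ ⟨ inj₁ w ⟩)) (distinct λ v →
        ≡-≤-trans (total (λ x → δ x v)) (two-sided dA A∈A dYs (trans (wt-++ nA Ys Bs) (cong (_+ 0) Ys⊆B)) v)))
      where
      Bs As : List V
      Bs = inj₂ y ∷ inj₂ y′ ∷ []
      As = inj₁ w′ ∷ inj₁ w ∷ []
      complete′ : ∀ {g z} → g ∈ f ∷ gs → nB z ≡ 1 → E g z
      complete′ g∈ z∈B = complete core bd′ [] onto d[] refl (subst (_ ∈_) eq g∈) z∈B ∉[]
      size-f∷gs : size (f ∷ gs) ≡ t
      size-f∷gs = trans (cong size eq) (size-fs core bd′ [] onto d[] refl)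
      open Zig (zig [] gs Bs (inj₂ y) (λ g∈ z∈B _ → complete′ (∈-there g∈) z∈B) (⊥-elim ∘ ∉[]) refl ∉[] (distinct₂ (y≢y′ ∘ inj₂-injective))
        (≤-trans (s≤s (≤-reflexive size-f∷gs)) (≤-trans (n≤1+n (suc t)) (≡-≤-trans (+-comm 2 t) t+2≤b))))
      lemma₁ : ∀ w′ y′ f gs Ys y w → w′ + (y′ + (f + (gs + Ys + y + (w + 0)))) ≡ f + gs + (w′ + (w + 0)) + (Ys + (y + (y′ + 0)))
      lemma₁ = solve-∀
      total : ∀ g → wt g (inj₁ w′ ∷ inj₂ y′ ∷ f ∷ Z ++ inj₁ w ∷ []) ≡ wt g ((f ∷ gs) ++ As) + wt g (Ys ++ Bs)
      total g = trans (cong (λ k → g (inj₁ w′) + (g (inj₂ y′) + (g f + k))) (trans (wt-++ g Z _) (cong (_+ (g (inj₁ w) + 0)) (weights g))))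
        (trans (lemma₁ (g (inj₁ w′)) (g (inj₂ y′)) (g f) (wt g gs) (wt g Ys) (g (inj₂ y)) (g (inj₁ w)))
        (sym (cong₂ _+_ (wt-++ g (f ∷ gs) As) (wt-++ g Ys Bs))))
      dA : Distinct ((f ∷ gs) ++ As)
      dA = distinct-≡ (cong (_++ As) (sym eq)) (distinct-fs₂ core bd′ [] onto d[] refl
        (light∉fs core bd′ [] onto d[] refl ¬h′) (light∉fs core bd′ [] onto d[] refl ¬h) (w≢w′ ∘ sym ∘ inj₁-injective))
      A∈A : wt nB ((f ∷ gs) ++ As) ≡ 0
      A∈A = trans (wt-++ nB (f ∷ gs) As) (trans (+-identityʳ _) (trans (cong (wt nB) eq) (Hub.fs⊆A (hub core bd′ [] onto d[] refl))))
      sizes : size (inj₁ w′ ∷ inj₂ y′ ∷ f ∷ Z ++ inj₁ w ∷ []) ≡ 3 + (t + t)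
      sizes = trans (total (λ _ → 1)) (trans (cong₂ _+_ (wt-++ (λ _ → 1) (f ∷ gs) As) (wt-++ (λ _ → 1) Ys Bs))
        (trans (cong (λ k → size (f ∷ gs) + 2 + (k + 2)) sizeYs) (trans (lemma₂ (size gs)) (cong (λ k → 3 + (k + k)) size-f∷gs))))
        where
        lemma₂ : ∀ s → suc s + 2 + (s + 2) ≡ 3 + (suc s + suc s)
        lemma₂ = solve-∀

  same-neighbour : ∀ {w w′ y y′} → ¬ 2 ≤ row G w → ¬ 2 ≤ row G w′ → G w y ≡ true → G w′ y′ ≡ true → y ≡ y′
  same-neighbour {w} {w′} {y} {y′} ¬h ¬h′ e e′ with y Fin.≟ y′
  ... | yes eq = eq
  ... | no y≢y′ with w Fin.≟ w′
  ...   | yes refl = ⊥-elim (¬h (two-neighbours G e e′ y≢y′))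
  ...   | no w≢w′ with hs′ in eq
  ...     | [] = ⊥-elim (<⇒≱ 1≤t (≤-reflexive (trans (sym (size-fs core bd′ [] onto d[] refl)) (cong size eq))))
  ...     | f ∷ gs = ⊥-elim (build f gs (sym eq) ¬h ¬h′ w≢w′ (edge e) (edge e′) y≢y′)

light-neighbours : ∀ {t a b} (G : BipGraph a b) → Core G t → 1 ≤ b → ∃ λ (nb : Fin a → Fin b) → ∀ i → ¬ 2 ≤ row G i → G i (nb i) ≡ true
light-neighbours {b = suc b} G core _ = (λ i → proj₁ (pick i)) , λ i → proj₂ (pick i)
  where
  pick : ∀ i → ∃ λ j → ¬ 2 ≤ row G i → G i j ≡ true
  pick i with heavy? G i
  ... | yes h = zero , λ ¬h → ⊥-elim (¬h h)
  ... | no ¬h with neighbour G i (≤-reflexive (sym (Core.pendant core ¬h)))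
  ...   | j , e = j , λ _ → e

-- The parameters t and r, and the theorem

record Parameters (k a : ℕ) : Set where
  field
    r       : ℕ
    r<2     : r < 2
    k≡      : k ≡ 3 + r + tOf k * 2
    2≤t     : 2 ≤ tOf k
    t+2≤a   : tOf k + 2 ≤ a

-- k = 3 + r + 2t with r < 2. Then t ≤ 1 would give k < 8, and a ≤ t + 1 would give 2a ≤ 2t + 2 < k.
parameters : ∀ {k a} → 8 ≤ k → k ≤ 2 * a → Parameters k a
parameters {k} {a} 8≤k k≤2a = record
  { r = r ; r<2 = r<2 ; k≡ = k≡
  ; 2≤t = ≮⇒≥ λ t<2 → <⇒≱ 8≤k (≡-≤-trans k≡ (+-mono-≤ {3 + r} {5} (+-monoʳ-≤ 3 (<⇒≤ r<2)) (*-monoˡ-≤ 2 (≤-pred t<2))))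
  ; t+2≤a = ≮⇒≥ λ a<t+2 → <⇒≱ (≤-trans (≤-trans (s≤s (*-monoʳ-≤ 2 (≤-pred (≤-trans a<t+2 (≤-reflexive (+-comm t 2)))))) (≡-≤-trans (lemma t) (+-monoˡ-≤ (t * 2) (m≤m+n 3 r)))) (≤-reflexive (sym k≡))) k≤2a }
  where
  t r : ℕ
  t = tOf k
  r = (k ∸ 3) % 2
  r<2 : r < 2
  r<2 = m%n<n (k ∸ 3) 2
  k≡ : k ≡ 3 + r + t * 2
  k≡ = trans (sym (m+[n∸m]≡n {3} {k} (≤-trans (m≤m+n 3 5) 8≤k))) (trans (cong (3 +_) (m≡m%n+[m/n]*n (k ∸ 3) 2)) (sym (+-assoc 3 r (t * 2))))
  lemma : ∀ t → suc (2 * suc t) ≡ 3 + t * 2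
  lemma = solve-∀

module Main {k a b : ℕ} (G : BipGraph a b) (8≤k : 8 ≤ k) (k≤2a : k ≤ 2 * a) (a≤b : a ≤ b) (conn : Connected G) (free : ¬ ContainsPath k G) where
  open Parameters (parameters {k} {a} 8≤k k≤2a)
  private
    t : ℕ
    t = tOf k

    t≤a : t ≤ a
    t≤a = ≤-trans (m≤m+n t 2) t+2≤a

    2≤a : 2 ≤ a
    2≤a = ≤-trans (m≤n+m 2 t) t+2≤a

    2≤b : 2 ≤ b
    2≤b = ≤-trans 2≤a a≤b

    bd₀ : Bounded G (2 + r + t * 2)
    bd₀ = ToContainsPath.bounded-by G (subst (λ k → ¬ ContainsPath k G) k≡ free)

    bd : Bounded G (3 + (t + t))
    bd w d = ≤-trans (bd₀ w d) (≤-trans (+-monoˡ-≤ (t * 2) (+-monoʳ-≤ 2 (≤-pred r<2))) (≤-reflexive (lemma t)))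
      where
      lemma : ∀ t → 2 + 1 + t * 2 ≡ 3 + (t + t)
      lemma = solve-∀

    result : Result t G
    result = subst (λ b → (G : BipGraph a b) → Connected G → Bounded G (3 + (t + t)) → Result t G) (m∸n+n≡m a≤b) (claim 2≤t t+2≤a (b ∸ a)) G conn bd

    bound : edges G + t ≤ t * b + a
    bound = go result
      where
      go : Result t G → edges G + t ≤ t * b + a
      go (inj₁ s) = <⇒≤ s
      go (inj₂ (inj₁ th)) = thin⇒≤ G (<⇒≤ 2≤b) th
      go (inj₂ (inj₂ (refl , th))) = subst (λ e → e + t ≤ t * b + a) (edges-flip G) (thin⇒≤ (flip G) (<⇒≤ 2≤b) th)

    target : t * b + (a ∸ t) + t ≡ t * b + a
    target = trans (+-assoc (t * b) (a ∸ t) t) (cong (t * b +_) (m∸n+n≡m t≤a))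

  upper : edgeCount G ≤ t * b + (a ∸ t)
  upper = subst (_≤ t * b + (a ∸ t)) (sym (edgeCount≡edges G)) (+-cancelʳ-≤ t _ _ (≤-trans bound (≤-reflexive (sym target))))

  extremal : edgeCount G ≡ t * b + (a ∸ t) → Core G t ⊎ (a ≡ b × Core (flip G) t)
  extremal eq = go result
    where
    tight : edges G + t ≡ t * b + a
    tight = trans (cong (_+ t) (trans (sym (edgeCount≡edges G)) eq)) target
    go : Result t G → Core G t ⊎ (a ≡ b × Core (flip G) t)
    go (inj₁ s) = ⊥-elim (<-irrefl tight s)
    go (inj₂ (inj₁ th)) = inj₁ (thin⇒core G 2≤b th (<-irrefl tight))
    go (inj₂ (inj₂ (refl , th))) = inj₂ (refl , thin⇒core (flip G) 2≤a th (<-irrefl tight ∘ strict-flip t G))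

  ≅⇒extremal : ∀ f → G ≅ B1 a b k f → edgeCount G ≡ t * b + (a ∸ t)
  ≅⇒extremal f iso = +-cancelʳ-≡ t _ _ (trans (cong (_+ t) (trans (edgeCount≡edges G) (≅⇒edges≡ G (B1 a b k f) iso)))
    (trans (edges-B1 k f t≤a) (sym target)))

  extremal⇒≅ : edgeCount G ≡ t * b + (a ∸ t) → Σ (Fin a → Fin b) λ f → G ≅ B1 a b k f
  extremal⇒≅ eq = go (extremal eq)
    where
    go : Core G t ⊎ (a ≡ b × Core (flip G) t) → Σ (Fin a → Fin b) λ f → G ≅ B1 a b k f
    go (inj₁ core) = let nb , ok = light-neighbours G core (<⇒≤ 2≤b); τ , iso = core⇒≅ k G core nb ok in nb ∘ τ , iso
    go (inj₂ (refl , core)) = let nb , ok = light-neighbours (flip G) core (<⇒≤ 2≤b); τ , iso = core⇒≅ k (flip G) core nb ok in nb ∘ τ , flip-≅ G iso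

  -- For odd k the path on 2t+3 = k vertices is forbidden as well.
  extremal⇒≅-odd : k % 2 ≡ 1 → edgeCount G ≡ t * b + (a ∸ t) → Σ (Fin b) λ v → G ≅ B1 a b k (λ _ → v)
  extremal⇒≅-odd odd eq = go (extremal eq)
    where
    r≡0 : r ≡ 0
    r≡0 = parity r r<2 (trans (sym ([m+kn]%n≡m%n (3 + r) t 2)) (trans (cong (_% 2) (sym k≡)) odd))
      where
      parity : ∀ r → r < 2 → (3 + r) % 2 ≡ 1 → r ≡ 0
      parity 0 _ _ = refl
      parity 1 _ ()
      parity (suc (suc _)) (s≤s (s≤s ())) _
    bd₂ : Bounded G (2 + (t + t))
    bd₂ w d = ≤-trans (bd₀ w d) (≤-reflexive (trans (cong (λ r → 2 + r + t * 2) r≡0) (lemma t)))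
      where
      lemma : ∀ t → 2 + 0 + t * 2 ≡ 2 + (t + t)
      lemma = solve-∀
    -- Stated for an arbitrary graph so that it applies to `flip G` as well.
    constant : ∀ {b′ a′} (G : BipGraph a′ b′) → Core G t → t + 2 ≤ a′ → t + 2 ≤ b′ → Bounded G (2 + (t + t)) → Σ (Fin b′) λ v → G ≅ B1 a′ b′ k (λ _ → v)
    constant {b′} {suc a′} G core le le′ bd = v , proj₂ (core⇒≅ k G core (λ _ → v) all)
      where
      1≤b′ : 1 ≤ b′
      1≤b′ = ≤-trans (≤-trans (s≤s z≤n) (m≤n+m 2 t)) le′
      nbs : ∃ λ (nb : Fin (suc a′) → Fin b′) → ∀ i → ¬ 2 ≤ row G i → G i (nb i) ≡ true
      nbs = light-neighbours G core 1≤b′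
      light : ∃ λ i → zero ≢ i × ¬ 2 ≤ row G i
      -- The vertex `zero` is arbitrary; only the existence of a light vertex matters.
      light = other-light G (≡-≤-trans (cong (_+ 2) (Core.count core)) le) zero
      v : Fin b′
      v = proj₁ nbs (proj₁ light)
      all : ∀ i → ¬ 2 ≤ row G i → G i v ≡ true
      all i ¬h = trans (cong (G i) (SameNeighbour.same-neighbour G core (<⇒≤ 2≤t) le′ bd
        (proj₂ (proj₂ light)) ¬h (proj₂ nbs _ (proj₂ (proj₂ light))) (proj₂ nbs i ¬h))) (proj₂ nbs i ¬h)
    constant {b′} {zero} G core le = case ≤-trans (m≤n+m 2 t) le of λ ()
    go : Core G t ⊎ (a ≡ b × Core (flip G) t) → Σ (Fin b) λ v → G ≅ B1 a b k (λ _ → v)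
    go (inj₁ core) = constant G core t+2≤a (≤-trans t+2≤a a≤b) bd₂
    go (inj₂ (refl , core)) = let v , iso = constant (flip G) core t+2≤a t+2≤a (Flip.bounded G bd₂) in v , flip-≅ G iso

theorem2 : (k a b : ℕ) → (G : BipGraph a b) →
    8 ≤ k → k ≤ 2 * a → a ≤ b →
    Connected G → ¬ ContainsPath k G →
    (edgeCount G ≤ tOf k * b + (a ∸ tOf k))
    × (k % 2 ≡ 1 →
    (edgeCount G ≡ tOf k * b + (a ∸ tOf k)
    ⇔ Σ (Fin b) (λ v → G ≅ B1 a b k (λ _ → v))))
    × (k % 2 ≡ 0 →
    (edgeCount G ≡ tOf k * b + (a ∸ tOf k)
    ⇔ Σ (Fin a → Fin b) (λ f → G ≅ B1 a b k f)))
theorem2 k a b G 8≤k k≤2a a≤b conn free = upper ,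
  (λ odd → mk⇔ (extremal⇒≅-odd odd) λ { (v , iso) → ≅⇒extremal (λ _ → v) iso }) ,
  (λ _ → mk⇔ extremal⇒≅ λ { (f , iso) → ≅⇒extremal f iso })
  where open Main G 8≤k k≤2a a≤b conn free
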